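{- If a graph $H$ is strongly tree decomposable, then $H$ has Sidorenko's property.
   Context: All graphs are finite and simple. For graphs $H,G$, $\mathrm{Hom}(H,G)$ denotes the set of homomorphisms from $H$ to $G$, i.e. maps $g:V(H)\to V(G)$ such that $\{g(v),g(w)\}\in E(G)$ whenever $\{v,w\}\in E(H)$. A graph $H$ has Sidorenko's property if for every graph $G$, $$|\mathrm{Hom}(H,G)|\ge |V(G)|^{|V(H)|}\left(\frac{2|E(G)|}{|V(G)|^2}\right)^{|E(H)|}.$$ A tree decomposition of a graph $H$ is a pair $(\mathcal{F},\mathcal{T})$ where $\mathcal{F}$ is a family of subsets of $V(H)$ and $\mathcal{T}$ is a tree with vertex set $\mathcal{F}$ such that: (1) $\bigcup_{X\in\mathcal{F}}X=V(H)$; (2) for every edge $\{v,w\}\in E(H)$ there is $X\in\mathcal{F}$ with $v,w\in X$; (3) for $X,Y,Z\in\mathcal{F}$, $X\cap Y\subseteq Z$ whenever $Z$ lies on the path from $X$ to $Y$ in $\mathcal{T}$. A strong tree decomposition is a tree decomposition $(\mathcal{F},\mathcal{T})$ such that additionally: (a) the induced subgraphs $H[X]$, $X\in\mathcal{F}$, are pairwise edge-disjoint trees; (b) for every pair $X,Y\in\mathcal{F}$ adjacent in $\mathcal{T}$, there is an isomorphism fixing $X\cap Y$ (pointwise) between the minimal subtree of $H[X]$ containing $X\cap Y$ and the minimal subtree of $H[Y]$ containing $X\cap Y$. $H$ is strongly tree decomposable if it has a strong tree decomposition. -}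

module Defs where

open import Data.Nat using (ℕ; zero; suc; _+_; _*_; _^_; _≤_; _<ᵇ_)
open import Data.Bool using (Bool; true; false; _∧_)
open import Data.Bool.Properties using () renaming (_≟_ to _≟ᵇ_)
open import Data.Fin using (Fin; toℕ)
open import Data.Fin.Properties using (all?)
open import Data.Fin.Subset using (Subset; _∈_; _∉_; _⊆_; _∩_)
open import Data.Vec using (Vec; []; _∷_; lookup)
open import Data.List using (List; []; _∷_; [_]; map; allFin; concatMap; filter; filterᵇ; length; cartesianProduct)
import Data.List.Membership.Propositional as LM
open import Data.List.Relation.Unary.All using (All)
open import Data.List.Relation.Unary.Unique.Propositional using (Unique)
open import Data.Product using (Σ; ∃; ∃-syntax; _×_; _,_; proj₁; proj₂)
open import Data.Empty using (⊥)
open import Relation.Nullary using (¬_; Dec)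
open import Relation.Nullary.Decidable using (_→-dec_)
open import Relation.Binary.PropositionalEquality using (_≡_)

record Graph : Set where
  field
    n      : ℕ
    adj    : Fin n → Fin n → Bool
    sym    : ∀ i j → adj i j ≡ adj j i
    irrefl : ∀ i → adj i i ≡ false

open Graph public

V : Graph → ℕ
V G = n G

Adj : (G : Graph) → Fin (n G) → Fin (n G) → Set
Adj G i j = adj G i j ≡ true

E : Graph → ℕ
E G = length (filterᵇ (λ p → (toℕ (proj₁ p) <ᵇ toℕ (proj₂ p)) ∧ adj G (proj₁ p) (proj₂ p))
                      (cartesianProduct (allFin (n G)) (allFin (n G))))

allMaps : (m k : ℕ) → List (Vec (Fin k) m)
allMaps zero    k = [ [] ]
allMaps (suc m) k = concatMap (λ i → map (i ∷_) (allMaps m k)) (allFin k)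

IsHom : (H G : Graph) → Vec (Fin (n G)) (n H) → Set
IsHom H G f = ∀ v w → Adj H v w → Adj G (lookup f v) (lookup f w)

isHom? : (H G : Graph) → (f : Vec (Fin (n G)) (n H)) → Dec (IsHom H G f)
isHom? H G f = all? (λ v → all? (λ w →
  (adj H v w ≟ᵇ true) →-dec (adj G (lookup f v) (lookup f w) ≟ᵇ true)))

homCount : Graph → Graph → ℕ
homCount H G = length (filter (isHom? H G) (allMaps (n H) (n G)))

-- Sidorenko's property, with denominators cleared:
--   |Hom(H,G)| ≥ |V(G)|^{|V(H)|} (2|E(G)|/|V(G)|^2)^{|E(H)|}
-- is, for |V(G)| ≥ 1, equivalent to
--   |V(G)|^{|V(H)|} * (2|E(G)|)^{|E(H)|} ≤ |Hom(H,G)| * |V(G)|^{2|E(H)|}.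

Sidorenko : Graph → Set
Sidorenko H = ∀ (G : Graph) → 1 ≤ V G →
  V G ^ V H * (2 * E G) ^ E H ≤ homCount H G * V G ^ (2 * E H)

data Walk (G : Graph) : Fin (n G) → Fin (n G) → List (Fin (n G)) → Set where
  here : ∀ {x} → Walk G x x (x ∷ [])
  step : ∀ {x y z vs} → Adj G x y → Walk G y z vs → Walk G x z (x ∷ vs)

Path : (G : Graph) → Fin (n G) → Fin (n G) → List (Fin (n G)) → Set
Path G x y vs = Walk G x y vs × Unique vs

Within : (G : Graph) → Subset (n G) → List (Fin (n G)) → Set
Within G S vs = All (λ v → v ∈ S) vs

-- G[S] is connected (vacuous when S is empty)
ConnectedOn : (G : Graph) → Subset (n G) → Set
ConnectedOn G S = ∀ x y → x ∈ S → y ∈ S → ∃[ vs ] (Walk G x y vs × Within G S vs)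

HasCycleOn : (G : Graph) → Subset (n G) → Set
HasCycleOn G S = ∃[ x ] ∃[ y ] ∃[ vs ]
  (Path G x y vs × Within G S vs × 3 ≤ length vs × Adj G y x)

-- G[S] is connected and acyclic (S may be empty)
ConnAcyclicOn : (G : Graph) → Subset (n G) → Set
ConnAcyclicOn G S = ConnectedOn G S × ¬ HasCycleOn G S

IsTreeOn : (G : Graph) → Subset (n G) → Set
IsTreeOn G S = (∃[ x ] x ∈ S) × ConnAcyclicOn G S

IsTree : Graph → Set
IsTree G = 1 ≤ n G × (∀ x y → ∃[ vs ] Walk G x y vs)
  × ¬ (∃[ x ] ∃[ y ] ∃[ vs ] (Path G x y vs × 3 ≤ length vs × Adj G y x))

-- Tree decompositions.  The tree T has vertex set Fin (n T); the family F
-- consists of the pairwise distinct bags  bag a , a : Fin (n T),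
-- so T is (an isomorphic copy of) a tree with vertex set F.

record TreeDecomposition (H : Graph) : Set where
  field
    T       : Graph
    T-tree  : IsTree T
    bag     : Fin (n T) → Subset (n H)
    bag-inj : ∀ a b → bag a ≡ bag b → a ≡ b
    cover   : ∀ v → ∃[ a ] v ∈ bag a
    edge    : ∀ v w → Adj H v w → ∃[ a ] (v ∈ bag a × w ∈ bag a)
    interp  : ∀ a b c → (∀ vs → Path T a b vs → c LM.∈ vs) →
              bag a ∩ bag b ⊆ bag c

open TreeDecomposition public

-- S is the minimal subtree of H[X] containing I: I ⊆ S ⊆ X, H[S] is
-- connected and acyclic, and S is contained in every such S'.
-- (When I = ∅ this is the empty subgraph.)
IsMinSubtree : (H : Graph) → (X I S : Subset (n H)) → Set
IsMinSubtree H X I S = I ⊆ S × S ⊆ X × ConnAcyclicOn H S ×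
  (∀ S' → I ⊆ S' → S' ⊆ X → ConnAcyclicOn H S' → S ⊆ S')

IsoFixing : (H : Graph) → (I S₁ S₂ : Subset (n H)) → Set
IsoFixing H I S₁ S₂ = Σ (Fin (n H) → Fin (n H)) λ f → Σ (Fin (n H) → Fin (n H)) λ g →
  ( (∀ v → v ∈ S₁ → f v ∈ S₂)
  × (∀ v → v ∈ S₂ → g v ∈ S₁)
  × (∀ v → v ∈ S₁ → g (f v) ≡ v)
  × (∀ v → v ∈ S₂ → f (g v) ≡ v)
  × (∀ v w → v ∈ S₁ → w ∈ S₁ → adj H v w ≡ adj H (f v) (f w))
  × (∀ v → v ∈ I → f v ≡ v) )

IsStrong : (H : Graph) → TreeDecomposition H → Set
IsStrong H D =
    (∀ a → IsTreeOn H (bag D a))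
  × (∀ a b → ¬ (a ≡ b) → ∀ v w → Adj H v w →
       ¬ (v ∈ bag D a × w ∈ bag D a × v ∈ bag D b × w ∈ bag D b))
  × (∀ a b → Adj (T D) a b →
       ∃[ Sa ] ∃[ Sb ] ( IsMinSubtree H (bag D a) (bag D a ∩ bag D b) Sa
                       × IsMinSubtree H (bag D b) (bag D a ∩ bag D b) Sb
                       × IsoFixing H (bag D a ∩ bag D b) Sa Sb ))

StronglyTreeDecomposable : Graph → Set
StronglyTreeDecomposable H = Σ (TreeDecomposition H) (IsStrong H)

{-# OPTIONS --safe #-}
module Submission where

-- For a tree X, the branching random walk on G (start with probability proportional to
-- the degree, then move to uniform neighbours) is a distribution P_X on homomorphisms
-- X → G whose marginal on a subtree S is P_S.  If bags X, Y are adjacent in the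
-- decomposition tree, the isomorphism of the minimal subtrees shows that P_X and P_Y have
-- the same marginal on X ∩ Y, so all P_X can be glued, conditionally independently, into
-- one distribution p on homomorphisms H → G.  The usual proof compares the entropy of p
-- with that of its marginals.  Here the logarithms are avoided: with the degree
-- distribution μ and all densities taken relative to the uniform measure, and with the
-- edge density ρ = 2|E(G)| / |V(G)|², the functions
--   ρ^(-|E(H)|) / p,   Π_{v ∈ X ∩ Y} μ(h v) / p_{X ∩ Y}(h)  for each glued pair of bags,
--   1 / μ(h v)  taken deg v - 1 times for each vertex v
-- multiply to 1, and all but the first have mean at most 1 under p.  By AM-GM the mean
-- of their sum is at least their number, so the first has mean at least 1; but its mean
-- is at most ρ^(-|E(H)|) times the homomorphism density of H in G.

-- The cancellation rests on the shape of a tree density: the product of `μ` over the vertices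
-- times, over the edges, the density of a random edge divided by `μ` at both ends. Since the bags
-- are edge-disjoint and cover all edges, every edge of H enters exactly once, and on a homomorphism
-- the edge density is the constant 1/ρ; each vertex v is left with the exponent 1 - deg v. All
-- exponents are integers, so AM-GM for a plain list suffices, no roots appear, and nonnegative
-- rationals are enough. Only at isolated vertices would the exponent have the wrong sign, and these
-- are placed uniformly instead. The marginal on X ∩ Y has no product formula, since X ∩ Y need not
-- be connected; the argument asks only that both bags induce the same one, and compares it with a
-- product measure of mass 1. Densities may vanish: with 0 as the inverse of 0, means that would
-- equal 1 are at most 1, which is the direction that is needed.

open import Defs renaming (n to ∣_∣ᵛ; sym to adj-sym; irrefl to adj-irrefl)
open import Algebra.Bundles using (CommutativeMonoid; CommutativeSemiring)
open import Algebra.Properties.Group using (∙-cancelˡ)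
open import Algebra.Structures using (IsCommutativeSemiring)
open import Data.Bool using (Bool; true; false; _∧_; _∨_; not; if_then_else_)
open import Data.Bool.Properties using (∨-identityʳ; ∧-identityʳ) renaming (_≟_ to _≟ᵇ_)
open import Data.Empty using (⊥; ⊥-elim)
open import Data.Fin using (Fin; zero; suc; toℕ; fromℕ<)
open import Data.Fin.Properties using (_≟_; suc-injective; toℕ-injective)
open import Data.Fin.Subset using (_∩_) renaming (_∈_ to _∈ˢ_)
open import Data.Fin.Subset.Properties using (x∈p∩q⁺; nonempty?)
open import Data.List using (List; []; _∷_; _++_; length; map; foldr; filter; filterᵇ; allFin; concatMap; replicate; tabulate; cartesianProduct)
open import Data.List.Membership.DecPropositional using () renaming (_∈?_ to ∈?-of)
open import Data.List.Membership.Propositional using (_∈_; _∉_)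
open import Data.List.Membership.Propositional.Properties using (∈-allFin; ∈-filter⁺; ∈-filter⁻; ∈-map⁻)
open import Data.List.Properties using (map-tabulate; map-∘; map-++)
open import Data.List.Relation.Unary.All as All using (All; []; _∷_)
import Data.List.Relation.Unary.All.Properties as Allₚ
open import Data.List.Relation.Unary.AllPairs using ([]; _∷_)
import Data.List.Relation.Unary.Any as Any
import Data.List.Relation.Unary.Unique.Propositional.Properties as Uniqueₚ
open import Data.Nat as ℕ using (ℕ; zero; suc; z≤n; s≤s; _<ᵇ_)
import Data.Nat.Properties as ℕₚ
open import Data.Product using (∃; ∃-syntax; _×_; _,_; proj₁; proj₂)
open import Data.Rational as ℚ using (ℚ; 0ℚ; 1ℚ; NonNegative)
import Data.Rational.Properties as ℚₚ
open import Data.Sum using (_⊎_; inj₁; inj₂)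
open import Data.Vec as Vec using (Vec; []; _∷_; lookup; _[_]≔_)
open import Data.Vec.Properties using (lookup∘updateAt; lookup∘updateAt′; lookup∘tabulate; []≔-commutes; []≔-idempotent; []≔-lookup; []=⇒lookup; lookup⇒[]=)
open import Data.Vec.Relation.Binary.Pointwise.Extensional using (ext; Pointwise-≡⇒≡)
open import Function using (_∘_; id)
open import Relation.Binary.PropositionalEquality using (_≡_; _≢_; refl; sym; trans; cong; cong₂; subst; subst₂; isEquivalence; module ≡-Reasoning)
open import Relation.Nullary using (Dec; yes; no; does)
open import Relation.Unary using (Decidable)

-- Nonnegative rationals

record ℚ⁺ : Set where
  constructor _⟨_⟩
  field
    value   : ℚ
    .nonneg : NonNegative value

open ℚ⁺

value-injective : ∀ {x y} → value x ≡ value y → x ≡ y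
value-injective {_ ⟨ _ ⟩} {._ ⟨ _ ⟩} refl = refl

infixl 6 _+_
infixl 7 _*_

abstract
  0# 1# : ℚ⁺
  0# = 0ℚ ⟨ _ ⟩
  1# = 1ℚ ⟨ _ ⟩

  _+_ _*_ : ℚ⁺ → ℚ⁺ → ℚ⁺
  (p ⟨ p⁺ ⟩) + (q ⟨ q⁺ ⟩) = (p ℚ.+ q) ⟨ ℚₚ.nonNeg+nonNeg⇒nonNeg p {{p⁺}} q {{q⁺}} ⟩
  (p ⟨ p⁺ ⟩) * (q ⟨ q⁺ ⟩) = (p ℚ.* q) ⟨ ℚₚ.nonNeg*nonNeg⇒nonNeg p {{p⁺}} q {{q⁺}} ⟩

  +-*-isCommutativeSemiring : IsCommutativeSemiring _≡_ _+_ _*_ 0# 1#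
  +-*-isCommutativeSemiring = record
    { isSemiring = record
      { isSemiringWithoutAnnihilatingZero = record
        { +-isCommutativeMonoid = record
          { isMonoid = record
            { isSemigroup = record
              { isMagma = record { isEquivalence = isEquivalence ; ∙-cong = cong₂ _+_ }
              ; assoc = λ x y z → value-injective (ℚₚ.+-assoc (value x) (value y) (value z)) }
            ; identity = (λ x → value-injective (ℚₚ.+-identityˡ (value x)))
                       , (λ x → value-injective (ℚₚ.+-identityʳ (value x))) }
          ; comm = λ x y → value-injective (ℚₚ.+-comm (value x) (value y)) }
        ; *-cong = cong₂ _*_
        ; *-assoc = λ x y z → value-injective (ℚₚ.*-assoc (value x) (value y) (value z))
        ; *-identity = (λ x → value-injective (ℚₚ.*-identityˡ (value x)))
                     , (λ x → value-injective (ℚₚ.*-identityʳ (value x)))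
        ; distrib = (λ x y z → value-injective (ℚₚ.*-distribˡ-+ (value x) (value y) (value z)))
                  , (λ x y z → value-injective (ℚₚ.*-distribʳ-+ (value x) (value y) (value z))) }
      ; zero = (λ x → value-injective (ℚₚ.*-zeroˡ (value x)))
             , (λ x → value-injective (ℚₚ.*-zeroʳ (value x))) }
    ; *-comm = λ x y → value-injective (ℚₚ.*-comm (value x) (value y)) }

  1≢0 : 1# ≢ 0#
  1≢0 eq with cong value eq
  ... | ()

  _≟0 : (x : ℚ⁺) → Dec (x ≡ 0#)
  (p ⟨ _ ⟩) ≟0 with p ℚ.≟ 0ℚ
  ... | yes p≡0 = yes (value-injective p≡0)
  ... | no  p≢0 = no (λ eq → p≢0 (cong value eq))

  private
    1/-nonNeg : ∀ p → .(NonNegative p) → (p≢0 : p ≢ 0ℚ) → NonNegative (ℚ.1/_ p {{ℚ.≢-nonZero p≢0}})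
    1/-nonNeg p p⁺ p≢0 = ℚₚ.pos⇒nonNeg (ℚ.1/_ p {{ℚ.≢-nonZero p≢0}})
      {{ℚₚ.1/pos⇒pos p {{ℚₚ.nonNeg∧nonZero⇒pos p {{p⁺}} {{ℚ.≢-nonZero p≢0}}}}}}

  -- The value 0 at 0 frees quotients of densities from side conditions: a quotient by a vanishing
  -- marginal is 0, and `x * inv x` never exceeds 1.
  inv : ℚ⁺ → ℚ⁺
  inv (p ⟨ p⁺ ⟩) with p ℚ.≟ 0ℚ
  ... | yes _   = 0#
  ... | no  p≢0 = (ℚ.1/_ p {{ℚ.≢-nonZero p≢0}}) ⟨ 1/-nonNeg p p⁺ p≢0 ⟩

  *-inv : ∀ {x} → x ≢ 0# → x * inv x ≡ 1#
  *-inv {p ⟨ p⁺ ⟩} x≢0 with p ℚ.≟ 0ℚ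
  ... | yes p≡0 = ⊥-elim (x≢0 (value-injective p≡0))
  ... | no  p≢0 = value-injective (ℚₚ.*-inverseʳ p {{ℚ.≢-nonZero p≢0}})

  +-cancelˡ : ∀ x {y z} → x + y ≡ x + z → y ≡ z
  +-cancelˡ x {y} {z} eq = value-injective (∙-cancelˡ ℚₚ.+-0-group (value x) (value y) (value z) (cong value eq))

  x+y≡0⇒x≡0 : ∀ {x y} → x + y ≡ 0# → x ≡ 0#
  x+y≡0⇒x≡0 {p ⟨ p⁺ ⟩} {q ⟨ q⁺ ⟩} eq = value-injective (ℚₚ.≤-antisym
    (subst (ℚ._≤ 0ℚ) (ℚₚ.+-identityʳ p)
      (ℚₚ.≤-trans (ℚₚ.+-monoʳ-≤ p (ℚₚ.nonNegative⁻¹ q {{q⁺}})) (ℚₚ.≤-reflexive (cong value eq))))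
    (ℚₚ.nonNegative⁻¹ p {{p⁺}}))

  private
    difference : ∀ p q → p ℚ.≤ q → ∀ .p⁺ .q⁺ → ∃ λ z → (p ⟨ p⁺ ⟩) + z ≡ (q ⟨ q⁺ ⟩)
    difference p q p≤q p⁺ q⁺ = (q ℚ.- p) ⟨ ℚ.nonNegative (subst (ℚ._≤ q ℚ.- p) (ℚₚ.+-inverseʳ p) (ℚₚ.+-monoˡ-≤ (ℚ.- p) p≤q)) ⟩ , value-injective lemma
      where
      open ≡-Reasoning
      lemma : p ℚ.+ (q ℚ.- p) ≡ q
      lemma = begin
        p ℚ.+ (q ℚ.- p)      ≡⟨ ℚₚ.+-comm p (q ℚ.- p) ⟩
        q ℚ.- p ℚ.+ p        ≡⟨ ℚₚ.+-assoc q (ℚ.- p) p ⟩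
        q ℚ.+ (ℚ.- p ℚ.+ p)  ≡⟨ cong (q ℚ.+_) (ℚₚ.+-inverseˡ p) ⟩
        q ℚ.+ 0ℚ             ≡⟨ ℚₚ.+-identityʳ q ⟩
        q                    ∎

  total : ∀ x y → (∃ λ z → x + z ≡ y) ⊎ (∃ λ z → y + z ≡ x)
  total (p ⟨ p⁺ ⟩) (q ⟨ q⁺ ⟩) with ℚₚ.≤-total p q
  ... | inj₁ p≤q = inj₁ (difference p q p≤q p⁺ q⁺)
  ... | inj₂ q≤p = inj₂ (difference q p q≤p q⁺ p⁺)

+-*-commutativeSemiring : CommutativeSemiring _ _
+-*-commutativeSemiring = record { isCommutativeSemiring = +-*-isCommutativeSemiring }

open CommutativeSemiring +-*-commutativeSemiring using
  (+-assoc; +-comm; +-identityˡ; +-identityʳ; *-assoc; *-comm; *-identityˡ; *-identityʳ; zeroˡ; zeroʳ; distribˡ; distribʳ)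
  renaming (semiring to +-*-semiring; +-commutativeMonoid to ℚ⁺-+; *-commutativeMonoid to ℚ⁺-*)
open import Algebra.Properties.Semiring.Mult +-*-semiring using (×-homo-+; ×1-homo-*) renaming (_×_ to _×ₙ_)
open import Algebra.Properties.CommutativeSemiring.Exp +-*-commutativeSemiring using (_^_; ^-distrib-*; ^-assocʳ)
open import Algebra.Solver.Ring.NaturalCoefficients.Default +-*-commutativeSemiring using (solve; con; _:=_; _:+_; _:*_)

infix 4 _≤_
-- An order without subtraction: as all elements are nonnegative, a witness for the difference is
-- enough, and monotonicity laws turn into semiring identities.
_≤_ : ℚ⁺ → ℚ⁺ → Set
x ≤ y = ∃ λ z → x + z ≡ y

≤-reflexive : ∀ {x y} → x ≡ y → x ≤ y
≤-reflexive {x} refl = 0# , +-identityʳ x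

≤-refl : ∀ {x} → x ≤ x
≤-refl = ≤-reflexive refl

≤-trans : ∀ {x y z} → x ≤ y → y ≤ z → x ≤ z
≤-trans {x} (u , refl) (v , refl) = u + v , sym (+-assoc x u v)

0≤x : ∀ x → 0# ≤ x
0≤x x = x , +-identityˡ x

x≤0⇒x≡0 : ∀ {x} → x ≤ 0# → x ≡ 0#
x≤0⇒x≡0 (z , eq) = x+y≡0⇒x≡0 eq

x+y≡0⇒y≡0 : ∀ {x y} → x + y ≡ 0# → y ≡ 0#
x+y≡0⇒y≡0 {x} {y} eq = x+y≡0⇒x≡0 (trans (+-comm y x) eq)

+-mono-≤ : ∀ {x y u v} → x ≤ y → u ≤ v → x + u ≤ y + v
+-mono-≤ {x} {_} {u} (a , refl) (b , refl) = a + b ,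
  solve 4 (λ x u a b → (x :+ u) :+ (a :+ b) := (x :+ a) :+ (u :+ b)) refl x u a b

*-monoʳ-≤ : ∀ x {y z} → y ≤ z → x * y ≤ x * z
*-monoʳ-≤ x {y} (a , refl) = x * a , sym (distribˡ x y a)

*-mono-≤ : ∀ {x y u v} → x ≤ y → u ≤ v → x * u ≤ y * v
*-mono-≤ {x} {_} {u} (a , refl) (b , refl) = x * b + a * u + a * b ,
  solve 4 (λ x u a b → x :* u :+ (x :* b :+ a :* u :+ a :* b) := (x :+ a) :* (u :+ b)) refl x u a b

+-cancelˡ-≤ : ∀ x {y z} → x + y ≤ x + z → y ≤ z
+-cancelˡ-≤ x {y} (a , eq) = a , +-cancelˡ x (trans (sym (+-assoc x y a)) eq)

x*y≡0⇒x≡0⊎y≡0 : ∀ {x y} → x * y ≡ 0# → x ≡ 0# ⊎ y ≡ 0#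
x*y≡0⇒x≡0⊎y≡0 {x} {y} eq with x ≟0
... | yes x≡0 = inj₁ x≡0
... | no  x≢0 = inj₂ (begin
  y                ≡⟨ *-identityˡ y ⟨
  1# * y           ≡⟨ cong (_* y) (*-inv x≢0) ⟨
  x * inv x * y    ≡⟨ solve 3 (λ x i y → x :* i :* y := i :* (x :* y)) refl x (inv x) y ⟩
  inv x * (x * y)  ≡⟨ cong (inv x *_) eq ⟩
  inv x * 0#       ≡⟨ zeroʳ _ ⟩
  0#               ∎)
  where open ≡-Reasoning

*-≢0ˡ : ∀ {x y} → x * y ≢ 0# → x ≢ 0#
*-≢0ˡ {y = y} xy≢0 refl = xy≢0 (zeroˡ y)

*-≢0ʳ : ∀ {x y} → x * y ≢ 0# → y ≢ 0#
*-≢0ʳ {x = x} xy≢0 refl = xy≢0 (zeroʳ x)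

*-inv-≤1 : ∀ x → x * inv x ≤ 1#
*-inv-≤1 x with x ≟0
... | yes refl = subst (_≤ 1#) (sym (zeroˡ (inv 0#))) (0≤x 1#)
... | no  x≢0  = ≤-reflexive (*-inv x≢0)

-- For densities the hypothesis is absolute continuity: where a marginal is 0, so is the density,
-- and dividing by the marginal can be undone everywhere.
*-*-inv : ∀ {x} y → (x ≡ 0# → y ≡ 0#) → y * (x * inv x) ≡ y
*-*-inv {x} y 0⇒0 with x ≟0
... | yes x≡0 rewrite 0⇒0 x≡0 = zeroˡ _
... | no  x≢0 = trans (cong (y *_) (*-inv x≢0)) (*-identityʳ y)

x²≡[x+z]²⇒z≡0 : ∀ x z → x * x ≡ (x + z) * (x + z) → z ≡ 0#
x²≡[x+z]²⇒z≡0 x z eq with x*y≡0⇒x≡0⊎y≡0 {z} {z} (x+y≡0⇒x≡0 {z * z} {x * z + z * x} (+-cancelˡ (x * x) (begin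
  x * x + (z * z + (x * z + z * x))
    ≡⟨ solve 2 (λ x z → x :* x :+ (z :* z :+ (x :* z :+ z :* x)) := (x :+ z) :* (x :+ z)) refl x z ⟩
  (x + z) * (x + z) ≡⟨ eq ⟨
  x * x             ≡⟨ +-identityʳ _ ⟨
  x * x + 0#        ∎)))
  where open ≡-Reasoning
... | inj₁ z≡0 = z≡0
... | inj₂ z≡0 = z≡0

-- Needed because an isomorphism of subtrees need not respect the order of the vertices: it visibly
-- preserves only the square of `K`, where every edge occurs in both directions.
square-injective : ∀ {x y} → x * x ≡ y * y → x ≡ y
square-injective {x} {y} eq with total x y
... | inj₁ (z , refl) = sym (trans (cong (x +_) (x²≡[x+z]²⇒z≡0 x z eq)) (+-identityʳ x))
... | inj₂ (z , refl) = trans (cong (y +_) (x²≡[x+z]²⇒z≡0 y z (sym eq))) (+-identityʳ y)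

fromℕ : ℕ → ℚ⁺
fromℕ n = n ×ₙ 1#

fromℕ-+ : ∀ m n → fromℕ (m ℕ.+ n) ≡ fromℕ m + fromℕ n
fromℕ-+ = ×-homo-+ 1#

fromℕ-* : ∀ m n → fromℕ (m ℕ.* n) ≡ fromℕ m * fromℕ n
fromℕ-* = ×1-homo-*

fromℕ-^ : ∀ m k → fromℕ (m ℕ.^ k) ≡ fromℕ m ^ k
fromℕ-^ m zero    = +-identityʳ 1#
fromℕ-^ m (suc k) = trans (fromℕ-* m (m ℕ.^ k)) (cong (fromℕ m *_) (fromℕ-^ m k))

fromℕ-≢0 : ∀ n → fromℕ (suc n) ≢ 0#
fromℕ-≢0 n eq = 1≢0 (x+y≡0⇒x≡0 eq)

fromℕ-cancel-≤ : ∀ m n → fromℕ m ≤ fromℕ n → m ℕ.≤ n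
fromℕ-cancel-≤ zero    n       _ = z≤n
fromℕ-cancel-≤ (suc m) zero    p = ⊥-elim (fromℕ-≢0 m (x≤0⇒x≡0 p))
fromℕ-cancel-≤ (suc m) (suc n) p = s≤s (fromℕ-cancel-≤ m n (+-cancelˡ-≤ 1# p))

1^ : ∀ k → 1# ^ k ≡ 1#
1^ zero    = refl
1^ (suc k) = trans (*-identityˡ _) (1^ k)

-- The arithmetic-geometric mean inequality

sumᴸ prodᴸ : List ℚ⁺ → ℚ⁺
sumᴸ  = foldr _+_ 0#
prodᴸ = foldr _*_ 1#

private
  len : List ℚ⁺ → ℚ⁺
  len xs = fromℕ (length xs)

  -- If t ≤ 1 ≤ b, replacing t, b by t b, 1 does not increase the sum.
  exchange : ∀ {t b} → t ≤ 1# → 1# ≤ b → 1# + t * b ≤ t + b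
  exchange {t} {b} (u , t+u≡1) (z , refl) = u * z , (begin
    1# + t * (1# + z) + u * z  ≡⟨ solve 3 (λ t u z → con 1 :+ t :* (con 1 :+ z) :+ u :* z := t :+ (con 1 :+ (t :+ u) :* z)) refl t u z ⟩
    t + (1# + (t + u) * z)     ≡⟨ cong (λ s → t + (1# + s * z)) t+u≡1 ⟩
    t + (1# + 1# * z)          ≡⟨ cong (λ s → t + (1# + s)) (*-identityˡ z) ⟩
    t + (1# + z)               ∎)
    where open ≡-Reasoning

  am-gm-≥1 : ∀ xs → All (1# ≤_) xs → len xs ≤ sumᴸ xs
  am-gm-≥1 []       []       = ≤-refl
  am-gm-≥1 (x ∷ xs) (p ∷ ps) = +-mono-≤ p (am-gm-≥1 xs ps)

  prod-≤1 : ∀ xs → All (_≤ 1#) xs → prodᴸ xs ≤ 1#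
  prod-≤1 []       []       = ≤-refl
  prod-≤1 (x ∷ xs) (p ∷ ps) = ≤-trans (*-mono-≤ p (prod-≤1 xs ps)) (≤-reflexive (*-identityˡ 1#))

  -- Each entry is at least the whole product, as the others are at most 1; so every entry is at
  -- least 1.
  am-gm-≤1 : ∀ xs → All (_≤ 1#) xs → 1# ≤ prodᴸ xs → len xs ≤ sumᴸ xs
  am-gm-≤1 []       []       _ = ≤-refl
  am-gm-≤1 (x ∷ xs) (p ∷ ps) q = +-mono-≤
    (≤-trans q (≤-trans (*-monoʳ-≤ x (prod-≤1 xs ps)) (≤-reflexive (*-identityʳ x))))
    (am-gm-≤1 xs ps (≤-trans q (≤-trans (*-mono-≤ p ≤-refl) (≤-reflexive (*-identityˡ _)))))

  -- Smoothing, with `t` as the running product: if t ≤ 1 it is merged with an entry b ≥ 1,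
  -- otherwise with an entry a ≤ 1, and by `exchange` the sum does not grow. Once the list of
  -- opposite entries is exhausted, everything lies on one side of 1.
  am-gm-split : ∀ t as bs → All (_≤ 1#) as → All (1# ≤_) bs → 1# ≤ t * (prodᴸ as * prodᴸ bs) →
                1# + (len as + len bs) ≤ t + (sumᴸ as + sumᴸ bs)
  am-gm-split t as bs as≤1 bs≥1 1≤ with total t 1#
  am-gm-split t as [] as≤1 bs≥1 1≤ | inj₁ t≤1 =
    subst₂ _≤_ (cong (1# +_) (sym (+-identityʳ _))) (cong (t +_) (sym (+-identityʳ _)))
      (am-gm-≤1 (t ∷ as) (t≤1 ∷ as≤1) (subst (1# ≤_) (cong (t *_) (*-identityʳ _)) 1≤))
  am-gm-split t as (b ∷ bs) as≤1 (1≤b ∷ bs≥1) 1≤ | inj₁ t≤1 =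
    subst₂ _≤_
      (solve 2 (λ a b → con 1 :+ (con 1 :+ (a :+ b)) := con 1 :+ (a :+ (con 1 :+ b))) refl (len as) (len bs))
      (solve 4 (λ t b sa sb → (t :+ b) :+ (sa :+ sb) := t :+ (sa :+ (b :+ sb))) refl t b (sumᴸ as) (sumᴸ bs))
      (≤-trans (+-mono-≤ (≤-refl {1#}) ih)
        (≤-trans (≤-reflexive (sym (+-assoc 1# (t * b) _))) (+-mono-≤ (exchange t≤1 1≤b) ≤-refl)))
    where
    ih : 1# + (len as + len bs) ≤ t * b + (sumᴸ as + sumᴸ bs)
    ih = am-gm-split (t * b) as bs as≤1 bs≥1 (subst (1# ≤_)
      (solve 4 (λ t b x y → t :* (x :* (b :* y)) := (t :* b) :* (x :* y)) refl t b (prodᴸ as) (prodᴸ bs)) 1≤)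
  am-gm-split t [] bs as≤1 bs≥1 1≤ | inj₂ 1≤t =
    subst₂ _≤_ (cong (1# +_) (sym (+-identityˡ _))) (cong (t +_) (sym (+-identityˡ _)))
      (am-gm-≥1 (t ∷ bs) (1≤t ∷ bs≥1))
  am-gm-split t (a ∷ as) bs (a≤1 ∷ as≤1) bs≥1 1≤ | inj₂ 1≤t =
    subst₂ _≤_
      (solve 2 (λ a b → con 1 :+ (con 1 :+ (a :+ b)) := con 1 :+ ((con 1 :+ a) :+ b)) refl (len as) (len bs))
      (solve 4 (λ t a sa sb → (a :+ t) :+ (sa :+ sb) := t :+ ((a :+ sa) :+ sb)) refl t a (sumᴸ as) (sumᴸ bs))
      (≤-trans (+-mono-≤ (≤-refl {1#}) ih)
        (≤-trans (≤-reflexive (sym (+-assoc 1# (a * t) _))) (+-mono-≤ (exchange a≤1 1≤t) ≤-refl)))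
    where
    ih : 1# + (len as + len bs) ≤ a * t + (sumᴸ as + sumᴸ bs)
    ih = am-gm-split (a * t) as bs as≤1 bs≥1 (subst (1# ≤_)
      (solve 4 (λ t a x y → t :* ((a :* x) :* y) := (a :* t) :* (x :* y)) refl t a (prodᴸ as) (prodᴸ bs)) 1≤)

  -- Sorting the entries by comparison with 1 prepares the smoothing, which starts from an
  -- additional entry 1 that is cancelled from both sides afterwards.
  am-gm-partition : ∀ xs as bs → All (_≤ 1#) as → All (1# ≤_) bs → 1# ≤ prodᴸ xs * (prodᴸ as * prodᴸ bs) →
                    len xs + (len as + len bs) ≤ sumᴸ xs + (sumᴸ as + sumᴸ bs)
  am-gm-partition [] as bs as≤1 bs≥1 1≤ =
    subst₂ _≤_ (sym (+-identityˡ _)) (sym (+-identityˡ _)) (+-cancelˡ-≤ 1# (am-gm-split 1# as bs as≤1 bs≥1 1≤))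
  am-gm-partition (x ∷ xs) as bs as≤1 bs≥1 1≤ with total x 1#
  ... | inj₁ x≤1 = subst₂ _≤_
    (solve 3 (λ l a b → l :+ ((con 1 :+ a) :+ b) := (con 1 :+ l) :+ (a :+ b)) refl (len xs) (len as) (len bs))
    (solve 4 (λ x l a b → l :+ ((x :+ a) :+ b) := (x :+ l) :+ (a :+ b)) refl x (sumᴸ xs) (sumᴸ as) (sumᴸ bs))
    (am-gm-partition xs (x ∷ as) bs (x≤1 ∷ as≤1) bs≥1 (subst (1# ≤_)
      (solve 4 (λ x l a b → (x :* l) :* (a :* b) := l :* ((x :* a) :* b)) refl x (prodᴸ xs) (prodᴸ as) (prodᴸ bs)) 1≤))
  ... | inj₂ 1≤x = subst₂ _≤_
    (solve 3 (λ l a b → l :+ (a :+ (con 1 :+ b)) := (con 1 :+ l) :+ (a :+ b)) refl (len xs) (len as) (len bs))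
    (solve 4 (λ x l a b → l :+ (a :+ (x :+ b)) := (x :+ l) :+ (a :+ b)) refl x (sumᴸ xs) (sumᴸ as) (sumᴸ bs))
    (am-gm-partition xs as (x ∷ bs) as≤1 (1≤x ∷ bs≥1) (subst (1# ≤_)
      (solve 4 (λ x l a b → (x :* l) :* (a :* b) := l :* (a :* (x :* b))) refl x (prodᴸ xs) (prodᴸ as) (prodᴸ bs)) 1≤))

-- Comparing the product with 1 instead of taking its root makes AM-GM a statement about rationals.
am-gm : ∀ xs → 1# ≤ prodᴸ xs → fromℕ (length xs) ≤ sumᴸ xs
am-gm xs 1≤ = subst₂ _≤_
  (solve 1 (λ l → l :+ (con 0 :+ con 0) := l) refl (len xs))
  (solve 1 (λ l → l :+ (con 0 :+ con 0) := l) refl (sumᴸ xs))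
  (am-gm-partition xs [] [] [] [] (subst (1# ≤_) (solve 1 (λ l → l := l :* (con 1 :* con 1)) refl (prodᴸ xs)) 1≤))

-- Finite sums and products

_<ᶠ_ : ∀ {n} → Fin n → Fin n → Bool
i <ᶠ j = toℕ i <ᵇ toℕ j

<ᵇ-trichotomy : ∀ m n → (m ≡ n) ⊎ ((m <ᵇ n) ≡ true × (n <ᵇ m) ≡ false) ⊎ ((m <ᵇ n) ≡ false × (n <ᵇ m) ≡ true)
<ᵇ-trichotomy zero    zero    = inj₁ refl
<ᵇ-trichotomy zero    (suc n) = inj₂ (inj₁ (refl , refl))
<ᵇ-trichotomy (suc m) zero    = inj₂ (inj₂ (refl , refl))
<ᵇ-trichotomy (suc m) (suc n) with <ᵇ-trichotomy m n
... | inj₁ eq = inj₁ (cong suc eq)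
... | inj₂ p  = inj₂ p

<ᶠ-trichotomy : ∀ {n} (i j : Fin n) → (i ≡ j) ⊎ ((i <ᶠ j) ≡ true × (j <ᶠ i) ≡ false) ⊎ ((i <ᶠ j) ≡ false × (j <ᶠ i) ≡ true)
<ᶠ-trichotomy i j with <ᵇ-trichotomy (toℕ i) (toℕ j)
... | inj₁ eq = inj₁ (toℕ-injective eq)
... | inj₂ p  = inj₂ p

∧-trueˡ : ∀ {a b} → (a ∧ b) ≡ true → a ≡ true
∧-trueˡ {true} _ = refl

∧-trueʳ : ∀ {a b} → (a ∧ b) ≡ true → b ≡ true
∧-trueʳ {true} eq = eq

∧-intro : ∀ {a b} → a ≡ true → b ≡ true → (a ∧ b) ≡ true
∧-intro refl refl = refl

∧-falseʳ : ∀ a {b} → b ≡ false → (a ∧ b) ≡ false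
∧-falseʳ true  eq = eq
∧-falseʳ false _  = refl

true≢false : ∀ {b} → b ≡ true → b ≢ false
true≢false refl ()

not-true⇒false : ∀ {b} → b ≢ true → b ≡ false
not-true⇒false {false} _ = refl
not-true⇒false {true}  p = ⊥-elim (p refl)

bool-iff : ∀ {a b} → (a ≡ true → b ≡ true) → (b ≡ true → a ≡ true) → a ≡ b
bool-iff {false} {false} _ _ = refl
bool-iff {false} {true}  _ g = g refl
bool-iff {true}  {_}     f _ = sym (f refl)

module BigOp {c ℓ} (M : CommutativeMonoid c ℓ) where
  open CommutativeMonoid M using (_≈_; _∙_; ε; setoid; identityˡ; identityʳ; ∙-cong; ∙-congˡ; ∙-congʳ; comm; assoc)
    renaming (Carrier to A; refl to ≈-refl; sym to ≈-sym; trans to ≈-trans)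
  import Algebra.Properties.CommutativeMonoid.Sum M as CM
  open import Relation.Binary.Reasoning.Setoid setoid

  -- Abstract, so that the length of a sum can be inferred from its value.
  abstract
    ⨁ : ∀ {n} → (Fin n → A) → A
    ⨁ = CM.sum

    ⨁-zero : (f : Fin 0 → A) → ⨁ f ≡ ε
    ⨁-zero f = refl

    ⨁-suc : ∀ {n} (f : Fin (suc n) → A) → ⨁ f ≡ f zero ∙ ⨁ (f ∘ suc)
    ⨁-suc f = refl

    ⨁-cong : ∀ {n} {f g : Fin n → A} → (∀ i → f i ≈ g i) → ⨁ f ≈ ⨁ g
    ⨁-cong = CM.sum-cong-≋

    ⨁-∙ : ∀ {n} (f g : Fin n → A) → ⨁ (λ i → f i ∙ g i) ≈ ⨁ f ∙ ⨁ g
    ⨁-∙ = CM.∑-distrib-+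

    ⨁-comm : ∀ {m n} (f : Fin m → Fin n → A) → ⨁ (λ i → ⨁ (λ j → f i j)) ≈ ⨁ (λ j → ⨁ (λ i → f i j))
    ⨁-comm = CM.∑-comm

    ⨁-replicate-ε : ∀ n → ⨁ {n} (λ _ → ε) ≈ ε
    ⨁-replicate-ε = CM.sum-replicate-zero

  infix 8 ⟦_⟧_
  ⟦_⟧_ : Bool → A → A
  ⟦ b ⟧ x = if b then x else ε

  ⟦⟧-cong : ∀ {b b′ x y} → b ≡ b′ → x ≈ y → ⟦ b ⟧ x ≈ ⟦ b′ ⟧ y
  ⟦⟧-cong {true}  refl eq = eq
  ⟦⟧-cong {false} refl eq = ≈-refl

  ⟦⟧-congʳ : ∀ b {x y} → (b ≡ true → x ≈ y) → ⟦ b ⟧ x ≈ ⟦ b ⟧ y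
  ⟦⟧-congʳ true  f = f refl
  ⟦⟧-congʳ false f = ≈-refl

  ⟦⟧-∙ : ∀ b x y → ⟦ b ⟧ (x ∙ y) ≈ ⟦ b ⟧ x ∙ ⟦ b ⟧ y
  ⟦⟧-∙ true  x y = ≈-refl
  ⟦⟧-∙ false x y = ≈-sym (identityˡ ε)

  ⨁-ε : ∀ {n} (f : Fin n → A) → (∀ i → f i ≈ ε) → ⨁ f ≈ ε
  ⨁-ε {n} f eq = ≈-trans (⨁-cong eq) (⨁-replicate-ε n)

  ⨁-⟦⟧ : ∀ b {n} (f : Fin n → A) → ⨁ (λ i → ⟦ b ⟧ f i) ≈ ⟦ b ⟧ ⨁ f
  ⨁-⟦⟧ true      f = ≈-refl
  ⨁-⟦⟧ false {n} f = ⨁-replicate-ε n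

  ⨁-single : ∀ {n} (f : Fin n → A) i → (∀ j → j ≢ i → f j ≈ ε) → ⨁ f ≈ f i
  ⨁-single f zero    off rewrite ⨁-suc f = ≈-trans (∙-congˡ (⨁-ε (f ∘ suc) (λ j → off (suc j) (λ ())))) (identityʳ _)
  ⨁-single f (suc i) off rewrite ⨁-suc f = ≈-trans (∙-cong (off zero (λ ())) (⨁-single (f ∘ suc) i (λ j j≢i → off (suc j) (j≢i ∘ suc-injective)))) (identityˡ _)

  ⨁-change : ∀ {n} (f g : Fin n → A) i c → f i ≈ g i ∙ c → (∀ j → j ≢ i → f j ≈ g j) → ⨁ f ≈ ⨁ g ∙ c
  ⨁-change {n} f g i c at off = begin
    ⨁ f                 ≈⟨ ⨁-cong pointwise ⟩
    ⨁ (λ j → g j ∙ δ j) ≈⟨ ⨁-∙ g δ ⟩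
    ⨁ g ∙ ⨁ δ           ≈⟨ ∙-congˡ (⨁-single δ i δ-off) ⟩
    ⨁ g ∙ δ i           ≈⟨ ∙-congˡ δ-at ⟩
    ⨁ g ∙ c             ∎
    where
    δ : Fin n → A
    δ j = ⟦ does (j ≟ i) ⟧ c
    δ-at : δ i ≈ c
    δ-at with i ≟ i
    ... | yes _  = ≈-refl
    ... | no i≢i = ⊥-elim (i≢i refl)
    δ-off : ∀ j → j ≢ i → δ j ≈ ε
    δ-off j j≢i with j ≟ i
    ... | yes j≡i = ⊥-elim (j≢i j≡i)
    ... | no _    = ≈-refl
    pointwise : ∀ j → f j ≈ g j ∙ δ j
    pointwise j with j ≟ i
    ... | yes refl = at
    ... | no j≢i   = ≈-trans (off j j≢i) (≈-sym (identityʳ _))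

  ⨁-change₂ : ∀ {m n} (f g : Fin m → Fin n → A) i j c → f i j ≈ g i j ∙ c →
              (∀ i′ j′ → (i′ ≢ i ⊎ j′ ≢ j) → f i′ j′ ≈ g i′ j′) →
              ⨁ (λ i → ⨁ (f i)) ≈ ⨁ (λ i → ⨁ (g i)) ∙ c
  ⨁-change₂ f g i j c at off = ⨁-change _ _ i c
    (⨁-change (f i) (g i) j c at (λ j′ j′≢j → off i j′ (inj₂ j′≢j)))
    (λ i′ i′≢i → ⨁-cong (λ j′ → off i′ j′ (inj₁ i′≢i)))

  -- Double counting over the graph of `f` on S: the left side consists of its row sums and the
  -- right side of its column sums, since column w contains just the entry at g w if w lies in S′
  -- and nothing otherwise.
  ⨁-reindex : ∀ {m n} (S : Fin m → Bool) (S′ : Fin n → Bool) (f : Fin m → Fin n) (g : Fin n → Fin m) →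
              (∀ v → S v ≡ true → S′ (f v) ≡ true) → (∀ v → S′ v ≡ true → S (g v) ≡ true) →
              (∀ v → S v ≡ true → g (f v) ≡ v) → (∀ v → S′ v ≡ true → f (g v) ≡ v) →
              (F : Fin n → A) → ⨁ (λ v → ⟦ S v ⟧ F (f v)) ≈ ⨁ (λ w → ⟦ S′ w ⟧ F w)
  ⨁-reindex {m} {n} S S′ f g f∈ g∈ gf fg F = begin
    ⨁ (λ v → ⟦ S v ⟧ F (f v))           ≈⟨ ⨁-cong row ⟨
    ⨁ (λ v → ⨁ (λ w → B v w))           ≈⟨ ⨁-comm B ⟩
    ⨁ (λ w → ⨁ (λ v → B v w))           ≈⟨ ⨁-cong column ⟩
    ⨁ (λ w → ⟦ S′ w ⟧ F w)              ∎
    where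
    B : Fin m → Fin n → A
    B v w = ⟦ S v ∧ does (f v ≟ w) ⟧ F w
    B-hit : ∀ v w → f v ≡ w → B v w ≈ ⟦ S v ⟧ F w
    B-hit v w eq with f v ≟ w
    ... | no  ≢ = ⊥-elim (≢ eq)
    ... | yes _ with S v
    ...   | true  = ≈-refl
    ...   | false = ≈-refl
    B-miss : ∀ v w → (S v ≡ true → f v ≢ w) → B v w ≈ ε
    B-miss v w miss with S v
    ... | false = ≈-refl
    ... | true with f v ≟ w
    ...   | yes eq = ⊥-elim (miss refl eq)
    ...   | no  _  = ≈-refl
    row : ∀ v → ⨁ (λ w → B v w) ≈ ⟦ S v ⟧ F (f v)
    row v = ≈-trans (⨁-single (B v) (f v) (λ w w≢ → B-miss v w (λ _ eq → w≢ (sym eq)))) (B-hit v (f v) refl)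
    column : ∀ w → ⨁ (λ v → B v w) ≈ ⟦ S′ w ⟧ F w
    column w with S′ w in S′w
    ... | true = ≈-trans (⨁-single (λ v → B v w) (g w)
                   (λ v v≢ → B-miss v w (λ Sv eq → v≢ (trans (sym (gf v Sv)) (cong g eq)))))
                   (≈-trans (B-hit (g w) w (fg w S′w)) (⟦⟧-cong (g∈ w S′w) ≈-refl))
    ... | false = ⨁-ε _ (λ v → B-miss v w (λ Sv eq → true≢false (subst (λ u → S′ u ≡ true) eq (f∈ v Sv)) S′w))

  -- The handshake principle: a pair i < j carries the contributions of both directions of an edge,
  -- and exchanging the two summations moves the second one to its own place. It serves for the edge
  -- count of G, for the square of `K`, and for collecting the vertex factors of H by degree.
  ⨁-symmetrise : ∀ {n} (b : Fin n → Fin n → Bool) → (∀ i j → b i j ≡ b j i) → (∀ i → b i i ≡ false) →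
                 (c : Fin n → Fin n → A) →
                 ⨁ (λ i → ⨁ (λ j → ⟦ (i <ᶠ j) ∧ b i j ⟧ (c i j ∙ c j i))) ≈ ⨁ (λ i → ⨁ (λ j → ⟦ b i j ⟧ c i j))
  ⨁-symmetrise b b-sym b-irr c = begin
    ⨁ (λ i → ⨁ (λ j → ⟦ (i <ᶠ j) ∧ b i j ⟧ (c i j ∙ c j i)))
      ≈⟨ ⨁-cong (λ i → ≈-trans (⨁-cong (λ j → ⟦⟧-∙ ((i <ᶠ j) ∧ b i j) _ _)) (⨁-∙ _ _)) ⟩
    ⨁ (λ i → ⨁ (λ j → ⟦ (i <ᶠ j) ∧ b i j ⟧ c i j) ∙ ⨁ (λ j → ⟦ (i <ᶠ j) ∧ b i j ⟧ c j i))
      ≈⟨ ⨁-∙ _ _ ⟩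
    ⨁ (λ i → ⨁ (λ j → ⟦ (i <ᶠ j) ∧ b i j ⟧ c i j)) ∙ ⨁ (λ i → ⨁ (λ j → ⟦ (i <ᶠ j) ∧ b i j ⟧ c j i))
      ≈⟨ ∙-congˡ (⨁-comm _) ⟩
    ⨁ (λ i → ⨁ (λ j → ⟦ (i <ᶠ j) ∧ b i j ⟧ c i j)) ∙ ⨁ (λ i → ⨁ (λ j → ⟦ (j <ᶠ i) ∧ b j i ⟧ c i j))
      ≈⟨ ⨁-∙ _ _ ⟨
    ⨁ (λ i → ⨁ (λ j → ⟦ (i <ᶠ j) ∧ b i j ⟧ c i j) ∙ ⨁ (λ j → ⟦ (j <ᶠ i) ∧ b j i ⟧ c i j))
      ≈⟨ ⨁-cong (λ i → ≈-trans (≈-sym (⨁-∙ _ _)) (⨁-cong (pair i))) ⟩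
    ⨁ (λ i → ⨁ (λ j → ⟦ b i j ⟧ c i j)) ∎
    where
    pair : ∀ i j → ⟦ (i <ᶠ j) ∧ b i j ⟧ c i j ∙ ⟦ (j <ᶠ i) ∧ b j i ⟧ c i j ≈ ⟦ b i j ⟧ c i j
    pair i j with <ᶠ-trichotomy i j
    ... | inj₁ refl rewrite b-irr i | ∧-falseʳ (i <ᶠ i) {false} refl = identityˡ ε
    ... | inj₂ (inj₁ (lt , gt)) rewrite lt | gt = identityʳ _
    ... | inj₂ (inj₂ (lt , gt)) rewrite lt | gt | b-sym j i = identityˡ _

  open import Algebra.Definitions.RawMonoid (CommutativeMonoid.rawMonoid M) using () renaming (_×_ to _×ₘ_)

  ⨁ᴸ : List A → A
  ⨁ᴸ = foldr _∙_ ε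

  ⨁ᴸ-++ : ∀ xs ys → ⨁ᴸ (xs ++ ys) ≈ ⨁ᴸ xs ∙ ⨁ᴸ ys
  ⨁ᴸ-++ []       ys = ≈-sym (identityˡ _)
  ⨁ᴸ-++ (x ∷ xs) ys = ≈-trans (∙-congˡ (⨁ᴸ-++ xs ys)) (≈-sym (assoc x _ _))

  ⨁ᴸ-concatMap : ∀ {b c} {B : Set b} {C : Set c} (F : C → A) (k : B → List C) {n} (f : Fin n → B) →
                 ⨁ᴸ (map F (concatMap k (tabulate f))) ≈ ⨁ (λ i → ⨁ᴸ (map F (k (f i))))
  ⨁ᴸ-concatMap F k {zero}  f rewrite ⨁-zero (λ i → ⨁ᴸ (map F (k (f i)))) = ≈-refl
  ⨁ᴸ-concatMap F k {suc n} f
    rewrite ⨁-suc (λ i → ⨁ᴸ (map F (k (f i)))) | map-++ F (k (f zero)) (concatMap k (tabulate (f ∘ suc))) =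
    ≈-trans (⨁ᴸ-++ (map F (k (f zero))) _) (∙-congˡ (⨁ᴸ-concatMap F k (f ∘ suc)))

  private
    _#_·_ : ∀ {b} {B : Set b} → (B → Bool) → List B → A → A
    p # xs · x = length (filterᵇ p xs) ×ₘ x

    #-++ : ∀ {b} {B : Set b} (p : B → Bool) xs ys x → p # (xs ++ ys) · x ≈ p # xs · x ∙ p # ys · x
    #-++ p []       ys x = ≈-sym (identityˡ _)
    #-++ p (z ∷ xs) ys x with p z
    ... | true  = ≈-trans (∙-congˡ (#-++ p xs ys x)) (≈-sym (assoc x _ _))
    ... | false = #-++ p xs ys x

    #-row : ∀ {b c} {B : Set b} {C : Set c} (p : B × C → Bool) i {n} (g : Fin n → C) x →
            p # map (i ,_) (tabulate g) · x ≈ ⨁ (λ j → ⟦ p (i , g j) ⟧ x)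
    #-row p i {zero}  g x rewrite ⨁-zero (λ j → ⟦ p (i , g j) ⟧ x) = ≈-refl
    #-row p i {suc n} g x rewrite ⨁-suc (λ j → ⟦ p (i , g j) ⟧ x) with p (i , g zero)
    ... | true  = ∙-congˡ (#-row p i (g ∘ suc) x)
    ... | false = ≈-trans (#-row p i (g ∘ suc) x) (≈-sym (identityˡ _))

  -- Stated for any commutative monoid because the count in `E` is needed both as a multiple of x,
  -- in sums, and as an exponent of x, in products.
  ⨁-cartesianProduct : ∀ {b c} {B : Set b} {C : Set c} (p : B × C → Bool) {m n} (f : Fin m → B) (g : Fin n → C) x →
    length (filterᵇ p (cartesianProduct (tabulate f) (tabulate g))) ×ₘ x ≈ ⨁ (λ i → ⨁ (λ j → ⟦ p (f i , g j) ⟧ x))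
  ⨁-cartesianProduct p {zero}  f g x rewrite ⨁-zero (λ i → ⨁ (λ j → ⟦ p (f i , g j) ⟧ x)) = ≈-refl
  ⨁-cartesianProduct p {suc m} f g x rewrite ⨁-suc (λ i → ⨁ (λ j → ⟦ p (f i , g j) ⟧ x)) =
    ≈-trans (#-++ p (map (f zero ,_) (tabulate g)) _ x)
            (∙-cong (#-row p (f zero) g x) (⨁-cartesianProduct p (f ∘ suc) g x))

module Sum  = BigOp ℚ⁺-+
module Prod = BigOp ℚ⁺-*

open Sum using () renaming (⨁ to ∑)
open Prod using (⟦_⟧_) renaming (⨁ to ∏)

∑-*ˡ : ∀ {n} x (f : Fin n → ℚ⁺) → x * ∑ f ≡ ∑ (λ i → x * f i)
∑-*ˡ {zero}  x f rewrite Sum.⨁-zero f | Sum.⨁-zero (λ i → x * f i) = zeroʳ x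
∑-*ˡ {suc n} x f rewrite Sum.⨁-suc f | Sum.⨁-suc (λ i → x * f i) =
  trans (distribˡ x _ _) (cong (x * f zero +_) (∑-*ˡ x (f ∘ suc)))

∑-mono-≤ : ∀ {n} {f g : Fin n → ℚ⁺} → (∀ i → f i ≤ g i) → ∑ f ≤ ∑ g
∑-mono-≤ {zero}  {f} {g} f≤g rewrite Sum.⨁-zero f | Sum.⨁-zero g = ≤-refl
∑-mono-≤ {suc n} {f} {g} f≤g rewrite Sum.⨁-suc f | Sum.⨁-suc g = +-mono-≤ (f≤g zero) (∑-mono-≤ (f≤g ∘ suc))

∑≡0 : ∀ {n} {f : Fin n → ℚ⁺} → ∑ f ≡ 0# → ∀ i → f i ≡ 0#
∑≡0 {f = f} eq zero    = x+y≡0⇒x≡0 (trans (sym (Sum.⨁-suc f)) eq)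
∑≡0 {f = f} eq (suc i) = ∑≡0 (x+y≡0⇒y≡0 (trans (sym (Sum.⨁-suc f)) eq)) i

∑-const : ∀ n x → ∑ {n} (λ _ → x) ≡ fromℕ n * x
∑-const zero    x = trans (Sum.⨁-zero (λ _ → x)) (sym (zeroˡ x))
∑-const (suc n) x = begin
  ∑ {suc n} (λ _ → x)   ≡⟨ Sum.⨁-suc (λ _ → x) ⟩
  x + ∑ {n} (λ _ → x)   ≡⟨ cong₂ _+_ (sym (*-identityˡ x)) (∑-const n x) ⟩
  1# * x + fromℕ n * x  ≡⟨ distribʳ x 1# (fromℕ n) ⟨
  fromℕ (suc n) * x     ∎
  where open ≡-Reasoning

∏-≢0 : ∀ {n} {f : Fin n → ℚ⁺} → ∏ f ≢ 0# → ∀ i → f i ≢ 0#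
∏-≢0 {f = f} ne zero    = *-≢0ˡ (subst (_≢ 0#) (Prod.⨁-suc f) ne)
∏-≢0 {f = f} ne (suc i) = ∏-≢0 (*-≢0ʳ (subst (_≢ 0#) (Prod.⨁-suc f) ne)) i

-- Averages and marginals

infix 4 _⊆ᵇ_
_⊆ᵇ_ : ∀ {n} → (Fin n → Bool) → (Fin n → Bool) → Set
S ⊆ᵇ S′ = ∀ v → S v ≡ true → S′ v ≡ true

infixr 6 _∩ᵇ_
infixr 5 _∪ᵇ_
_∩ᵇ_ _∪ᵇ_ : ∀ {n} → (Fin n → Bool) → (Fin n → Bool) → Fin n → Bool
(S ∩ᵇ S′) v = S v ∧ S′ v
(S ∪ᵇ S′) v = S v ∨ S′ v

∨-trueˡ : ∀ {a} b → a ≡ true → (a ∨ b) ≡ true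
∨-trueˡ b refl = refl

∨-trueʳ : ∀ a {b} → b ≡ true → (a ∨ b) ≡ true
∨-trueʳ true  _  = refl
∨-trueʳ false eq = eq

∨-true⁻ : ∀ a {b} → (a ∨ b) ≡ true → a ≡ true ⊎ b ≡ true
∨-true⁻ true  _  = inj₁ refl
∨-true⁻ false eq = inj₂ eq

true-or-false : ∀ b → b ≡ true ⊎ b ≡ false
true-or-false true  = inj₁ refl
true-or-false false = inj₂ refl

module Averaging (N n : ℕ) (n≢0 : fromℕ n ≢ 0#) where

  Ω : Set
  Ω = Vec (Fin n) N

  ν : ℚ⁺
  ν = inv (fromℕ n)

  n*ν≡1 : fromℕ n * ν ≡ 1#
  n*ν≡1 = *-inv n≢0

  ν≢0 : ν ≢ 0#
  ν≢0 = *-≢0ʳ {fromℕ n} (subst (_≢ 0#) (sym n*ν≡1) 1≢0)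

  ν*∑-const : ∀ x → ν * ∑ {n} (λ _ → x) ≡ x
  ν*∑-const x = begin
    ν * ∑ {n} (λ _ → x)  ≡⟨ cong (ν *_) (∑-const n x) ⟩
    ν * (fromℕ n * x)    ≡⟨ solve 3 (λ u m x → u :* (m :* x) := (m :* u) :* x) refl ν (fromℕ n) x ⟩
    fromℕ n * ν * x      ≡⟨ cong (_* x) n*ν≡1 ⟩
    1# * x               ≡⟨ *-identityˡ x ⟩
    x                    ∎
    where open ≡-Reasoning

  evaluate : List (Ω → ℚ⁺) → Ω → List ℚ⁺
  evaluate Fs h = map (λ F → F h) Fs

  -- Measurability with respect to the coordinates in S.
  Dep : (Fin N → Bool) → (Ω → ℚ⁺) → Set
  Dep S F = ∀ h h′ → (∀ v → S v ≡ true → lookup h v ≡ lookup h′ v) → F h ≡ F h′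

  Dep-⊆ : ∀ {S S′ F} → S ⊆ᵇ S′ → Dep S F → Dep S′ F
  Dep-⊆ S⊆S′ dep h h′ agree = dep h h′ (λ v Sv → agree v (S⊆S′ v Sv))

  Dep-* : ∀ {S F G} → Dep S F → Dep S G → Dep S (λ h → F h * G h)
  Dep-* dF dG h h′ agree = cong₂ _*_ (dF h h′ agree) (dG h h′ agree)

  Dep-inv : ∀ {S F} → Dep S F → Dep S (λ h → inv (F h))
  Dep-inv dF h h′ agree = cong inv (dF h h′ agree)

  lookup-≔ : ∀ (h : Ω) v a → lookup (h [ v ]≔ a) v ≡ a
  lookup-≔ h v a = lookup∘updateAt v h

  lookup-≔′ : ∀ (h : Ω) {v u} a → u ≢ v → lookup (h [ v ]≔ a) u ≡ lookup h u
  lookup-≔′ h {v} {u} a u≢v = lookup∘updateAt′ u v u≢v h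

  Dep-≔ : ∀ {S F} → Dep S F → ∀ {v} → S v ≡ false → ∀ h a → F (h [ v ]≔ a) ≡ F h
  Dep-≔ {S} dep Sv≡false h a = dep _ _ (λ u Su → lookup-≔′ h a (λ u≡v → true≢false (subst (λ w → S w ≡ true) u≡v Su) Sv≡false))

  -- The conditional expectation given all coordinates but v. It remains a function on all of `Ω`,
  -- constant in v, so averages compose freely and partial maps are avoided.
  avg : Fin N → (Ω → ℚ⁺) → Ω → ℚ⁺
  avg v F h = ν * ∑ (λ a → F (h [ v ]≔ a))

  Avg : List (Fin N) → (Ω → ℚ⁺) → Ω → ℚ⁺
  Avg []       F = F
  Avg (v ∷ vs) F = avg v (Avg vs F)

  avg-cong : ∀ v F G h → (∀ a → F (h [ v ]≔ a) ≡ G (h [ v ]≔ a)) → avg v F h ≡ avg v G h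
  avg-cong v F G h eq = cong (ν *_) (Sum.⨁-cong eq)

  avg-const : ∀ v F h {c} → (∀ a → F (h [ v ]≔ a) ≡ c) → avg v F h ≡ c
  avg-const v F h {c} eq = trans (cong (ν *_) (Sum.⨁-cong eq)) (ν*∑-const c)

  avg-*ˡ : ∀ v F G h c → (∀ a → F (h [ v ]≔ a) ≡ c * G (h [ v ]≔ a)) → avg v F h ≡ c * avg v G h
  avg-*ˡ v F G h c eq = begin
    ν * ∑ (λ a → F (h [ v ]≔ a))      ≡⟨ cong (ν *_) (Sum.⨁-cong eq) ⟩
    ν * ∑ (λ a → c * G (h [ v ]≔ a))  ≡⟨ cong (ν *_) (∑-*ˡ c _) ⟨
    ν * (c * ∑ (λ a → G (h [ v ]≔ a))) ≡⟨ solve 3 (λ u c s → u :* (c :* s) := c :* (u :* s)) refl ν c _ ⟩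
    c * (ν * ∑ (λ a → G (h [ v ]≔ a))) ∎
    where open ≡-Reasoning

  avg-+ : ∀ v F G h → avg v (λ h → F h + G h) h ≡ avg v F h + avg v G h
  avg-+ v F G h = trans (cong (ν *_) (Sum.⨁-∙ _ _)) (distribˡ ν _ _)

  avg-mono-≤ : ∀ v {F G} → (∀ h → F h ≤ G h) → ∀ h → avg v F h ≤ avg v G h
  avg-mono-≤ v F≤G h = *-monoʳ-≤ ν (∑-mono-≤ (λ a → F≤G _))

  avg-≡0 : ∀ v F h → avg v F h ≡ 0# → F h ≡ 0#
  avg-≡0 v F h eq with x*y≡0⇒x≡0⊎y≡0 eq
  ... | inj₁ ν≡0 = ⊥-elim (ν≢0 ν≡0)
  ... | inj₂ ∑≡ = subst (λ h → F h ≡ 0#) ([]≔-lookup h v) (∑≡0 ∑≡ (lookup h v))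

  avg-idem : ∀ v F h → avg v (avg v F) h ≡ avg v F h
  avg-idem v F h = avg-const v (avg v F) h (λ a → cong (ν *_) (Sum.⨁-cong (λ b → cong F ([]≔-idempotent h v))))

  avg-comm : ∀ u v F h → avg u (avg v F) h ≡ avg v (avg u F) h
  avg-comm u v F h with u ≟ v
  ... | yes refl = refl
  ... | no u≢v = cong (ν *_) (begin
    ∑ (λ a → ν * ∑ (λ b → F ((h [ u ]≔ a) [ v ]≔ b)))  ≡⟨ ∑-*ˡ ν _ ⟨
    ν * ∑ (λ a → ∑ (λ b → F ((h [ u ]≔ a) [ v ]≔ b)))  ≡⟨ cong (ν *_) (Sum.⨁-comm _) ⟩
    ν * ∑ (λ b → ∑ (λ a → F ((h [ u ]≔ a) [ v ]≔ b)))
      ≡⟨ cong (ν *_) (Sum.⨁-cong (λ b → Sum.⨁-cong (λ a → cong F ([]≔-commutes h u v u≢v)))) ⟩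
    ν * ∑ (λ b → ∑ (λ a → F ((h [ v ]≔ b) [ u ]≔ a)))  ≡⟨ ∑-*ˡ ν _ ⟩
    ∑ (λ b → ν * ∑ (λ a → F ((h [ v ]≔ b) [ u ]≔ a)))  ∎)
    where open ≡-Reasoning

  Avg-cong : ∀ vs {F G} → (∀ h → F h ≡ G h) → ∀ h → Avg vs F h ≡ Avg vs G h
  Avg-cong []       eq h = eq h
  Avg-cong (v ∷ vs) {F} {G} eq h = avg-cong v (Avg vs F) (Avg vs G) h (λ a → Avg-cong vs eq _)

  Avg-+ : ∀ vs F G h → Avg vs (λ h → F h + G h) h ≡ Avg vs F h + Avg vs G h
  Avg-+ []       F G h = refl
  Avg-+ (v ∷ vs) F G h = trans (avg-cong v (Avg vs _) (λ h → Avg vs F h + Avg vs G h) h (λ a → Avg-+ vs F G _)) (avg-+ v (Avg vs F) (Avg vs G) h)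

  Avg-mono-≤ : ∀ vs {F G} → (∀ h → F h ≤ G h) → ∀ h → Avg vs F h ≤ Avg vs G h
  Avg-mono-≤ []       F≤G = F≤G
  Avg-mono-≤ (v ∷ vs) F≤G = avg-mono-≤ v (Avg-mono-≤ vs F≤G)

  Avg-≡0 : ∀ vs F h → Avg vs F h ≡ 0# → F h ≡ 0#
  Avg-≡0 []       F h eq = eq
  Avg-≡0 (v ∷ vs) F h eq = Avg-≡0 vs F h (avg-≡0 v (Avg vs F) h eq)

  Avg-const : ∀ vs c h → Avg vs (λ _ → c) h ≡ c
  Avg-const []       c h = refl
  Avg-const (v ∷ vs) c h = avg-const v (Avg vs (λ _ → c)) h (λ a → Avg-const vs c _)

  Avg-*ˡ : ∀ vs c F h → Avg vs (λ h → c * F h) h ≡ c * Avg vs F h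
  Avg-*ˡ []       c F h = refl
  Avg-*ˡ (v ∷ vs) c F h = avg-*ˡ v (Avg vs _) (Avg vs F) h c (λ a → Avg-*ˡ vs c F _)

  Avg-pull : ∀ {S} vs F G → Dep S F → (∀ v → v ∈ vs → S v ≡ false) →
             ∀ h → Avg vs (λ h → F h * G h) h ≡ F h * Avg vs G h
  Avg-pull []       F G dep out h = refl
  Avg-pull (v ∷ vs) F G dep out h = avg-*ˡ v (Avg vs _) (Avg vs G) h (F h) (λ a →
    trans (Avg-pull vs F G dep (λ u u∈ → out u (Any.there u∈)) (h [ v ]≔ a))
          (cong (_* Avg vs G (h [ v ]≔ a)) (Dep-≔ dep (out v (Any.here refl)) h a)))

  Avg-id : ∀ {S} vs F → Dep S F → (∀ v → v ∈ vs → S v ≡ false) → ∀ h → Avg vs F h ≡ F h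
  Avg-id []       F dep out h = refl
  Avg-id (v ∷ vs) F dep out h = avg-const v (Avg vs F) h (λ a →
    trans (Avg-id vs F dep (λ u u∈ → out u (Any.there u∈)) _) (Dep-≔ dep (out v (Any.here refl)) h a))

  Avg-agree : ∀ {S} vs {F} → Dep S F → ∀ h h′ →
              (∀ v → S v ≡ true → v ∉ vs → lookup h v ≡ lookup h′ v) → Avg vs F h ≡ Avg vs F h′
  Avg-agree         []       dep h h′ agree = dep h h′ (λ v Sv → agree v Sv (λ ()))
  Avg-agree {S} (v ∷ vs) dep h h′ agree = cong (ν *_) (Sum.⨁-cong (λ a → Avg-agree vs dep _ _ (agree′ a)))
    where
    agree′ : ∀ a u → S u ≡ true → u ∉ vs → lookup (h [ v ]≔ a) u ≡ lookup (h′ [ v ]≔ a) u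
    agree′ a u Su u∉ with u ≟ v
    ... | yes refl = trans (lookup-≔ h u a) (sym (lookup-≔ h′ u a))
    ... | no u≢v = trans (lookup-≔′ h a u≢v) (trans
      (agree u Su (λ { (Any.here u≡v) → u≢v u≡v ; (Any.there u∈) → u∉ u∈ })) (sym (lookup-≔′ h′ a u≢v)))

  Avg-avg-comm : ∀ vs v F h → Avg vs (avg v F) h ≡ avg v (Avg vs F) h
  Avg-avg-comm []       v F h = refl
  Avg-avg-comm (u ∷ vs) v F h = trans (avg-cong u (Avg vs (avg v F)) (avg v (Avg vs F)) h (λ a → Avg-avg-comm vs v F _)) (avg-comm u v (Avg vs F) h)

  Avg-absorb₁ : ∀ {vs v} → v ∈ vs → ∀ F h → Avg vs (avg v F) h ≡ Avg vs F h
  Avg-absorb₁ {v ∷ vs} (Any.here refl) F h =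
    trans (avg-cong v (Avg vs (avg v F)) (avg v (Avg vs F)) h (λ a → Avg-avg-comm vs v F _)) (avg-idem v (Avg vs F) h)
  Avg-absorb₁ {v ∷ vs} (Any.there u∈)  F h = avg-cong v (Avg vs _) (Avg vs F) h (λ a → Avg-absorb₁ u∈ F _)

  -- Averages commute and are idempotent, so averaging first over coordinates that are averaged
  -- later anyway changes nothing. The tower property of marginals is an instance.
  Avg-absorb : ∀ vs ws → (∀ v → v ∈ ws → v ∈ vs) → ∀ F h → Avg vs (Avg ws F) h ≡ Avg vs F h
  Avg-absorb vs []       ws⊆vs F h = refl
  Avg-absorb vs (w ∷ ws) ws⊆vs F h = trans (Avg-absorb₁ (ws⊆vs w (Any.here refl)) (Avg ws F) h)
    (Avg-absorb vs ws (λ v v∈ → ws⊆vs v (Any.there v∈)) F h)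

  outside : (Fin N → Bool) → List (Fin N)
  outside S = filter (λ v → S v ≟ᵇ false) (allFin N)

  ∈-outside⁺ : ∀ S {v} → S v ≡ false → v ∈ outside S
  ∈-outside⁺ S {v} eq = ∈-filter⁺ (λ v → S v ≟ᵇ false) (∈-allFin v) eq

  ∈-outside⁻ : ∀ S {v} → v ∈ outside S → S v ≡ false
  ∈-outside⁻ S v∈ = proj₂ (∈-filter⁻ (λ v → S v ≟ᵇ false) {xs = allFin N} v∈)

  ∉-outside : ∀ S {v} → v ∉ outside S → S v ≡ true
  ∉-outside S {v} v∉ with true-or-false (S v)
  ... | inj₁ eq = eq
  ... | inj₂ eq = ⊥-elim (v∉ (∈-outside⁺ S eq))

  abstract
    -- The conditional expectation given the coordinates in S; applied to a density, it is the
    -- density of the marginal on S relative to the uniform measure.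
    marg : (Fin N → Bool) → (Ω → ℚ⁺) → Ω → ℚ⁺
    marg S = Avg (outside S)

    marg-cong : ∀ S {F G} → (∀ h → F h ≡ G h) → ∀ h → marg S F h ≡ marg S G h
    marg-cong S = Avg-cong (outside S)

    marg-dep : ∀ S F → Dep S (marg S F)
    marg-dep S F h h′ agree = Avg-agree {λ _ → true} (outside S) whole h h′ λ v _ v∉ →
      agree v (∉-outside S v∉)
      where
      whole : Dep (λ _ → true) F
      whole h h′ agree = cong F (Pointwise-≡⇒≡ (ext (λ v → agree v refl)))

    marg-id : ∀ {S F} → Dep S F → ∀ h → marg S F h ≡ F h
    marg-id {S} {F} dep = Avg-id (outside S) F dep (λ v → ∈-outside⁻ S)

    marg-pull : ∀ {S F} G → Dep S F → ∀ h → marg S (λ h → F h * G h) h ≡ F h * marg S G h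
    marg-pull {S} {F} G dep = Avg-pull (outside S) F G dep (λ v → ∈-outside⁻ S)

    marg-avg : ∀ {S v} → S v ≡ false → ∀ F h → marg S (avg v F) h ≡ marg S F h
    marg-avg {S} eq = Avg-absorb₁ (∈-outside⁺ S eq)

    marg-Avg : ∀ {S} ws → (∀ v → v ∈ ws → S v ≡ false) → ∀ F h → marg S (Avg ws F) h ≡ marg S F h
    marg-Avg {S} ws out = Avg-absorb (outside S) ws (λ v v∈ → ∈-outside⁺ S (out v v∈))

    marg-≡0 : ∀ S F h → marg S F h ≡ 0# → F h ≡ 0#
    marg-≡0 S = Avg-≡0 (outside S)

    marg-tower : ∀ {S S′} → S ⊆ᵇ S′ → ∀ F h → marg S (marg S′ F) h ≡ marg S F h
    marg-tower {S} {S′} S⊆S′ = Avg-absorb (outside S) (outside S′) (λ v v∈ → ∈-outside⁺ S (not-true⇒false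
      (λ Sv → true≢false (S⊆S′ v Sv) (∈-outside⁻ S′ v∈))))

    marg-≗ : ∀ {S S′} → (∀ v → S v ≡ S′ v) → ∀ F h → marg S F h ≡ marg S′ F h
    marg-≗ {S} {S′} eq F h = trans (sym (marg-tower (λ v Sv → trans (sym (eq v)) Sv) F h))
      (marg-id {S} (Dep-⊆ (λ v S′v → trans (eq v) S′v) (marg-dep S′ F)) h)

    -- The coordinates are independent under the uniform measure: averaging a function of the
    -- coordinates in S′ over those outside S leaves only S ∩ S′. Conditioning on S ∩ S′ thus
    -- changes nothing, and the tower property removes the other two.
    marg-∩ : ∀ S S′ F h → marg S (marg S′ F) h ≡ marg (S ∩ᵇ S′) F h
    marg-∩ S S′ F h = begin
      marg S (marg S′ F) h            ≡⟨ marg-id dep h ⟨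
      marg I (marg S (marg S′ F)) h   ≡⟨ marg-tower {I} {S} (λ v → ∧-trueˡ) _ h ⟩
      marg I (marg S′ F) h            ≡⟨ marg-tower {I} {S′} (λ v → ∧-trueʳ {S v}) F h ⟩
      marg I F h                      ∎
      where
      open ≡-Reasoning
      I : Fin N → Bool
      I = S ∩ᵇ S′
      dep : Dep I (marg S (marg S′ F))
      dep h h′ agree = Avg-agree {S′} (outside S) (marg-dep S′ F) h h′
        (λ v S′v v∉ → agree v (∧-intro (∉-outside S v∉) S′v))

    -- The argument stays although the value does not depend on it. In the end it is the constant
    -- map `h₀`, available since G has a vertex.
    𝔼 : (Ω → ℚ⁺) → Ω → ℚ⁺
    𝔼 = Avg (allFin N)

    𝔼-def : ∀ F h → 𝔼 F h ≡ Avg (allFin N) F h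
    𝔼-def F h = refl

    𝔼-cong : ∀ {F G} → (∀ h → F h ≡ G h) → ∀ h → 𝔼 F h ≡ 𝔼 G h
    𝔼-cong = Avg-cong (allFin N)

    𝔼-+ : ∀ F G h → 𝔼 (λ h → F h + G h) h ≡ 𝔼 F h + 𝔼 G h
    𝔼-+ = Avg-+ (allFin N)

    𝔼-mono-≤ : ∀ {F G} → (∀ h → F h ≤ G h) → ∀ h → 𝔼 F h ≤ 𝔼 G h
    𝔼-mono-≤ = Avg-mono-≤ (allFin N)

    𝔼-const : ∀ c h → 𝔼 (λ _ → c) h ≡ c
    𝔼-const = Avg-const (allFin N)

    𝔼-*ˡ : ∀ c F h → 𝔼 (λ h → c * F h) h ≡ c * 𝔼 F h
    𝔼-*ˡ = Avg-*ˡ (allFin N)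

    𝔼-marg : ∀ S F h → 𝔼 (marg S F) h ≡ 𝔼 F h
    𝔼-marg S = Avg-absorb (allFin N) (outside S) (λ v _ → ∈-allFin v)

  -- Under a density G, the mean of a function of the coordinates in S sees only the marginal of G
  -- on S.
  𝔼-marg-* : ∀ {S F} G → Dep S F → ∀ h → 𝔼 (λ h → F h * G h) h ≡ 𝔼 (λ h → F h * marg S G h) h
  𝔼-marg-* {S} {F} G dep h = trans (sym (𝔼-marg S _ h)) (𝔼-cong (marg-pull G dep) h)

  -- Conditionally independent gluing of two densities

  module Gluing {U X : Fin N → Bool} {p P : Ω → ℚ⁺} (depU : Dep U p) (depX : Dep X P)
                (consistent : ∀ h → marg (U ∩ᵇ X) p h ≡ marg (U ∩ᵇ X) P h) where

    q : Ω → ℚ⁺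
    q = marg (U ∩ᵇ X) P

    -- `p` is followed by the conditional density of `P` given the common coordinates: the two parts
    -- are conditionally independent given U ∩ X.
    glue : Ω → ℚ⁺
    glue h = p h * (P h * inv (q h))

    glue-dep : Dep (U ∪ᵇ X) glue
    glue-dep = Dep-* (Dep-⊆ (λ v → ∨-trueˡ (X v)) depU)
      (Dep-* (Dep-⊆ (λ v → ∨-trueʳ (U v)) depX)
             (Dep-inv (Dep-⊆ (λ v I → ∨-trueˡ (X v) (∧-trueˡ I)) (marg-dep (U ∩ᵇ X) P))))

    private
      open ≡-Reasoning
      q-depU : Dep U q
      q-depU = Dep-⊆ (λ v → ∧-trueˡ) (marg-dep (U ∩ᵇ X) P)
      q-depX : Dep X q
      q-depX = Dep-⊆ (λ v → ∧-trueʳ {U v}) (marg-dep (U ∩ᵇ X) P)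

    -- Averaged over the coordinates outside U, `P` leaves its marginal on U ∩ X, which is exactly
    -- the denominator `q`.
    marg-glueˡ : ∀ h → marg U glue h ≡ p h
    marg-glueˡ h = begin
      marg U glue h
        ≡⟨ marg-cong U (λ h → solve 3 (λ p P i → p :* (P :* i) := (p :* i) :* P) refl (p h) (P h) (inv (q h))) h ⟩
      marg U (λ h → p h * inv (q h) * P h) h
        ≡⟨ marg-pull P (Dep-* depU (Dep-inv q-depU)) h ⟩
      p h * inv (q h) * marg U P h
        ≡⟨ cong (p h * inv (q h) *_) (trans (marg-cong U (λ h → sym (marg-id depX h)) h) (marg-∩ U X P h)) ⟩
      p h * inv (q h) * q h
        ≡⟨ solve 3 (λ p i q → p :* i :* q := p :* (q :* i)) refl (p h) (inv (q h)) (q h) ⟩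
      p h * (q h * inv (q h))
        -- A nonnegative function vanishes wherever its average does, and by `consistent` the
        -- average of `p` over the coordinates outside U ∩ X is `q`.
        ≡⟨ *-*-inv (p h) (λ q≡0 → marg-≡0 (U ∩ᵇ X) p h (trans (consistent h) q≡0)) ⟩
      p h ∎

    marg-glueʳ : ∀ h → marg X glue h ≡ P h
    marg-glueʳ h = begin
      marg X glue h
        ≡⟨ marg-cong X (λ h → solve 3 (λ p P i → p :* (P :* i) := (P :* i) :* p) refl (p h) (P h) (inv (q h))) h ⟩
      marg X (λ h → P h * inv (q h) * p h) h
        ≡⟨ marg-pull p (Dep-* depX (Dep-inv q-depX)) h ⟩
      P h * inv (q h) * marg X p h
        ≡⟨ cong (P h * inv (q h) *_) (trans (marg-cong X (λ h → sym (marg-id depU h)) h)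
             (trans (marg-∩ X U p h) (trans (marg-≗ (λ v → ∧-comm (X v) (U v)) p h) (consistent h)))) ⟩
      P h * inv (q h) * q h
        ≡⟨ solve 3 (λ p i q → p :* i :* q := p :* (q :* i)) refl (P h) (inv (q h)) (q h) ⟩
      P h * (q h * inv (q h))
        ≡⟨ *-*-inv (P h) (λ q≡0 → marg-≡0 (U ∩ᵇ X) P h q≡0) ⟩
      P h ∎
      where
      ∧-comm : ∀ a b → (a ∧ b) ≡ (b ∧ a)
      ∧-comm true  true  = refl
      ∧-comm true  false = refl
      ∧-comm false true  = refl
      ∧-comm false false = refl

-- Densities of branching random walks

count : ∀ {n} → (Fin n → Bool) → ℕ
count {zero}  b = 0
count {suc n} b = (if b zero then 1 else 0) ℕ.+ count (b ∘ suc)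

count-positive : ∀ {n} (b : Fin n → Bool) i → b i ≡ true → ∃ λ k → count b ≡ suc k
count-positive b zero    bi rewrite bi = _ , refl
count-positive b (suc i) bi with b zero
... | true  = _ , refl
... | false = count-positive (b ∘ suc) i bi

∏-count : ∀ {n} (b : Fin n → Bool) x → ∏ (λ i → ⟦ b i ⟧ x) ≡ x ^ count b
∏-count {zero}  b x = Prod.⨁-zero _
∏-count {suc n} b x = trans (Prod.⨁-suc _) (trans (cong (⟦ b zero ⟧ x *_) (∏-count (b ∘ suc) x)) cons)
  where
  cons : ⟦ b zero ⟧ x * x ^ count (b ∘ suc) ≡ x ^ count b
  cons with b zero
  ... | true  = refl
  ... | false = *-identityˡ _

∅ᵇ : ∀ {n} → Fin n → Bool
∅ᵇ _ = false

⁅_⁆ : ∀ {n} → Fin n → Fin n → Bool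
⁅ v ⁆ u = does (u ≟ v)

⁅⁆-refl : ∀ {n} (v : Fin n) → ⁅ v ⁆ v ≡ true
⁅⁆-refl v with v ≟ v
... | yes _  = refl
... | no v≢v = ⊥-elim (v≢v refl)

⁅⁆-≢ : ∀ {n} {u v : Fin n} → u ≢ v → ⁅ v ⁆ u ≡ false
⁅⁆-≢ {u = u} {v} u≢v with u ≟ v
... | yes u≡v = ⊥-elim (u≢v u≡v)
... | no _    = refl

⁅⁆-true : ∀ {n} {u v : Fin n} → ⁅ v ⁆ u ≡ true → u ≡ v
⁅⁆-true {u = u} {v} eq with u ≟ v
... | yes u≡v = u≡v

insert : ∀ {n} → Fin n → (Fin n → Bool) → Fin n → Bool
insert v S = S ∪ᵇ ⁅ v ⁆

insert-∈ : ∀ {n} v (S : Fin n → Bool) → insert v S v ≡ true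
insert-∈ v S = ∨-trueʳ (S v) (⁅⁆-refl v)

insert-⊇ : ∀ {n} v (S : Fin n → Bool) → S ⊆ᵇ insert v S
insert-⊇ v S u Su = ∨-trueˡ (⁅ v ⁆ u) Su

insert⁻ : ∀ {n} v (S : Fin n → Bool) {u} → insert v S u ≡ true → S u ≡ true ⊎ u ≡ v
insert⁻ v S {u} eq with ∨-true⁻ (S u) eq
... | inj₁ Su = inj₁ Su
... | inj₂ eq′ = inj₂ (⁅⁆-true eq′)

insert-≢ : ∀ {n} v (S : Fin n → Bool) {u} → u ≢ v → insert v S u ≡ S u
insert-≢ v S {u} u≢v rewrite ⁅⁆-≢ u≢v = ∨-identityʳ (S u)

remove : ∀ {n} → Fin n → (Fin n → Bool) → Fin n → Bool
remove v S u = S u ∧ not (⁅ v ⁆ u)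

module Density (H G : Graph) (n≢0 : fromℕ ∣ G ∣ᵛ ≢ 0#) where

  private
    N = ∣ H ∣ᵛ

  open Averaging N ∣ G ∣ᵛ n≢0

  kernel : ℚ⁺ → Fin ∣ G ∣ᵛ → Fin ∣ G ∣ᵛ → ℚ⁺
  kernel β a b = if adj G a b then β else 0#

  module Kernel (β : ℚ⁺) (normalised : ν * ∑ (λ a → ν * ∑ (λ b → kernel β a b)) ≡ 1#) where

    w : Fin ∣ G ∣ᵛ → Fin ∣ G ∣ᵛ → ℚ⁺
    w = kernel β

    w-sym : ∀ a b → w a b ≡ w b a
    w-sym a b rewrite adj-sym G a b = refl

    -- The density, relative to the uniform measure, of the distribution proportional to the degrees.
    μ₀ : Fin ∣ G ∣ᵛ → ℚ⁺
    μ₀ a = ν * ∑ (λ b → w a b)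

    degree : Fin N → ℕ
    degree v = count (adj H v)

    -- An isolated vertex of H is mapped uniformly: with the weight μ₀ it
    -- would contribute the exponent -1 to the final product.
    weight : ℕ → Fin ∣ G ∣ᵛ → ℚ⁺
    weight zero    a = 1#
    weight (suc _) a = μ₀ a

    μ : Fin N → Fin ∣ G ∣ᵛ → ℚ⁺
    μ v = weight (degree v)

    μ-adjacent : ∀ {u v} → Adj H u v → ∀ a → μ u a ≡ μ₀ a
    μ-adjacent {u} {v} u~v a with degree u | count-positive (adj H u) v u~v
    ... | _ | _ , refl = refl

    avg-μ : ∀ v h → avg v (λ h → μ v (lookup h v)) h ≡ 1#
    avg-μ v h = trans (cong (ν *_) (Sum.⨁-cong (λ a → cong (μ v) (lookup-≔ h v a)))) (mean (degree v))
      where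
      mean : ∀ d → ν * ∑ (weight d) ≡ 1#
      mean zero    = ν*∑-const 1#
      mean (suc d) = normalised

    -- For an edge ij of H, the density of a random oriented edge of G relative to the product of
    -- the laws of its ends: the correlation that an edge adds to independent vertices.
    k : Fin N → Fin N → Fin ∣ G ∣ᵛ → Fin ∣ G ∣ᵛ → ℚ⁺
    k i j a b = w a b * (inv (μ i a) * inv (μ j b))

    k-sym : ∀ i j a b → k i j a b ≡ k j i b a
    k-sym i j a b = cong₂ _*_ (w-sym a b) (*-comm _ _)

    Φ : (Fin N → Bool) → Ω → ℚ⁺
    Φ S h = ∏ (λ v → ⟦ S v ⟧ μ v (lookup h v))

    edgeIn : (Fin N → Bool) → Fin N → Fin N → Bool
    edgeIn S i j = adj H i j ∧ (S i ∧ S j)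

    K : (Fin N → Bool) → Ω → ℚ⁺
    K S h = ∏ (λ i → ∏ (λ j → ⟦ (i <ᶠ j) ∧ edgeIn S i j ⟧ k i j (lookup h i) (lookup h j)))

    -- For a tree H[S], the density of the branching random walk on G indexed by H[S].
    P : (Fin N → Bool) → Ω → ℚ⁺
    P S h = Φ S h * K S h

    Φ-≗ : ∀ {S S′} → (∀ v → S v ≡ S′ v) → ∀ h → Φ S h ≡ Φ S′ h
    Φ-≗ eq h = Prod.⨁-cong (λ v → Prod.⟦⟧-cong (eq v) refl)

    K-≗ : ∀ {S S′} → (∀ v → S v ≡ S′ v) → ∀ h → K S h ≡ K S′ h
    K-≗ eq h = Prod.⨁-cong (λ i → Prod.⨁-cong (λ j → Prod.⟦⟧-cong
      (cong ((i <ᶠ j) ∧_) (cong (adj H i j ∧_) (cong₂ _∧_ (eq i) (eq j)))) refl))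

    P-≗ : ∀ {S S′} → (∀ v → S v ≡ S′ v) → ∀ h → P S h ≡ P S′ h
    P-≗ eq h = cong₂ _*_ (Φ-≗ eq h) (K-≗ eq h)

    Φ-dep : ∀ S → Dep S (Φ S)
    Φ-dep S h h′ agree = Prod.⨁-cong (λ v → Prod.⟦⟧-congʳ (S v) (λ Sv → cong (μ v) (agree v Sv)))

    K-dep : ∀ S → Dep S (K S)
    K-dep S h h′ agree = Prod.⨁-cong (λ i → Prod.⨁-cong (λ j → Prod.⟦⟧-congʳ ((i <ᶠ j) ∧ edgeIn S i j)
      (λ eq → cong₂ (k i j)
        (agree i (∧-trueˡ (∧-trueʳ {adj H i j} (∧-trueʳ {i <ᶠ j} eq))))
        (agree j (∧-trueʳ {S i} (∧-trueʳ {adj H i j} (∧-trueʳ {i <ᶠ j} eq)))))))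

    P-dep : ∀ S → Dep S (P S)
    P-dep S = Dep-* (Φ-dep S) (K-dep S)

    Φ-∅ : ∀ h → Φ ∅ᵇ h ≡ 1#
    Φ-∅ h = Prod.⨁-ε _ (λ v → refl)

    K-∅ : ∀ {S} → (∀ i j → edgeIn S i j ≡ false) → ∀ h → K S h ≡ 1#
    K-∅ none h = Prod.⨁-ε _ (λ i → Prod.⨁-ε _ (λ j → Prod.⟦⟧-cong (∧-falseʳ (i <ᶠ j) (none i j)) refl))

    P-∅ : ∀ h → P ∅ᵇ h ≡ 1#
    P-∅ h = trans (cong₂ _*_ (Φ-∅ h) (K-∅ {∅ᵇ} (λ i j → ∧-falseʳ (adj H i j) refl) h)) (*-identityˡ 1#)

    Φ-insert : ∀ {S v} → S v ≡ false → ∀ h → Φ (insert v S) h ≡ Φ S h * μ v (lookup h v)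
    Φ-insert {S} {v} v∉S h = Prod.⨁-change _ _ v (μ v (lookup h v))
      (trans (Prod.⟦⟧-cong (insert-∈ v S) refl)
        (trans (sym (*-identityˡ _)) (cong (_* μ v (lookup h v)) (Prod.⟦⟧-cong {x = μ v (lookup h v)} (sym v∉S) refl))))
      (λ u u≢v → Prod.⟦⟧-cong (insert-≢ v S u≢v) refl)

    edgeIn-⊆ : ∀ {S S′} → S ⊆ᵇ S′ → ∀ i j → edgeIn S i j ≡ true → edgeIn S′ i j ≡ true
    edgeIn-⊆ {S} S⊆S′ i j eq = ∧-intro {adj H i j} (∧-trueˡ {adj H i j} eq) (∧-intro
      (S⊆S′ i (∧-trueˡ (∧-trueʳ {adj H i j} eq)))
      (S⊆S′ j (∧-trueʳ {S i} (∧-trueʳ {adj H i j} eq))))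

    edgeIn-insert⁻ : ∀ {S u v} → (∀ u′ → S u′ ≡ true → Adj H u′ v → u′ ≡ u) →
                     ∀ i j → edgeIn (insert v S) i j ≡ true →
                     edgeIn S i j ≡ true ⊎ (i ≡ u × j ≡ v) ⊎ (i ≡ v × j ≡ u)
    edgeIn-insert⁻ {S} {u} {v} unique i j eq with ∧-trueˡ {adj H i j} eq | ∧-trueʳ {adj H i j} eq
    ... | i~j | both with insert⁻ v S (∧-trueˡ both) | insert⁻ v S (∧-trueʳ {insert v S i} both)
    ...   | inj₁ i∈S  | inj₁ j∈S  = inj₁ (∧-intro i~j (∧-intro i∈S j∈S))
    ...   | inj₁ i∈S  | inj₂ refl = inj₂ (inj₁ (unique i i∈S i~j , refl))
    ...   | inj₂ refl | inj₁ j∈S  = inj₂ (inj₂ (refl , unique j j∈S (trans (adj-sym H j i) i~j)))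
    ...   | inj₂ refl | inj₂ refl = ⊥-elim (true≢false i~j (adj-irrefl H i))

    -- A vertex with a single neighbour in S adds one edge. `K` stores it at the pair whose smaller
    -- index comes first, hence the two symmetric cases.
    K-insert : ∀ {S u v} → S u ≡ true → S v ≡ false → Adj H u v →
               (∀ u′ → S u′ ≡ true → Adj H u′ v → u′ ≡ u) →
               ∀ h → K (insert v S) h ≡ K S h * k u v (lookup h u) (lookup h v)
    K-insert {S} {u} {v} u∈S v∉S u~v unique h with <ᶠ-trichotomy u v
    ... | inj₁ refl = ⊥-elim (true≢false u∈S v∉S)
    ... | inj₂ (inj₁ (u<v , v≮u)) = Prod.⨁-change₂ _ _ u v _ at
            (λ i j ne → Prod.⟦⟧-cong (bool-iff (new i j ne) (old i j)) refl)
      where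
      at : ⟦ (u <ᶠ v) ∧ edgeIn (insert v S) u v ⟧ k u v (lookup h u) (lookup h v) ≡
           ⟦ (u <ᶠ v) ∧ edgeIn S u v ⟧ k u v (lookup h u) (lookup h v) * k u v (lookup h u) (lookup h v)
      at rewrite u<v | u~v | insert-⊇ v S u u∈S | insert-∈ v S | u∈S | v∉S = sym (*-identityˡ _)
      old : ∀ i j → ((i <ᶠ j) ∧ edgeIn S i j) ≡ true → ((i <ᶠ j) ∧ edgeIn (insert v S) i j) ≡ true
      old i j eq = ∧-intro {i <ᶠ j} (∧-trueˡ {i <ᶠ j} eq) (edgeIn-⊆ (insert-⊇ v S) i j (∧-trueʳ {i <ᶠ j} eq))
      new : ∀ i j → i ≢ u ⊎ j ≢ v → ((i <ᶠ j) ∧ edgeIn (insert v S) i j) ≡ true → ((i <ᶠ j) ∧ edgeIn S i j) ≡ true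
      new i j ne eq with edgeIn-insert⁻ unique i j (∧-trueʳ {i <ᶠ j} eq) | ne
      ... | inj₁ e                    | _         = ∧-intro {i <ᶠ j} (∧-trueˡ {i <ᶠ j} eq) e
      ... | inj₂ (inj₁ (i≡u , j≡v))   | inj₁ i≢u  = ⊥-elim (i≢u i≡u)
      ... | inj₂ (inj₁ (i≡u , j≡v))   | inj₂ j≢v  = ⊥-elim (j≢v j≡v)
      ... | inj₂ (inj₂ (refl , refl)) | _         = ⊥-elim (true≢false (∧-trueˡ {i <ᶠ j} eq) v≮u)
    ... | inj₂ (inj₂ (u≮v , v<u)) = trans (Prod.⨁-change₂ _ _ v u _ at
            (λ i j ne → Prod.⟦⟧-cong (bool-iff (new i j ne) (old i j)) refl)) (cong (K S h *_) (k-sym v u _ _))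
      where
      at : ⟦ (v <ᶠ u) ∧ edgeIn (insert v S) v u ⟧ k v u (lookup h v) (lookup h u) ≡
           ⟦ (v <ᶠ u) ∧ edgeIn S v u ⟧ k v u (lookup h v) (lookup h u) * k v u (lookup h v) (lookup h u)
      at rewrite v<u | adj-sym H v u | u~v | insert-⊇ v S u u∈S | insert-∈ v S | u∈S | v∉S = sym (*-identityˡ _)
      old : ∀ i j → ((i <ᶠ j) ∧ edgeIn S i j) ≡ true → ((i <ᶠ j) ∧ edgeIn (insert v S) i j) ≡ true
      old i j eq = ∧-intro {i <ᶠ j} (∧-trueˡ {i <ᶠ j} eq) (edgeIn-⊆ (insert-⊇ v S) i j (∧-trueʳ {i <ᶠ j} eq))
      new : ∀ i j → i ≢ v ⊎ j ≢ u → ((i <ᶠ j) ∧ edgeIn (insert v S) i j) ≡ true → ((i <ᶠ j) ∧ edgeIn S i j) ≡ true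
      new i j ne eq with edgeIn-insert⁻ unique i j (∧-trueʳ {i <ᶠ j} eq) | ne
      ... | inj₁ e                    | _         = ∧-intro {i <ᶠ j} (∧-trueˡ {i <ᶠ j} eq) e
      ... | inj₂ (inj₁ (refl , refl)) | _         = ⊥-elim (true≢false (∧-trueˡ {i <ᶠ j} eq) u≮v)
      ... | inj₂ (inj₂ (i≡v , j≡u))   | inj₁ i≢v  = ⊥-elim (i≢v i≡v)
      ... | inj₂ (inj₂ (i≡v , j≡u))   | inj₂ j≢u  = ⊥-elim (j≢u j≡u)

    -- The step from u to the new leaf v is a probability distribution: the weights `w` at the image
    -- of u average to its `μ₀`, which cancels the denominator belonging to u.
    avg-insert : ∀ {S u v} → S u ≡ true → S v ≡ false → Adj H u v →
                 (∀ u′ → S u′ ≡ true → Adj H u′ v → u′ ≡ u) →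
                 ∀ h → avg v (P (insert v S)) h ≡ P S h
    avg-insert {S} {u} {v} u∈S v∉S u~v unique h = begin
      avg v (P (insert v S)) h
        ≡⟨ avg-*ˡ v (P (insert v S)) F h (P S h) split ⟩
      P S h * avg v F h
        ≡⟨ cong (P S h *_) (avg-*ˡ v F (λ h′ → w (lookup h u) (lookup h′ v)) h (inv (μ u (lookup h u))) cancel) ⟩
      P S h * (inv (μ u (lookup h u)) * (ν * ∑ (λ a → w (lookup h u) (lookup (h [ v ]≔ a) v))))
        ≡⟨ cong (λ x → P S h * (inv (μ u (lookup h u)) * x))
             (trans (cong (ν *_) (Sum.⨁-cong (λ a → cong (w (lookup h u)) (lookup-≔ h v a)))) (sym (μ-adjacent u~v (lookup h u)))) ⟩
      P S h * (inv (μ u (lookup h u)) * μ u (lookup h u))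
        ≡⟨ cong (P S h *_) (*-comm _ _) ⟩
      P S h * (μ u (lookup h u) * inv (μ u (lookup h u)))
        ≡⟨ *-*-inv (P S h) μ≡0⇒P≡0 ⟩
      P S h ∎
      where
      open ≡-Reasoning
      F : Ω → ℚ⁺
      F h = μ v (lookup h v) * k u v (lookup h u) (lookup h v)
      u≢v : u ≢ v
      u≢v refl = true≢false u∈S v∉S
      split : ∀ a → P (insert v S) (h [ v ]≔ a) ≡ P S h * F (h [ v ]≔ a)
      split a = begin
        P (insert v S) h′
          ≡⟨ cong₂ _*_ (Φ-insert v∉S h′) (K-insert u∈S v∉S u~v unique h′) ⟩
        (Φ S h′ * μ v (lookup h′ v)) * (K S h′ * k u v (lookup h′ u) (lookup h′ v))
          ≡⟨ solve 4 (λ x m y k → (x :* m) :* (y :* k) := (x :* y) :* (m :* k)) refl (Φ S h′) _ (K S h′) _ ⟩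
        P S h′ * F h′
          ≡⟨ cong (_* F h′) (Dep-≔ (P-dep S) v∉S h a) ⟩
        P S h * F h′ ∎
        where
        h′ = h [ v ]≔ a
      -- If the degree density at a is 0, all weights at a are 0; so `μ v` cancels against its
      -- inverse even at its zeros.
      w≡0 : ∀ a b → μ₀ a ≡ 0# → w a b ≡ 0#
      w≡0 a b eq with x*y≡0⇒x≡0⊎y≡0 eq
      ... | inj₁ ν≡0 = ⊥-elim (ν≢0 ν≡0)
      ... | inj₂ s   = ∑≡0 s b
      cancel : ∀ a → F (h [ v ]≔ a) ≡ inv (μ u (lookup h u)) * w (lookup h u) (lookup (h [ v ]≔ a) v)
      cancel a rewrite lookup-≔′ h a u≢v | lookup-≔ h v a = begin
        μ v a * (w (lookup h u) a * (inv (μ u (lookup h u)) * inv (μ v a)))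
          ≡⟨ solve 4 (λ m w i j → m :* (w :* (i :* j)) := i :* (w :* (m :* j))) refl (μ v a) _ _ (inv (μ v a)) ⟩
        inv (μ u (lookup h u)) * (w (lookup h u) a * (μ v a * inv (μ v a)))
          ≡⟨ cong (inv (μ u (lookup h u)) *_) (*-*-inv _ (λ μ≡0 → trans (w-sym (lookup h u) a)
               (w≡0 a (lookup h u) (trans (sym (μ-adjacent (trans (adj-sym H v u) u~v) a)) μ≡0)))) ⟩
        inv (μ u (lookup h u)) * w (lookup h u) a ∎
      μ≡0⇒P≡0 : μ u (lookup h u) ≡ 0# → P S h ≡ 0#
      μ≡0⇒P≡0 μ≡0 with P S h ≟0
      ... | yes eq = eq
      ... | no ne  = ⊥-elim (∏-≢0 (*-≢0ˡ ne) u (trans (Prod.⟦⟧-cong u∈S refl) μ≡0))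

    marg-insert : ∀ {S u v} → S u ≡ true → S v ≡ false → Adj H u v →
                  (∀ u′ → S u′ ≡ true → Adj H u′ v → u′ ≡ u) →
                  ∀ h → marg S (P (insert v S)) h ≡ P S h
    marg-insert {S} {u} {v} u∈S v∉S u~v unique h = trans (sym (marg-avg v∉S _ h))
      (trans (marg-cong S (avg-insert u∈S v∉S u~v unique) h) (marg-id (P-dep S) h))

    P-⁅⁆ : ∀ v h → P ⁅ v ⁆ h ≡ μ v (lookup h v)
    P-⁅⁆ v h = begin
      Φ ⁅ v ⁆ h * K ⁅ v ⁆ h      ≡⟨ cong₂ _*_ (Φ-insert {∅ᵇ} {v} refl h) (K-∅ {⁅ v ⁆} none h) ⟩
      Φ ∅ᵇ h * μ v (lookup h v) * 1#  ≡⟨ *-identityʳ _ ⟩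
      Φ ∅ᵇ h * μ v (lookup h v)  ≡⟨ cong (_* μ v (lookup h v)) (Φ-∅ h) ⟩
      1# * μ v (lookup h v)      ≡⟨ *-identityˡ _ ⟩
      μ v (lookup h v)           ∎
      where
      open ≡-Reasoning
      none : ∀ i j → edgeIn ⁅ v ⁆ i j ≡ false
      none i j = not-true⇒false (λ eq → true≢false (∧-trueˡ {adj H i j} eq)
        (trans (cong₂ (adj H) (⁅⁆-true (∧-trueˡ (∧-trueʳ {adj H i j} eq)))
                              (⁅⁆-true (∧-trueʳ {⁅ v ⁆ i} (∧-trueʳ {adj H i j} eq)))) (adj-irrefl H v)))

    marg-∅-⁅⁆ : ∀ v h → marg ∅ᵇ (P ⁅ v ⁆) h ≡ P ∅ᵇ h
    marg-∅-⁅⁆ v h = trans (sym (marg-avg {∅ᵇ} {v} refl _ h)) (trans (marg-cong ∅ᵇ (λ h →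
      trans (avg-cong v (P ⁅ v ⁆) (λ h → μ v (lookup h v)) h (λ a → P-⁅⁆ v (h [ v ]≔ a))) (trans (avg-μ v h) (sym (P-∅ h)))) h)
      (marg-id (P-dep ∅ᵇ) h))

    remaining : (Fin N → Bool) → List (Fin N) → Fin N → Bool
    remaining S []       = S
    remaining S (v ∷ vs) = remove v (remaining S vs)

    remaining-∈ : ∀ S vs {v} → v ∈ vs → remaining S vs v ≡ false
    remaining-∈ S (v ∷ vs) (Any.here refl) rewrite ⁅⁆-refl v = ∧-falseʳ (remaining S vs v) refl
    remaining-∈ S (u ∷ vs) (Any.there v∈)  rewrite remaining-∈ S vs v∈ = refl

    avg-Φ : ∀ v S h → avg v (Φ S) h ≡ Φ (remove v S) h
    avg-Φ v S h with true-or-false (S v)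
    ... | inj₂ v∉S = trans (avg-const v (Φ S) h (λ a → Dep-≔ (Φ-dep S) v∉S h a)) (Φ-≗ same h)
      where
      same : ∀ u → S u ≡ remove v S u
      same u with u ≟ v
      ... | yes refl rewrite v∉S = refl
      ... | no _ = sym (∧-identityʳ (S u))
    ... | inj₁ v∈S = begin
      avg v (Φ S) h
        ≡⟨ avg-*ˡ v (Φ S) (λ h → μ v (lookup h v)) h (Φ (remove v S) h) split ⟩
      Φ (remove v S) h * avg v (λ h → μ v (lookup h v)) h
        ≡⟨ cong (Φ (remove v S) h *_) (avg-μ v h) ⟩
      Φ (remove v S) h * 1#
        ≡⟨ *-identityʳ _ ⟩
      Φ (remove v S) h ∎
      where
      open ≡-Reasoning
      v∉ : remove v S v ≡ false
      v∉ rewrite ⁅⁆-refl v = ∧-falseʳ (S v) refl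
      same : ∀ u → S u ≡ insert v (remove v S) u
      same u with u ≟ v
      ... | yes refl rewrite v∈S = refl
      ... | no _ with S u
      ...   | true  = refl
      ...   | false = refl
      split : ∀ a → Φ S (h [ v ]≔ a) ≡ Φ (remove v S) h * μ v (lookup (h [ v ]≔ a) v)
      split a = trans (Φ-≗ same (h [ v ]≔ a)) (trans (Φ-insert v∉ (h [ v ]≔ a)) (cong (_* μ v (lookup (h [ v ]≔ a) v)) (Dep-≔ (Φ-dep (remove v S)) v∉ h a)))

    Avg-Φ : ∀ vs S h → Avg vs (Φ S) h ≡ Φ (remaining S vs) h
    Avg-Φ []       S h = refl
    Avg-Φ (v ∷ vs) S h = trans (avg-cong v (Avg vs (Φ S)) (Φ (remaining S vs)) h (λ a → Avg-Φ vs S _)) (avg-Φ v (remaining S vs) h)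

    -- Under `Φ` the vertices are independent, so each averaged coordinate contributes a factor 1
    -- whatever the edges in S are. This matters for intersections of bags, which may be
    -- disconnected.
    𝔼-Φ : ∀ S h → 𝔼 (Φ S) h ≡ 1#
    𝔼-Φ S h = trans (𝔼-def (Φ S) h) (trans (Avg-Φ (allFin N) S h)
      (trans (Φ-≗ (λ v → remaining-∈ S (allFin N) (∈-allFin v)) h) (Φ-∅ h)))

-- Walks and trees

module _ (G : Graph) where

  private
    VG = Fin ∣ G ∣ᵛ

  adj-flip : ∀ {u v} → Adj G u v → Adj G v u
  adj-flip {u} {v} u~v = trans (adj-sym G v u) u~v

  AllIn : (VG → Bool) → List VG → Set
  AllIn S = All (λ v → S v ≡ true)

  Connected : (VG → Bool) → Set
  Connected S = ∀ x y → S x ≡ true → S y ≡ true → ∃[ vs ] (Walk G x y vs × AllIn S vs)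

  Acyclic : (VG → Bool) → Set
  Acyclic S = ∀ {x y vs} → Path G x y vs → AllIn S vs → 3 ℕ.≤ length vs → Adj G y x → ⊥

  walk-++ : ∀ {x z y w vs ws} → Walk G x z vs → Adj G z y → Walk G y w ws → Walk G x w (vs ++ ws)
  walk-++ here         z~y q = step z~y q
  walk-++ (step x~u p) z~y q = step x~u (walk-++ p z~y q)

  path-from : ∀ {Q : VG → Set} {x y z vs} → Path G y z vs → All Q vs → x ∈ vs → ∃[ ws ] (Path G x z ws × All Q ws)
  path-from (here , uniq)     qs       (Any.here refl) = _ , (here , uniq) , qs
  path-from (step a p , uniq) qs       (Any.here refl) = _ , (step a p , uniq) , qs
  path-from (step a p , _ ∷ uniq) (_ ∷ qs) (Any.there x∈) = path-from (p , uniq) qs x∈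

  walk⇒path : ∀ {Q : VG → Set} {x y vs} → Walk G x y vs → All Q vs → ∃[ ws ] (Path G x y ws × All Q ws)
  walk⇒path here qs = _ , (here , [] ∷ []) , qs
  walk⇒path {x = x} (step x~u p) (q ∷ qs) with walk⇒path p qs
  ... | ws , path , qs′ with ∈?-of _≟_ x ws
  ...   | yes x∈ = path-from path qs′ x∈
  ...   | no  x∉ = x ∷ ws , (step x~u (proj₁ path) , Allₚ.¬Any⇒All¬ ws x∉ ∷ proj₂ path) , q ∷ qs′

  -- The tail after the last vertex in S avoids S, and so it can be joined to any path inside S
  -- without repeating a vertex.
  record Exit (S : VG → Bool) (b : VG) (vs : List VG) : Set where
    field
      {last next} : VG
      {rest}      : List VG
      last∈S      : S last ≡ true
      last∈vs     : last ∈ vs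
      last~next   : Adj G last next
      rest-path   : Path G next b rest
      rest∉S      : All (λ v → S v ≡ false) rest

  last-exit : ∀ S {x b vs} → Path G x b vs → S b ≡ false → All (λ v → S v ≡ false) vs ⊎ Exit S b vs
  last-exit S (here , uniq) b∉S = inj₁ (b∉S ∷ [])
  last-exit S {x} (step x~y p , _ ∷ uniq) b∉S with last-exit S (p , uniq) b∉S
  ... | inj₂ exit = inj₂ (record
    { last∈S = Exit.last∈S exit ; last∈vs = Any.there (Exit.last∈vs exit) ; last~next = Exit.last~next exit
    ; rest-path = Exit.rest-path exit ; rest∉S = Exit.rest∉S exit })
  ... | inj₁ out with true-or-false (S x)
  ...   | inj₁ x∈S = inj₂ (record
    { last∈S = x∈S ; last∈vs = Any.here refl ; last~next = x~y ; rest-path = p , uniq ; rest∉S = out })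
  ...   | inj₂ x∉S = inj₁ (x∉S ∷ out)

  -- A path inside S from a to z is continued by the outside path to b. It has at least three
  -- vertices because a ≠ z, so an edge from b to a closes a cycle; both applications derive their
  -- contradiction in this way.
  detour-cycle : ∀ {S a z y b ws} → Connected S → S a ≡ true → S z ≡ true → a ≢ z →
                 Adj G z y → Path G y b ws → All (λ v → S v ≡ false) ws →
                 ∃[ vs ] (Path G a b vs × 3 ℕ.≤ length vs × All (λ v → S v ≡ true ⊎ v ∈ ws) vs)
  detour-cycle {S} {a} {z} conn a∈S z∈S a≢z z~y (q , q-unique) ws∉S with conn a z a∈S z∈S
  ... | _ , walk , inS with walk⇒path walk inS
  ...   | vs , (p , p-unique) , vs∈S = vs ++ _ , (walk-++ p z~y q , Uniqueₚ.++⁺ p-unique q-unique disjoint)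
          , long p q , Allₚ.++⁺ (All.map inj₁ vs∈S) (All.tabulate inj₂)
    where
    disjoint : ∀ {v} → v ∈ vs × v ∈ _ → ⊥
    disjoint (v∈vs , v∈ws) = true≢false (All.lookup vs∈S v∈vs) (All.lookup ws∉S v∈ws)
    nonempty : ∀ {x y us} → Walk G x y us → 1 ℕ.≤ length us
    nonempty here       = s≤s z≤n
    nonempty (step _ _) = s≤s z≤n
    long : ∀ {us ws y b} → Walk G a z us → Walk G y b ws → 3 ℕ.≤ length (us ++ ws)
    long here                q = ⊥-elim (a≢z refl)
    long (step _ here)       q = s≤s (s≤s (nonempty q))
    long (step _ (step _ p)) q = s≤s (s≤s (nonempty′ p q))
      where
      nonempty′ : ∀ {us ws x u y b} → Walk G x u us → Walk G y b ws → 1 ℕ.≤ length (us ++ ws)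
      nonempty′ here       _ = s≤s z≤n
      nonempty′ (step _ _) _ = s≤s z≤n

  connected-insert : ∀ {S u v} → Connected S → S u ≡ true → Adj G u v → Connected (insert v S)
  connected-insert {S} {u} {v} conn u∈S u~v x y x∈ y∈ with insert⁻ v S x∈ | insert⁻ v S y∈
  ... | inj₁ x∈S  | inj₁ y∈S with conn x y x∈S y∈S
  ...   | vs , p , ps = vs , p , All.map (insert-⊇ v S _) ps
  connected-insert {S} {u} {v} conn u∈S u~v x y x∈ y∈ | inj₁ x∈S | inj₂ refl with conn x u x∈S u∈S
  ...   | vs , p , ps = vs ++ v ∷ [] , walk-++ p u~v here , Allₚ.++⁺ (All.map (insert-⊇ v S _) ps) (insert-∈ v S ∷ [])
  connected-insert {S} {u} {v} conn u∈S u~v x y x∈ y∈ | inj₂ refl | inj₁ y∈S with conn u y u∈S y∈S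
  ...   | vs , p , ps = v ∷ vs , step (adj-flip u~v) p , insert-∈ v S ∷ All.map (insert-⊇ v S _) ps
  connected-insert {S} {u} {v} conn u∈S u~v x y x∈ y∈ | inj₂ refl | inj₂ refl = v ∷ [] , here , insert-∈ v S ∷ []

  connected-⁅⁆ : ∀ v → Connected ⁅ v ⁆
  connected-⁅⁆ v x y x∈ y∈ with ⁅⁆-true {u = x} x∈ | ⁅⁆-true {u = y} y∈
  ... | refl | refl = v ∷ [] , here , ⁅⁆-refl v ∷ []

  -- Two neighbours of v in S are joined by a path inside S, and together with v this would be a
  -- cycle in X.
  unique-neighbour : ∀ {X S u u′ v} → Acyclic X → Connected S → S ⊆ᵇ X → X v ≡ true → S v ≡ false →
                     S u ≡ true → S u′ ≡ true → Adj G u v → Adj G u′ v → u′ ≡ u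
  unique-neighbour {X} {S} {u} {u′} {v} acyclic conn S⊆X v∈X v∉S u∈S u′∈S u~v u′~v with u′ ≟ u
  ... | yes eq = eq
  ... | no u′≢u with detour-cycle conn u′∈S u∈S u′≢u u~v (here , [] ∷ []) (v∉S ∷ [])
  ...   | vs , path , 3≤ , within = ⊥-elim (acyclic path (All.map inX within) 3≤ (adj-flip u′~v))
    where
    inX : ∀ {x} → S x ≡ true ⊎ x ∈ v ∷ [] → X x ≡ true
    inX (inj₁ x∈S)             = S⊆X _ x∈S
    inX (inj₂ (Any.here refl)) = v∈X

  -- A property of vertex sets that is preserved by adding an adjacent vertex of a
  -- connected set X passes from a subset of X to one containing X.
  module Spread (X : VG → Bool) (C : (VG → Bool) → Set)
                (extend : ∀ {S u v} → C S → S u ≡ true → S v ≡ false → X v ≡ true → Adj G u v → C (insert v S)) where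

    reach : ∀ {S x t vs} → C S → S x ≡ true → Walk G x t vs → AllIn X vs →
            ∃[ S′ ] (C S′ × S ⊆ᵇ S′ × S′ t ≡ true)
    reach {S} c x∈S here xs = S , c , (λ _ v∈ → v∈) , x∈S
    reach {S} c x∈S (step {y = y} x~y p) (_ ∷ xs) with true-or-false (S y)
    ... | inj₁ y∈S = reach c y∈S p xs
    ... | inj₂ y∉S with reach (extend c x∈S y∉S (head p xs) x~y) (insert-∈ y S) p xs
      where
      head : ∀ {y t vs} → Walk G y t vs → AllIn X vs → X y ≡ true
      head here       (y∈ ∷ _) = y∈
      head (step _ _) (y∈ ∷ _) = y∈
    ...   | S′ , c′ , ⊆S′ , t∈ = S′ , c′ , (λ v v∈ → ⊆S′ v (insert-⊇ y S v v∈)) , t∈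

    reach-all : ∀ {S s} → Connected X → X s ≡ true → C S → S s ≡ true → (ts : List VG) →
                ∃[ S′ ] (C S′ × S ⊆ᵇ S′ × (∀ t → t ∈ ts → X t ≡ true → S′ t ≡ true))
    reach-all {S} conn s∈X c s∈S [] = S , c , (λ _ v∈ → v∈) , (λ _ ())
    reach-all {S} {s} conn s∈X c s∈S (t ∷ ts) with reach-all conn s∈X c s∈S ts
    ... | S₁ , c₁ , S⊆S₁ , done with true-or-false (X t)
    ...   | inj₂ t∉X = S₁ , c₁ , S⊆S₁ , λ
      { u (Any.here refl) u∈X → ⊥-elim (true≢false u∈X t∉X)
      ; u (Any.there u∈)  u∈X → done u u∈ u∈X }
    ...   | inj₁ t∈X with conn s t s∈X t∈X
    ...     | vs , p , vs∈X with reach c₁ (S⊆S₁ s s∈S) p vs∈X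
    ...       | S₂ , c₂ , S₁⊆S₂ , t∈S₂ = S₂ , c₂ , (λ v v∈ → S₁⊆S₂ v (S⊆S₁ v v∈)) , λ
      { u (Any.here refl) _   → t∈S₂
      ; u (Any.there u∈)  u∈X → S₁⊆S₂ u (done u u∈ u∈X) }

    spread : ∀ {S s} → Connected X → X s ≡ true → C S → S s ≡ true → ∃[ S′ ] (C S′ × X ⊆ᵇ S′)
    spread conn s∈X c s∈S with reach-all conn s∈X c s∈S (allFin ∣ G ∣ᵛ)
    ... | S′ , c′ , _ , all = S′ , c′ , λ v → all v (∈-allFin v)

-- Marginals of tree densities and their relabelling

module Trees (H G : Graph) (n≢0 : fromℕ ∣ G ∣ᵛ ≢ 0#) (β : ℚ⁺)
             (normalised : Averaging.ν ∣ H ∣ᵛ ∣ G ∣ᵛ n≢0 *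
               ∑ (λ a → Averaging.ν ∣ H ∣ᵛ ∣ G ∣ᵛ n≢0 * ∑ (λ b → Density.kernel H G n≢0 β a b)) ≡ 1#) where

  private
    N = ∣ H ∣ᵛ

  open Averaging N ∣ G ∣ᵛ n≢0
  open Density H G n≢0
  open Kernel β normalised

  -- S grows to X one vertex at a time. By acyclicity of X every new vertex has only one neighbour
  -- in the current subtree, so averaging it out gives back the previous density.
  marg-tree : ∀ {X S s} → Connected H X → Acyclic H X → Connected H S → S ⊆ᵇ X → S s ≡ true →
              ∀ h → marg S (P X) h ≡ P S h
  marg-tree {X} {S} {s} X-conn acyclic S-conn S⊆X s∈S h =
    conclude (spread X-conn (S⊆X s s∈S) (S-conn , S⊆X , (λ _ v∈ → v∈) , marg-id (P-dep S)) s∈S)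
    where
    C : (Fin N → Bool) → Set
    C S′ = Connected H S′ × S′ ⊆ᵇ X × S ⊆ᵇ S′ × (∀ h → marg S (P S′) h ≡ P S h)
    extend : ∀ {S′ u v} → C S′ → S′ u ≡ true → S′ v ≡ false → X v ≡ true → Adj H u v → C (insert v S′)
    extend {S′} {u} {v} (conn , S′⊆X , S⊆S′ , eq) u∈S′ v∉S′ v∈X u~v =
      connected-insert H conn u∈S′ u~v , inX , (λ x x∈ → insert-⊇ v S′ x (S⊆S′ x x∈)) , λ h → begin
        marg S (P (insert v S′)) h            ≡⟨ marg-tower S⊆S′ _ h ⟨
        marg S (marg S′ (P (insert v S′))) h  ≡⟨ marg-cong S (marg-insert u∈S′ v∉S′ u~v
          (λ u′ u′∈ u′~v → unique-neighbour H acyclic conn S′⊆X v∈X v∉S′ u∈S′ u′∈ u~v u′~v)) h ⟩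
        marg S (P S′) h                       ≡⟨ eq h ⟩
        P S h                                 ∎
      where
      open ≡-Reasoning
      inX : insert v S′ ⊆ᵇ X
      inX x x∈ with insert⁻ v S′ x∈
      ... | inj₁ x∈S′ = S′⊆X x x∈S′
      ... | inj₂ refl = v∈X
    open Spread H X C extend
    conclude : ∃[ S′ ] (C S′ × X ⊆ᵇ S′) → marg S (P X) h ≡ P S h
    conclude (S′ , (_ , S′⊆X , _ , eq) , X⊆S′) =
      trans (marg-cong S (P-≗ (λ v → bool-iff (X⊆S′ v) (S′⊆X v))) h) (eq h)

  -- The empty set has no neighbours from which to grow, so the marginal passes through a single
  -- vertex, whose law has mass 1.
  marg-∅-tree : ∀ {X x} → Connected H X → Acyclic H X → X x ≡ true → ∀ h → marg ∅ᵇ (P X) h ≡ P ∅ᵇ h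
  marg-∅-tree {X} {x} conn acyclic x∈X h = begin
    marg ∅ᵇ (P X) h               ≡⟨ marg-tower {S′ = ⁅ x ⁆} (λ _ ()) _ h ⟨
    marg ∅ᵇ (marg ⁅ x ⁆ (P X)) h  ≡⟨ marg-cong ∅ᵇ (marg-tree {s = x} conn acyclic (connected-⁅⁆ H x) x⊆X (⁅⁆-refl x)) h ⟩
    marg ∅ᵇ (P ⁅ x ⁆) h           ≡⟨ marg-∅-⁅⁆ x h ⟩
    P ∅ᵇ h                        ∎
    where
    open ≡-Reasoning
    x⊆X : ⁅ x ⁆ ⊆ᵇ X
    x⊆X v v∈ = subst (λ v → X v ≡ true) (sym (⁅⁆-true v∈)) x∈X

  𝔼-tree : ∀ {X x} → Connected H X → Acyclic H X → X x ≡ true → ∀ h → 𝔼 (P X) h ≡ 1#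
  𝔼-tree {X} conn acyclic x∈X h = trans (sym (𝔼-marg ∅ᵇ (P X) h))
    (trans (𝔼-cong (λ h → trans (marg-∅-tree conn acyclic x∈X h) (P-∅ h)) h) (𝔼-const 1# h))

  -- Unlike K, the product over ordered pairs does not refer to the order of the
  -- vertices, so it can be reindexed along an isomorphism.
  K² : (Fin N → Bool) → Ω → ℚ⁺
  K² S h = ∏ (λ i → ∏ (λ j → ⟦ edgeIn S i j ⟧ k i j (lookup h i) (lookup h j)))

  K-square : ∀ S h → K S h * K S h ≡ K² S h
  K-square S h = begin
    K S h * K S h
      ≡⟨ Prod.⨁-∙ _ _ ⟨
    ∏ (λ i → ∏ (λ j → ⟦ (i <ᶠ j) ∧ edgeIn S i j ⟧ κ i j) * ∏ (λ j → ⟦ (i <ᶠ j) ∧ edgeIn S i j ⟧ κ i j))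
      ≡⟨ Prod.⨁-cong (λ i → trans (sym (Prod.⨁-∙ _ _)) (Prod.⨁-cong (λ j →
           trans (sym (Prod.⟦⟧-∙ ((i <ᶠ j) ∧ edgeIn S i j) (κ i j) (κ i j)))
             (Prod.⟦⟧-cong {(i <ᶠ j) ∧ edgeIn S i j} refl (cong (κ i j *_) (k-sym i j _ _)))))) ⟩
    ∏ (λ i → ∏ (λ j → ⟦ (i <ᶠ j) ∧ edgeIn S i j ⟧ (κ i j * κ j i)))
      ≡⟨ Prod.⨁-symmetrise (edgeIn S) edge-sym edge-irrefl κ ⟩
    K² S h ∎
    where
    open ≡-Reasoning
    κ : Fin N → Fin N → ℚ⁺
    κ i j = k i j (lookup h i) (lookup h j)
    edge-sym : ∀ i j → edgeIn S i j ≡ edgeIn S j i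
    edge-sym i j = bool-iff (flip i j) (flip j i)
      where
      flip : ∀ i j → edgeIn S i j ≡ true → edgeIn S j i ≡ true
      flip i j eq = ∧-intro {adj H j i} (adj-flip H (∧-trueˡ {adj H i j} eq)) (∧-intro {S j}
        (∧-trueʳ {S i} (∧-trueʳ {adj H i j} eq)) (∧-trueˡ {S i} (∧-trueʳ {adj H i j} eq)))
    edge-irrefl : ∀ i → edgeIn S i i ≡ false
    edge-irrefl i rewrite adj-irrefl H i = refl

  module Relabelling {S S′ I : Fin N → Bool} (f g : Fin N → Fin N)
    (f∈ : ∀ v → S v ≡ true → S′ (f v) ≡ true) (g∈ : ∀ v → S′ v ≡ true → S (g v) ≡ true)
    (gf : ∀ v → S v ≡ true → g (f v) ≡ v) (fg : ∀ v → S′ v ≡ true → f (g v) ≡ v)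
    (f-adj : ∀ u v → S u ≡ true → S v ≡ true → adj H u v ≡ adj H (f u) (f v))
    (f-fix : ∀ v → I v ≡ true → f v ≡ v) (f-μ : ∀ v → S v ≡ true → ∀ a → μ v a ≡ μ (f v) a)
    (I⊆S : I ⊆ᵇ S) where

    -- Assignments are pulled back along f on S. What happens outside S is immaterial, as only
    -- functions of the coordinates in S are evaluated at `φ h`.
    φ : Ω → Ω
    φ h = Vec.tabulate (λ v → if S v then lookup h (f v) else lookup h v)

    lookup-φ : ∀ h {v} → S v ≡ true → lookup (φ h) v ≡ lookup h (f v)
    lookup-φ h {v} v∈S = trans (lookup∘tabulate _ v) (cong (if_then lookup h (f v) else lookup h v) v∈S)

    f-injective : ∀ {u v} → S u ≡ true → S v ≡ true → f u ≡ f v → u ≡ v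
    f-injective u∈S v∈S eq = trans (sym (gf _ u∈S)) (trans (cong g eq) (gf _ v∈S))

    Φ-relabel : ∀ h → Φ S (φ h) ≡ Φ S′ h
    Φ-relabel h = trans
      (Prod.⨁-cong (λ v → Prod.⟦⟧-congʳ (S v) (λ v∈S → trans (cong (μ v) (lookup-φ h v∈S)) (f-μ v v∈S _))))
      (Prod.⨁-reindex S S′ f g f∈ g∈ gf fg (λ w → μ w (lookup h w)))

    K²-relabel : ∀ h → K² S (φ h) ≡ K² S′ h
    K²-relabel h = begin
      K² S (φ h)
        ≡⟨ Prod.⨁-cong (λ i → trans (Prod.⨁-cong (pull i)) (Prod.⨁-⟦⟧ (S i) _)) ⟩
      ∏ (λ i → ⟦ S i ⟧ ∏ (λ j → ⟦ S j ⟧ F (f i) (f j)))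
        ≡⟨ Prod.⨁-cong (λ i → Prod.⟦⟧-cong {S i} refl (Prod.⨁-reindex S S′ f g f∈ g∈ gf fg (F (f i)))) ⟩
      ∏ (λ i → ⟦ S i ⟧ ∏ (λ j → ⟦ S′ j ⟧ F (f i) j))
        ≡⟨ Prod.⨁-reindex S S′ f g f∈ g∈ gf fg (λ i → ∏ (λ j → ⟦ S′ j ⟧ F i j)) ⟩
      ∏ (λ i → ⟦ S′ i ⟧ ∏ (λ j → ⟦ S′ j ⟧ F i j))
        ≡⟨ Prod.⨁-cong (λ i → trans (sym (Prod.⨁-⟦⟧ (S′ i) _)) (Prod.⨁-cong (λ j → sym (nest (adj H i j) (S′ i) (S′ j) _)))) ⟩
      K² S′ h ∎
      where
      open ≡-Reasoning
      F : Fin N → Fin N → ℚ⁺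
      F i j = ⟦ adj H i j ⟧ k i j (lookup h i) (lookup h j)
      nest : ∀ a s t x → ⟦ a ∧ (s ∧ t) ⟧ x ≡ ⟦ s ⟧ ⟦ t ⟧ ⟦ a ⟧ x
      nest a     false t     x = Prod.⟦⟧-cong (∧-falseʳ a refl) refl
      nest a     true  false x = Prod.⟦⟧-cong (∧-falseʳ a refl) refl
      nest true  true  true  x = refl
      nest false true  true  x = refl
      pull : ∀ i j → ⟦ edgeIn S i j ⟧ k i j (lookup (φ h) i) (lookup (φ h) j) ≡ ⟦ S i ⟧ ⟦ S j ⟧ F (f i) (f j)
      pull i j = trans (nest (adj H i j) (S i) (S j) _) (Prod.⟦⟧-congʳ (S i) (λ i∈S → Prod.⟦⟧-congʳ (S j) (λ j∈S →
        Prod.⟦⟧-cong (f-adj i j i∈S j∈S) (cong₂ _*_ (cong₂ w (lookup-φ h i∈S) (lookup-φ h j∈S))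
          (cong₂ _*_ (cong inv (trans (cong (μ i) (lookup-φ h i∈S)) (f-μ i i∈S _)))
                     (cong inv (trans (cong (μ j) (lookup-φ h j∈S)) (f-μ j j∈S _))))))))

    P-relabel : ∀ h → P S (φ h) ≡ P S′ h
    P-relabel h = cong₂ _*_ (Φ-relabel h) (square-injective
      (trans (K-square S (φ h)) (trans (K²-relabel h) (sym (K-square S′ h)))))

    avg-relabel : ∀ {F v} → Dep S F → S v ≡ true → ∀ h → avg (f v) (F ∘ φ) h ≡ avg v F (φ h)
    avg-relabel {F} {v} dep v∈S h = cong (ν *_) (Sum.⨁-cong (λ a → dep _ _ (agree a)))
      where
      agree : ∀ a u → S u ≡ true → lookup (φ (h [ f v ]≔ a)) u ≡ lookup (φ h [ v ]≔ a) u
      agree a u u∈S with u ≟ v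
      ... | yes refl = trans (lookup-φ (h [ f v ]≔ a) u∈S) (trans (lookup-≔ h (f v) a) (sym (lookup-≔ (φ h) v a)))
      ... | no u≢v = trans (lookup-φ (h [ f v ]≔ a) u∈S) (trans (lookup-≔′ h a (λ eq → u≢v (f-injective u∈S v∈S eq)))
        (trans (sym (lookup-φ h u∈S)) (sym (lookup-≔′ (φ h) a u≢v))))

    Avg-relabel : ∀ {F} vs → Dep S F → (∀ v → v ∈ vs → S v ≡ true) → ∀ h → Avg (map f vs) (F ∘ φ) h ≡ Avg vs F (φ h)
    Avg-relabel         []       dep vs∈S h = refl
    Avg-relabel {F} (v ∷ vs) dep vs∈S h = trans
      (avg-cong (f v) (Avg (map f vs) (F ∘ φ)) (Avg vs F ∘ φ) h (λ a → Avg-relabel vs dep (λ u u∈ → vs∈S u (Any.there u∈)) _))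
      (avg-relabel (λ h h′ agree → Avg-agree vs dep h h′ (λ u u∈S _ → agree u u∈S)) (vs∈S v (Any.here refl)) h)

    -- Averaging `P S′` over f(S ∖ I) is averaging `P S` over S ∖ I and then applying `φ`. The
    -- result depends only on the coordinates in I, and these are not moved by `φ` because f fixes
    -- I.
    marg-relabel : ∀ h → marg I (P S) h ≡ marg I (P S′) h
    marg-relabel h = sym (begin
      marg I (P S′) h
        ≡⟨ marg-Avg (map f vs) fvs∉I (P S′) h ⟨
      marg I (Avg (map f vs) (P S′)) h
        ≡⟨ marg-cong I (λ h → trans (Avg-cong (map f vs) (λ h → sym (P-relabel h)) h)
             (Avg-relabel vs (P-dep S) (λ v v∈ → ∧-trueˡ (vs∈ v∈)) h)) h ⟩
      marg I (Avg vs (P S) ∘ φ) h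
        ≡⟨ marg-cong I (λ h → trans (sym (marg-vs (φ h))) (marg-dep I (P S) (φ h) h (φ-fix h))) h ⟩
      marg I (marg I (P S)) h
        ≡⟨ marg-id (marg-dep I (P S)) h ⟩
      marg I (P S) h ∎)
      where
      open ≡-Reasoning
      vs : List (Fin N)
      vs = filter (λ v → (S v ∧ not (I v)) ≟ᵇ true) (allFin N)
      vs∈ : ∀ {v} → v ∈ vs → (S v ∧ not (I v)) ≡ true
      vs∈ v∈ = proj₂ (∈-filter⁻ (λ v → (S v ∧ not (I v)) ≟ᵇ true) {xs = allFin N} v∈)
      not-true⁻ : ∀ {b} → not b ≡ true → b ≡ false
      not-true⁻ {false} _ = refl
      vs∉I : ∀ v → v ∈ vs → I v ≡ false
      vs∉I v v∈ = not-true⁻ (∧-trueʳ {S v} (vs∈ v∈))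
      fvs∉I : ∀ w → w ∈ map f vs → I w ≡ false
      fvs∉I w w∈ with ∈-map⁻ f w∈
      -- If f v were in I, f would fix it, so f (f v) = f v; by injectivity f v = v, and v itself
      -- would be in I.
      ... | v , v∈ , refl = not-true⇒false (λ fv∈I → true≢false
        (subst (λ u → I u ≡ true) (f-injective (I⊆S (f v) fv∈I) (∧-trueˡ (vs∈ v∈)) (f-fix (f v) fv∈I)) fv∈I)
        (vs∉I v v∈))
      φ-fix : ∀ h v → I v ≡ true → lookup (φ h) v ≡ lookup h v
      φ-fix h v v∈I = trans (lookup-φ h (I⊆S v v∈I)) (cong (lookup h) (f-fix v v∈I))
      Avg-dep : Dep I (Avg vs (P S))
      Avg-dep h h′ agree = Avg-agree vs (P-dep S) h h′ (λ v v∈S v∉vs → agree v (in-I v v∈S v∉vs))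
        where
        in-I : ∀ v → S v ≡ true → v ∉ vs → I v ≡ true
        in-I v v∈S v∉vs with true-or-false (I v)
        ... | inj₁ v∈I = v∈I
        ... | inj₂ v∉I = ⊥-elim (v∉vs (∈-filter⁺ (λ v → (S v ∧ not (I v)) ≟ᵇ true) (∈-allFin v)
          (∧-intro v∈S (cong not v∉I))))
      marg-vs : ∀ h → marg I (P S) h ≡ Avg vs (P S) h
      marg-vs h = trans (sym (marg-Avg vs vs∉I (P S) h)) (marg-id Avg-dep h)

-- Gluing along the decomposition tree

module _ (H : Graph) where

  connectedOn⇒connected : ∀ {S} → ConnectedOn H S → Connected H (lookup S)
  connectedOn⇒connected {S} conn x y x∈ y∈ with conn x y (lookup⇒[]= x S x∈) (lookup⇒[]= y S y∈)
  ... | vs , p , within = vs , p , All.map []=⇒lookup within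

  cycle-free⇒acyclic : ∀ {S} → (HasCycleOn H S → ⊥) → Acyclic H (lookup S)
  cycle-free⇒acyclic {S} no-cycle path within 3≤ y~x =
    no-cycle (_ , _ , _ , path , All.map (lookup⇒[]= _ S) within , 3≤ , y~x)

module Glued (H G : Graph) (n≢0 : fromℕ ∣ G ∣ᵛ ≢ 0#) (β : ℚ⁺)
             (normalised : Averaging.ν ∣ H ∣ᵛ ∣ G ∣ᵛ n≢0 *
               ∑ (λ a → Averaging.ν ∣ H ∣ᵛ ∣ G ∣ᵛ n≢0 * ∑ (λ b → Density.kernel H G n≢0 β a b)) ≡ 1#)
             (D : TreeDecomposition H) (strong : IsStrong H D) where

  open Averaging ∣ H ∣ᵛ ∣ G ∣ᵛ n≢0
  open Density H G n≢0
  open Kernel β normalised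
  open Trees H G n≢0 β normalised

  private
    N = ∣ H ∣ᵛ
    k′ = ∣ T D ∣ᵛ

  X : Fin k′ → Fin N → Bool
  X a = lookup (bag D a)

  X-connected : ∀ a → Connected H (X a)
  X-connected a = connectedOn⇒connected H (proj₁ (proj₂ (proj₁ strong a)))

  X-acyclic : ∀ a → Acyclic H (X a)
  X-acyclic a = cycle-free⇒acyclic H (proj₂ (proj₂ (proj₁ strong a)))

  X-nonempty : ∀ a → ∃[ x ] X a x ≡ true
  X-nonempty a with proj₁ (proj₁ strong a)
  ... | x , x∈ = x , []=⇒lookup x∈

  marg-bag-≗∅ : ∀ {I} a → (∀ v → I v ≡ false) → ∀ h → marg I (P (X a)) h ≡ P ∅ᵇ h
  marg-bag-≗∅ a empty h = trans (marg-≗ empty _ h) (marg-∅-tree (X-connected a) (X-acyclic a) (proj₂ (X-nonempty a)) h)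

  marg-bag : ∀ {S I s} a → Connected H S → S ⊆ᵇ X a → I ⊆ᵇ S → S s ≡ true →
             ∀ h → marg I (P (X a)) h ≡ marg I (P S) h
  marg-bag {I = I} a S-conn S⊆X I⊆S s∈S h = trans (sym (marg-tower I⊆S _ h))
    (marg-cong I (marg-tree (X-connected a) (X-acyclic a) S-conn S⊆X s∈S) h)

  -- Each marginal is first reduced to the minimal subtree of its bag, and the isomorphism then
  -- carries one into the other. If the bags are disjoint these subtrees are empty and have no
  -- vertex to start from, but both marginals are the total mass 1.
  bags-consistent : ∀ a b → Adj (T D) a b →
                    ∀ h → marg (X a ∩ᵇ X b) (P (X a)) h ≡ marg (X a ∩ᵇ X b) (P (X b)) h
  bags-consistent a b a~b h with proj₂ (proj₂ strong) a b a~b | nonempty? (bag D a ∩ bag D b)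
  ... | _ | no empty = trans (marg-bag-≗∅ a none h) (sym (marg-bag-≗∅ b none h))
    where
    none : ∀ v → (X a ∩ᵇ X b) v ≡ false
    none v = not-true⇒false (λ v∈ → empty (v , x∈p∩q⁺
      (lookup⇒[]= v _ (∧-trueˡ v∈) , lookup⇒[]= v _ (∧-trueʳ {X a v} v∈))))
  ... | Sa , Sb , (I⊆Sa , Sa⊆X , (Sa-conn , _) , _) , (I⊆Sb , Sb⊆X , (Sb-conn , _) , _)
      , f , g , f∈ , g∈ , gf , fg , f-adj , f-fix | yes (s , s∈I) = begin
    marg I (P (X a)) h     ≡⟨ marg-bag a Sa-connected Sa⊆Xa I⊆Saᵇ s∈Sa h ⟩
    marg I (P (lookup Sa)) h
      ≡⟨ Relabelling.marg-relabel {lookup Sa} {lookup Sb} {I} f g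
           (λ v v∈ → []=⇒lookup (f∈ v (lookup⇒[]= v Sa v∈))) (λ v v∈ → []=⇒lookup (g∈ v (lookup⇒[]= v Sb v∈)))
           (λ v v∈ → gf v (lookup⇒[]= v Sa v∈)) (λ v v∈ → fg v (lookup⇒[]= v Sb v∈))
           (λ u v u∈ v∈ → f-adj u v (lookup⇒[]= u Sa u∈) (lookup⇒[]= v Sa v∈)) f-fixᵇ f-μ I⊆Saᵇ h ⟩
    marg I (P (lookup Sb)) h  ≡⟨ marg-bag b (connectedOn⇒connected H Sb-conn) (λ v v∈ → []=⇒lookup (Sb⊆X (lookup⇒[]= v Sb v∈)))
                                   (λ v v∈ → []=⇒lookup (I⊆Sb (I⇒ v∈))) ([]=⇒lookup (I⊆Sb s∈I)) h ⟨
    marg I (P (X b)) h     ∎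
    where
    open ≡-Reasoning
    I : Fin N → Bool
    I = X a ∩ᵇ X b
    I⇒ : ∀ {v} → I v ≡ true → v ∈ˢ bag D a ∩ bag D b
    I⇒ {v} v∈ = x∈p∩q⁺ (lookup⇒[]= v _ (∧-trueˡ v∈) , lookup⇒[]= v _ (∧-trueʳ {X a v} v∈))
    Sa-connected : Connected H (lookup Sa)
    Sa-connected = connectedOn⇒connected H Sa-conn
    Sa⊆Xa : lookup Sa ⊆ᵇ X a
    Sa⊆Xa v v∈ = []=⇒lookup (Sa⊆X (lookup⇒[]= v Sa v∈))
    I⊆Saᵇ : I ⊆ᵇ lookup Sa
    I⊆Saᵇ v v∈ = []=⇒lookup (I⊆Sa (I⇒ v∈))
    s∈Sa : lookup Sa s ≡ true
    s∈Sa = []=⇒lookup (I⊆Sa s∈I)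
    f-fixᵇ : ∀ v → I v ≡ true → f v ≡ v
    f-fixᵇ v v∈ = f-fix v (I⇒ v∈)
    -- A vertex of the subtree either has a neighbour in it or is fixed by f,
    -- so f preserves whether a vertex is isolated in H.
    f-μ : ∀ v → lookup Sa v ≡ true → ∀ x → μ v x ≡ μ (f v) x
    f-μ v v∈ x with Sa-connected v s v∈ s∈Sa
    ... | _ , here , _ = cong (λ u → μ u x) (sym (f-fix v s∈I))
    ... | _ , step {y = y} v~y p , _ ∷ ps = trans (μ-adjacent v~y x) (sym (μ-adjacent
            (trans (sym (f-adj v y (lookup⇒[]= v Sa v∈) (lookup⇒[]= y Sa (first p ps)))) v~y) x))
      where
      first : ∀ {y z vs} → Walk H y z vs → AllIn H (lookup Sa) vs → lookup Sa y ≡ true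
      first here       (y∈ ∷ _) = y∈
      first (step _ _) (y∈ ∷ _) = y∈

  -- Every path of the decomposition tree from c to b leaves Q for the last time at a: if it did so
  -- at another vertex z, a path inside Q from a to z, the rest of the path to b and the edge ab
  -- would form a cycle. Hence a lies between c and b.
  separation : ∀ {Q a b c} → Connected (T D) Q → Q a ≡ true → Q b ≡ false → Q c ≡ true → Adj (T D) a b →
               X c ∩ᵇ X b ⊆ᵇ X a
  separation {Q} {a} {b} {c} Q-conn a∈Q b∉Q c∈Q a~b v v∈ = []=⇒lookup (interp D c b a on-path
    (x∈p∩q⁺ (lookup⇒[]= v _ (∧-trueˡ v∈) , lookup⇒[]= v _ (∧-trueʳ {X c v} v∈))))
    where

    on-path : ∀ vs → Path (T D) c b vs → a ∈ vs
    on-path vs path with last-exit (T D) Q path b∉Q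
    ... | inj₁ out = ⊥-elim (true≢false c∈Q (first (proj₁ path) out))
      where
      first : ∀ {vs} → Walk (T D) c b vs → All (λ v → Q v ≡ false) vs → Q c ≡ false
      first here       (c∉ ∷ _) = c∉
      first (step _ _) (c∉ ∷ _) = c∉
    ... | inj₂ exit with Exit.last exit ≟ a
    ...   | yes z≡a = subst (_∈ vs) z≡a (Exit.last∈vs exit)
    ...   | no z≢a with detour-cycle (T D) Q-conn a∈Q (Exit.last∈S exit) (λ eq → z≢a (sym eq))
                          (Exit.last~next exit) (Exit.rest-path exit) (Exit.rest∉S exit)
    ...     | us , cyc , 3≤ , _ = ⊥-elim (proj₂ (proj₂ (T-tree D)) (a , b , us , cyc , 3≤ , adj-flip (T D) a~b))

  -- When a bag is glued on, the surplus vertex factors are those of the intersection; together with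
  -- the inverse of `q` they make up the new factor.
  Φ-∪-∩ : ∀ S S′ h → Φ S h * Φ S′ h ≡ Φ (S ∪ᵇ S′) h * Φ (S ∩ᵇ S′) h
  Φ-∪-∩ S S′ h = trans (sym (Prod.⨁-∙ _ _)) (trans (Prod.⨁-cong pointwise) (Prod.⨁-∙ _ _))
    where
    pointwise : ∀ v → ⟦ S v ⟧ μ v (lookup h v) * ⟦ S′ v ⟧ μ v (lookup h v) ≡
                      ⟦ S v ∨ S′ v ⟧ μ v (lookup h v) * ⟦ S v ∧ S′ v ⟧ μ v (lookup h v)
    pointwise v with S v | S′ v
    ... | true  | true  = refl
    ... | true  | false = refl
    ... | false | true  = *-comm _ _
    ... | false | false = refl

  -- The factors are the ratios of the product measure to the marginal of p, one for
  -- each intersection along which a bag was glued.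
  record GluedDensity (Q : Fin k′ → Bool) : Set where
    field
      Q-connected : Connected (T D) Q
      U           : Fin N → Bool
      bags⊆U      : ∀ a → Q a ≡ true → X a ⊆ᵇ U
      U⊆bags      : ∀ v → U v ≡ true → ∃[ a ] (Q a ≡ true × X a v ≡ true)
      p           : Ω → ℚ⁺
      p-dep       : Dep U p
      p-marg      : ∀ a → Q a ≡ true → ∀ h → marg (X a) p h ≡ P (X a) h
      factors     : List (Ω → ℚ⁺)
      factors-≤1  : All (λ B → Dep U B × (∀ h → 𝔼 (λ h → B h * p h) h ≤ 1#)) factors
      p-product   : ∀ h → p h ≡ prodᴸ (evaluate factors h) * (Φ U h * ∏ (λ a → ⟦ Q a ⟧ K (X a) h))

  single-bag : ∀ a → GluedDensity ⁅ a ⁆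
  single-bag a = record
    { Q-connected = connected-⁅⁆ (T D) a
    ; U = X a
    ; bags⊆U = λ b b∈ v v∈ → subst (λ c → X c v ≡ true) (⁅⁆-true b∈) v∈
    ; U⊆bags = λ v v∈ → a , ⁅⁆-refl a , v∈
    ; p = P (X a)
    ; p-dep = P-dep (X a)
    ; p-marg = λ b b∈ h → marg-single b (⁅⁆-true b∈) h
    ; factors = []
    ; factors-≤1 = []
    ; p-product = λ h → trans (sym (*-identityˡ _)) (cong (λ x → 1# * (Φ (X a) h * x)) (sym (single h)))
    }
    where
    marg-single : ∀ b → b ≡ a → ∀ h → marg (X b) (P (X a)) h ≡ P (X b) h
    marg-single b refl = marg-id (P-dep (X a))
    single : ∀ h → ∏ (λ b → ⟦ ⁅ a ⁆ b ⟧ K (X b) h) ≡ K (X a) h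
    single h = trans (Prod.⨁-single _ a (λ b b≢a → Prod.⟦⟧-cong (⁅⁆-≢ b≢a) refl)) (Prod.⟦⟧-cong (⁅⁆-refl a) refl)

  module AddBag {Q a b} (state : GluedDensity Q) (a∈Q : Q a ≡ true) (b∉Q : Q b ≡ false) (a~b : Adj (T D) a b) where
    open GluedDensity state
    open ≡-Reasoning

    I : Fin N → Bool
    I = U ∩ᵇ X b

    -- The running intersection property: the new bag meets all earlier bags only inside its
    -- neighbour a, so consistency with one bag is consistency with everything glued so far.
    I≗ : ∀ v → I v ≡ (X a ∩ᵇ X b) v
    I≗ v = bool-iff to (λ v∈ → ∧-intro {U v} (bags⊆U a a∈Q v (∧-trueˡ v∈)) (∧-trueʳ {X a v} v∈))
      where
      to : I v ≡ true → (X a ∩ᵇ X b) v ≡ true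
      to v∈ with U⊆bags v (∧-trueˡ v∈)
      ... | c , c∈Q , v∈Xc = ∧-intro {X a v}
        (separation Q-connected a∈Q b∉Q c∈Q a~b v (∧-intro {X c v} v∈Xc (∧-trueʳ {U v} v∈))) (∧-trueʳ {U v} v∈)

    consistent : ∀ h → marg I p h ≡ marg I (P (X b)) h
    consistent h = begin
      marg I p h                               ≡⟨ marg-≗ I≗ p h ⟩
      marg (X a ∩ᵇ X b) p h                    ≡⟨ marg-tower {X a ∩ᵇ X b} {X a} (λ v → ∧-trueˡ) p h ⟨
      marg (X a ∩ᵇ X b) (marg (X a) p) h       ≡⟨ marg-cong (X a ∩ᵇ X b) (p-marg a a∈Q) h ⟩
      marg (X a ∩ᵇ X b) (P (X a)) h            ≡⟨ bags-consistent a b a~b h ⟩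
      marg (X a ∩ᵇ X b) (P (X b)) h            ≡⟨ marg-≗ I≗ (P (X b)) h ⟨
      marg I (P (X b)) h                       ∎

    open Gluing p-dep (P-dep (X b)) consistent public

    factor : Ω → ℚ⁺
    factor h = Φ I h * inv (q h)

    factor-dep : Dep I factor
    factor-dep = Dep-* (Φ-dep I) (Dep-inv (marg-dep I (P (X b))))

    I⊆X : I ⊆ᵇ X b
    I⊆X v = ∧-trueʳ {U v}

    -- The marginal of the glued density on I is `q`, which cancels the denominator and leaves the
    -- mean of `Φ I` over the points where `q` is nonzero.
    factor-≤1 : ∀ h → 𝔼 (λ h → factor h * glue h) h ≤ 1#
    factor-≤1 h = subst (_≤ 1#) (sym eq) (≤-trans (𝔼-mono-≤ bound h) (≤-reflexive (𝔼-Φ I h)))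
      where
      eq : 𝔼 (λ h → factor h * glue h) h ≡ 𝔼 (λ h → Φ I h * (q h * inv (q h))) h
      eq = trans (𝔼-marg-* glue factor-dep h) (𝔼-cong (λ h → begin
        factor h * marg I glue h
          ≡⟨ cong (factor h *_) (trans (sym (marg-tower I⊆X glue h)) (marg-cong I marg-glueʳ h)) ⟩
        Φ I h * inv (q h) * q h
          ≡⟨ solve 3 (λ x i y → x :* i :* y := x :* (y :* i)) refl (Φ I h) (inv (q h)) (q h) ⟩
        Φ I h * (q h * inv (q h)) ∎) h)
      bound : ∀ h → Φ I h * (q h * inv (q h)) ≤ Φ I h
      bound h = ≤-trans (*-monoʳ-≤ (Φ I h) (*-inv-≤1 (q h))) (≤-reflexive (*-identityʳ _))

    -- Gluing does not change the marginal on U, on which the earlier factors depend.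
    old-factor-≤1 : ∀ {B} → Dep U B × (∀ h → 𝔼 (λ h → B h * p h) h ≤ 1#) →
                    Dep (U ∪ᵇ X b) B × (∀ h → 𝔼 (λ h → B h * glue h) h ≤ 1#)
    old-factor-≤1 {B} (B-dep , B≤1) = Dep-⊆ (λ v → ∨-trueˡ (X b v)) B-dep , λ h →
      subst (_≤ 1#) (sym (trans (𝔼-marg-* glue B-dep h) (𝔼-cong (λ h → cong (B h *_) (marg-glueˡ h)) h))) (B≤1 h)

    glue-marg : ∀ c → insert b Q c ≡ true → ∀ h → marg (X c) glue h ≡ P (X c) h
    glue-marg c c∈ h with insert⁻ b Q c∈
    ... | inj₂ refl = marg-glueʳ h
    ... | inj₁ c∈Q  = begin
      marg (X c) glue h           ≡⟨ marg-tower (bags⊆U c c∈Q) glue h ⟨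
      marg (X c) (marg U glue) h  ≡⟨ marg-cong (X c) marg-glueˡ h ⟩
      marg (X c) p h              ≡⟨ p-marg c c∈Q h ⟩
      P (X c) h                   ∎

    glue-product : ∀ h → glue h ≡ prodᴸ (evaluate (factor ∷ factors) h) *
                                  (Φ (U ∪ᵇ X b) h * ∏ (λ c → ⟦ insert b Q c ⟧ K (X c) h))
    glue-product h = begin
      p h * (Φ (X b) h * K (X b) h * inv (q h))
        ≡⟨ cong (_* (Φ (X b) h * K (X b) h * inv (q h))) (p-product h) ⟩
      Bs * (Φ U h * Ks) * (Φ (X b) h * K (X b) h * inv (q h))
        ≡⟨ solve 6 (λ B x k y l i → B :* (x :* k) :* (y :* l :* i) := (x :* y) :* (B :* i :* (k :* l))) refl
             Bs (Φ U h) Ks (Φ (X b) h) (K (X b) h) (inv (q h)) ⟩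
      (Φ U h * Φ (X b) h) * (Bs * inv (q h) * (Ks * K (X b) h))
        ≡⟨ cong₂ (λ x y → x * (Bs * inv (q h) * y)) (Φ-∪-∩ U (X b) h) (sym grow) ⟩
      (Φ (U ∪ᵇ X b) h * Φ I h) * (Bs * inv (q h) * Ks′)
        ≡⟨ solve 5 (λ B x z i k → (x :* z) :* (B :* i :* k) := (z :* i :* B) :* (x :* k)) refl
             Bs (Φ (U ∪ᵇ X b) h) (Φ I h) (inv (q h)) Ks′ ⟩
      (Φ I h * inv (q h) * Bs) * (Φ (U ∪ᵇ X b) h * Ks′) ∎
      where
      Bs = prodᴸ (evaluate factors h)
      Ks = ∏ (λ c → ⟦ Q c ⟧ K (X c) h)
      Ks′ = ∏ (λ c → ⟦ insert b Q c ⟧ K (X c) h)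
      grow : Ks′ ≡ Ks * K (X b) h
      grow = Prod.⨁-change _ _ b (K (X b) h)
        (trans (Prod.⟦⟧-cong (insert-∈ b Q) refl)
          (trans (sym (*-identityˡ _)) (cong (_* K (X b) h) (Prod.⟦⟧-cong {x = K (X b) h} (sym b∉Q) refl))))
        (λ c c≢b → Prod.⟦⟧-cong (insert-≢ b Q c≢b) refl)

    add-bag : GluedDensity (insert b Q)
    add-bag = record
      { Q-connected = connected-insert (T D) Q-connected a∈Q a~b
      ; U = U ∪ᵇ X b
      ; bags⊆U = bags⊆
      ; U⊆bags = ⊆bags
      ; p = glue
      ; p-dep = glue-dep
      ; p-marg = glue-marg
      ; factors = factor ∷ factors
      ; factors-≤1 = (Dep-⊆ (λ v v∈ → ∨-trueˡ (X b v) (∧-trueˡ v∈)) factor-dep , factor-≤1) ∷ All.map old-factor-≤1 factors-≤1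
      ; p-product = glue-product
      }
      where
      bags⊆ : ∀ c → insert b Q c ≡ true → X c ⊆ᵇ U ∪ᵇ X b
      bags⊆ c c∈ v v∈ with insert⁻ b Q c∈
      ... | inj₁ c∈Q  = ∨-trueˡ (X b v) (bags⊆U c c∈Q v v∈)
      ... | inj₂ refl = ∨-trueʳ (U v) v∈
      ⊆bags : ∀ v → (U ∪ᵇ X b) v ≡ true → ∃[ c ] (insert b Q c ≡ true × X c v ≡ true)
      ⊆bags v v∈ with ∨-true⁻ (U v) v∈
      ... | inj₂ v∈Xb = b , insert-∈ b Q , v∈Xb
      ... | inj₁ v∈U with U⊆bags v v∈U
      ...   | c , c∈Q , v∈Xc = c , insert-⊇ b Q c c∈Q , v∈Xc

  -- The spreading argument that grows subtrees of H is applied to the decomposition tree, with the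
  -- glued density as the data carried along.
  all-bags : ∃[ Q ] (GluedDensity Q × (∀ a → Q a ≡ true))
  all-bags with root (T-tree D)
    where
    root : IsTree (T D) → Fin k′
    root (1≤n , _) = Data.Fin.fromℕ< 1≤n
  ... | r with Spread.spread (T D) (λ _ → true) GluedDensity
                 (λ state a∈Q b∉Q _ a~b → AddBag.add-bag state a∈Q b∉Q a~b)
                 {s = r} connected refl (single-bag r) (⁅⁆-refl r)
    where
    connected : Connected (T D) (λ _ → true)
    connected x y _ _ with proj₁ (proj₂ (T-tree D)) x y
    ... | vs , p = vs , p , All.tabulate (λ _ → refl)
  ...   | Q , state , all = Q , state , (λ a → all a refl)

-- Counting homomorphisms

edges-∑ : ∀ G x → ∑ (λ i → ∑ (λ j → Sum.⟦ (i <ᶠ j) ∧ adj G i j ⟧ x)) ≡ E G ×ₙ x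
edges-∑ G x = sym (Sum.⨁-cartesianProduct _ id id x)

edges-∏ : ∀ G x → ∏ (λ i → ∏ (λ j → ⟦ (i <ᶠ j) ∧ adj G i j ⟧ x)) ≡ x ^ E G
edges-∏ G x = sym (Prod.⨁-cartesianProduct _ id id x)

handshake : ∀ G → ∑ (λ i → ∑ (λ j → Sum.⟦ adj G i j ⟧ 1#)) ≡ fromℕ (2 ℕ.* E G)
handshake G = begin
  ∑ (λ i → ∑ (λ j → Sum.⟦ adj G i j ⟧ 1#))
    ≡⟨ Sum.⨁-symmetrise (adj G) (adj-sym G) (adj-irrefl G) (λ _ _ → 1#) ⟨
  ∑ (λ i → ∑ (λ j → Sum.⟦ (i <ᶠ j) ∧ adj G i j ⟧ (1# + 1#)))
    ≡⟨ Sum.⨁-cong (λ i → trans (Sum.⨁-cong (λ j → Sum.⟦⟧-∙ ((i <ᶠ j) ∧ adj G i j) 1# 1#)) (Sum.⨁-∙ _ _)) ⟩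
  ∑ (λ i → ∑ (λ j → Sum.⟦ (i <ᶠ j) ∧ adj G i j ⟧ 1#) + ∑ (λ j → Sum.⟦ (i <ᶠ j) ∧ adj G i j ⟧ 1#))
    ≡⟨ Sum.⨁-∙ _ _ ⟩
  ∑ (λ i → ∑ (λ j → Sum.⟦ (i <ᶠ j) ∧ adj G i j ⟧ 1#)) + ∑ (λ i → ∑ (λ j → Sum.⟦ (i <ᶠ j) ∧ adj G i j ⟧ 1#))
    ≡⟨ cong₂ _+_ (edges-∑ G 1#) (edges-∑ G 1#) ⟩
  fromℕ (E G) + fromℕ (E G)
    ≡⟨ cong (fromℕ (E G) +_) (+-identityʳ _) ⟨
  fromℕ (E G) + (fromℕ (E G) + fromℕ 0)
    ≡⟨ trans (fromℕ-+ (E G) (E G ℕ.+ 0)) (cong (fromℕ (E G) +_) (fromℕ-+ (E G) 0)) ⟨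
  fromℕ (2 ℕ.* E G) ∎
  where open ≡-Reasoning

module _ {n : ℕ} (n≢0 : fromℕ n ≢ 0#) where

  private
    module Av N = Averaging N n n≢0

  Avg-suc : ∀ {N} vs F a (h : Vec (Fin n) N) → Av.Avg (suc N) (map suc vs) F (a ∷ h) ≡ Av.Avg N vs (λ h → F (a ∷ h)) h
  Avg-suc {N} []       F a h = refl
  Avg-suc {N} (v ∷ vs) F a h = cong (Av.ν N *_) (Sum.⨁-cong (λ b → Avg-suc vs F a (h Vec.[ v ]≔ b)))

  Avg-allMaps : ∀ N F h → Av.Avg N (allFin N) F h ≡ inv (fromℕ n) ^ N * sumᴸ (map F (allMaps N n))
  Avg-allMaps zero    F [] = trans (sym (+-identityʳ _)) (sym (*-identityˡ _))
  Avg-allMaps (suc N) F (b ∷ h) = begin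
    ν * ∑ (λ a → Av.Avg (suc N) (tabulate suc) F (a ∷ h))
      ≡⟨ cong (ν *_) (Sum.⨁-cong (λ a → cong (λ vs → Av.Avg (suc N) vs F (a ∷ h)) (map-tabulate id suc))) ⟨
    ν * ∑ (λ a → Av.Avg (suc N) (map suc (allFin N)) F (a ∷ h))
      ≡⟨ cong (ν *_) (Sum.⨁-cong (λ a → trans (Avg-suc (allFin N) F a h) (Avg-allMaps N (λ h → F (a ∷ h)) h))) ⟩
    ν * ∑ (λ a → ν ^ N * sumᴸ (map (λ h → F (a ∷ h)) (allMaps N n)))
      ≡⟨ cong (ν *_) (∑-*ˡ (ν ^ N) _) ⟨
    ν * (ν ^ N * ∑ (λ a → sumᴸ (map (λ h → F (a ∷ h)) (allMaps N n))))
      ≡⟨ *-assoc ν _ _ ⟨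
    ν ^ suc N * ∑ (λ a → sumᴸ (map (λ h → F (a ∷ h)) (allMaps N n)))
      ≡⟨ cong (ν ^ suc N *_) (Sum.⨁-cong (λ a → cong sumᴸ (map-∘ (allMaps N n)))) ⟩
    ν ^ suc N * ∑ (λ a → sumᴸ (map F (map (a ∷_) (allMaps N n))))
      ≡⟨ cong (ν ^ suc N *_) (Sum.⨁ᴸ-concatMap F (λ a → map (a ∷_) (allMaps N n)) id) ⟨
    ν ^ suc N * sumᴸ (map F (allMaps (suc N) n)) ∎
    where
    open ≡-Reasoning
    ν = inv (fromℕ n)

indicator : ∀ {A : Set} {Q : A → Set} → Decidable Q → A → ℚ⁺
indicator Q? x = if does (Q? x) then 1# else 0#

indicator-true : ∀ {A : Set} {Q : A → Set} (Q? : Decidable Q) {x} → Q x → indicator Q? x ≡ 1#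
indicator-true Q? {x} qx with Q? x
... | yes _  = refl
... | no ¬qx = ⊥-elim (¬qx qx)

sumᴸ-indicator : ∀ {A : Set} {Q : A → Set} (Q? : Decidable Q) xs → sumᴸ (map (indicator Q?) xs) ≡ fromℕ (length (filter Q? xs))
sumᴸ-indicator Q? []       = refl
sumᴸ-indicator Q? (x ∷ xs) with does (Q? x)
... | true  = cong (1# +_) (sumᴸ-indicator Q? xs)
... | false = trans (+-identityˡ _) (sumᴸ-indicator Q? xs)

module _ (H G : Graph) (n≢0 : fromℕ ∣ G ∣ᵛ ≢ 0#) where

  open Averaging ∣ H ∣ᵛ ∣ G ∣ᵛ n≢0

  𝔼-isHom : ∀ h → 𝔼 (indicator (isHom? H G)) h ≡ ν ^ ∣ H ∣ᵛ * fromℕ (homCount H G)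
  𝔼-isHom h = trans (𝔼-def _ h) (trans (Avg-allMaps n≢0 ∣ H ∣ᵛ (indicator (isHom? H G)) h)
    (cong (ν ^ ∣ H ∣ᵛ *_) (sumᴸ-indicator (isHom? H G) (allMaps ∣ H ∣ᵛ ∣ G ∣ᵛ))))

  edge-weights-≢0⇒IsHom : ∀ h (x : Fin ∣ H ∣ᵛ → Fin ∣ H ∣ᵛ → ℚ⁺) → (∀ i j → x i j ≢ 0# → Adj G (lookup h i) (lookup h j)) →
                       ∏ (λ i → ∏ (λ j → ⟦ (i <ᶠ j) ∧ adj H i j ⟧ x i j)) ≢ 0# → IsHom H G h
  edge-weights-≢0⇒IsHom h x x⇒ ne u v u~v with <ᶠ-trichotomy u v
  ... | inj₁ refl = ⊥-elim (true≢false u~v (adj-irrefl H u))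
  ... | inj₂ (inj₁ (u<v , _)) = x⇒ u v (subst (_≢ 0#)
          (Prod.⟦⟧-cong (∧-intro {u <ᶠ v} u<v u~v) refl) (∏-≢0 (∏-≢0 ne u) v))
  ... | inj₂ (inj₂ (_ , v<u)) = adj-flip G (x⇒ v u (subst (_≢ 0#)
          (Prod.⟦⟧-cong (∧-intro {v <ᶠ u} v<u (adj-flip H u~v)) refl) (∏-≢0 (∏-≢0 ne v) u)))

-- The averaged arithmetic-geometric mean inequality

module Hölder {N n : ℕ} (n≢0 : fromℕ n ≢ 0#) where

  open Averaging N n n≢0

  private
    𝔼-sum-≤ : ∀ {p : Ω → ℚ⁺} Fs → All (λ F → ∀ h → 𝔼 (λ h → F h * p h) h ≤ 1#) Fs →
              ∀ h → 𝔼 (λ h → sumᴸ (evaluate Fs h) * p h) h ≤ fromℕ (length Fs)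
    𝔼-sum-≤ {p} []       []         h = ≤-reflexive (trans (𝔼-cong (λ h → zeroˡ (p h)) h) (𝔼-const 0# h))
    𝔼-sum-≤ {p} (F ∷ Fs) (F≤ ∷ Fs≤) h = ≤-trans
      (≤-reflexive (trans (𝔼-cong (λ h → distribʳ (p h) (F h) _) h) (𝔼-+ _ _ h)))
      (+-mono-≤ (F≤ h) (𝔼-sum-≤ Fs Fs≤ h))

    length-evaluate : ∀ Fs h → length (evaluate Fs h) ≡ length Fs
    length-evaluate []       h = refl
    length-evaluate (F ∷ Fs) h = cong suc (length-evaluate Fs h)

  -- By AM-GM the sum of the functions is pointwise at least their number; now average.
  hölder : ∀ {p g : Ω → ℚ⁺} Fs → (∀ h → 𝔼 p h ≡ 1#) → (∀ h → p h ≢ 0# → 1# ≤ prodᴸ (g h ∷ evaluate Fs h)) →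
           All (λ F → ∀ h → 𝔼 (λ h → F h * p h) h ≤ 1#) Fs → ∀ h → 1# ≤ 𝔼 (λ h → g h * p h) h
  hölder {p} {g} Fs mass product Fs≤ h = +-cancelˡ-≤ (fromℕ (length Fs)) (subst₂ _≤_
    (trans (*-identityʳ _) (+-comm 1# _)) (+-comm _ (fromℕ (length Fs))) (≤-trans lower upper))
    where
    m : ℚ⁺
    m = fromℕ (suc (length Fs))
    pointwise : ∀ h → m * p h ≤ g h * p h + sumᴸ (evaluate Fs h) * p h
    pointwise h with p h ≟0
    ... | yes p≡0 rewrite p≡0 | zeroʳ m = 0≤x _
    ... | no  p≢0 = subst₂ _≤_ (*-comm (p h) m)
      (trans (*-comm (p h) _) (distribʳ (p h) (g h) _))
      (*-monoʳ-≤ (p h) (subst (λ l → fromℕ l ≤ sumᴸ (g h ∷ evaluate Fs h)) (cong suc (length-evaluate Fs h))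
        (am-gm (g h ∷ evaluate Fs h) (product h p≢0))))
    lower : m * 1# ≤ 𝔼 (λ h → g h * p h + sumᴸ (evaluate Fs h) * p h) h
    lower = subst (_≤ 𝔼 (λ h → g h * p h + sumᴸ (evaluate Fs h) * p h) h) (trans (𝔼-*ˡ m p h) (cong (m *_) (mass h))) (𝔼-mono-≤ pointwise h)
    upper : 𝔼 (λ h → g h * p h + sumᴸ (evaluate Fs h) * p h) h ≤ 𝔼 (λ h → g h * p h) h + fromℕ (length Fs)
    upper = ≤-trans (≤-reflexive (𝔼-+ _ _ h)) (+-mono-≤ ≤-refl (𝔼-sum-≤ Fs Fs≤ h))

-- Normalisation, product identity and the homomorphism density

module Scaling (H G : Graph) (n≢0 : fromℕ ∣ G ∣ᵛ ≢ 0#) (e≢0 : fromℕ (2 ℕ.* E G) ≢ 0#) where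

  open Averaging ∣ H ∣ᵛ ∣ G ∣ᵛ n≢0
  open Density H G n≢0

  -- The kernel takes the value 1/ρ on edges, the height at which its mean over all pairs of
  -- vertices of G is 1.
  ρ β : ℚ⁺
  ρ = fromℕ (2 ℕ.* E G) * (ν * ν)
  β = inv ρ

  ρ*β≡1 : ρ * β ≡ 1#
  ρ*β≡1 = *-inv ρ≢0
    where
    ρ≢0 : ρ ≢ 0#
    ρ≢0 eq with x*y≡0⇒x≡0⊎y≡0 eq
    ... | inj₁ e≡0  = e≢0 e≡0
    ... | inj₂ νν≡0 with x*y≡0⇒x≡0⊎y≡0 νν≡0
    ...   | inj₁ ν≡0 = ν≢0 ν≡0
    ...   | inj₂ ν≡0 = ν≢0 ν≡0

  normalised : ν * ∑ (λ a → ν * ∑ (λ b → kernel β a b)) ≡ 1#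
  normalised = begin
    ν * ∑ (λ a → ν * ∑ (λ b → kernel β a b))
      ≡⟨ cong (ν *_) (Sum.⨁-cong row) ⟩
    ν * ∑ (λ a → (ν * β) * ∑ (λ b → Sum.⟦ adj G a b ⟧ 1#))
      ≡⟨ cong (ν *_) (∑-*ˡ (ν * β) _) ⟨
    ν * ((ν * β) * ∑ (λ a → ∑ (λ b → Sum.⟦ adj G a b ⟧ 1#)))
      ≡⟨ cong (λ e → ν * ((ν * β) * e)) (handshake G) ⟩
    ν * ((ν * β) * fromℕ (2 ℕ.* E G))
      ≡⟨ solve 3 (λ u b e → u :* ((u :* b) :* e) := (e :* (u :* u)) :* b) refl ν β (fromℕ (2 ℕ.* E G)) ⟩
    ρ * β
      ≡⟨ ρ*β≡1 ⟩
    1# ∎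
    where
    open ≡-Reasoning
    entry : ∀ a b → kernel β a b ≡ β * Sum.⟦ adj G a b ⟧ 1#
    entry a b with adj G a b
    ... | true  = sym (*-identityʳ β)
    ... | false = sym (zeroʳ β)
    row : ∀ a → ν * ∑ (λ b → kernel β a b) ≡ (ν * β) * ∑ (λ b → Sum.⟦ adj G a b ⟧ 1#)
    row a = trans (cong (ν *_) (trans (Sum.⨁-cong (entry a)) (sym (∑-*ˡ β _)))) (sym (*-assoc ν β _))

module Main (H G : Graph) (n≢0 : fromℕ ∣ G ∣ᵛ ≢ 0#) (β : ℚ⁺)
            (normalised : Averaging.ν ∣ H ∣ᵛ ∣ G ∣ᵛ n≢0 *
              ∑ (λ a → Averaging.ν ∣ H ∣ᵛ ∣ G ∣ᵛ n≢0 * ∑ (λ b → Density.kernel H G n≢0 β a b)) ≡ 1#)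
            (D : TreeDecomposition H) (strong : IsStrong H D) where

  open Averaging ∣ H ∣ᵛ ∣ G ∣ᵛ n≢0
  open Density H G n≢0

  private
    N = ∣ H ∣ᵛ

  open Kernel β normalised
  open Trees H G n≢0 β normalised
  open Glued H G n≢0 β normalised D strong

  module _ {Q} (state : GluedDensity Q) (all∈Q : ∀ a → Q a ≡ true) where
    open GluedDensity state
    open ≡-Reasoning

    all∈U : ∀ v → U v ≡ true
    all∈U v with cover D v
    ... | a , v∈a = bags⊆U a (all∈Q a) v ([]=⇒lookup v∈a)

    -- An edge of H lies in some bag by the covering condition, and in no second one by
    -- edge-disjointness.
    edge-in-one-bag : ∀ i j x → ∏ (λ a → ⟦ (i <ᶠ j) ∧ edgeIn (X a) i j ⟧ x) ≡ ⟦ (i <ᶠ j) ∧ adj H i j ⟧ x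
    edge-in-one-bag i j x with true-or-false (adj H i j)
    ... | inj₂ i≁j = trans (Prod.⨁-ε _ (λ a → Prod.⟦⟧-cong (∧-falseʳ (i <ᶠ j) (cong (_∧ (X a i ∧ X a j)) i≁j)) refl))
                           (sym (Prod.⟦⟧-cong (∧-falseʳ (i <ᶠ j) i≁j) refl))
    ... | inj₁ i~j with edge D i j i~j
    ...   | a , i∈a , j∈a = trans (Prod.⨁-single _ a (λ b b≢a → Prod.⟦⟧-cong (∧-falseʳ (i <ᶠ j) (other b b≢a)) refl))
                                  (Prod.⟦⟧-cong (cong ((i <ᶠ j) ∧_) (trans this (sym i~j))) refl)
      where
      this : edgeIn (X a) i j ≡ true
      this = ∧-intro i~j (∧-intro ([]=⇒lookup i∈a) ([]=⇒lookup j∈a))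
      other : ∀ b → b ≢ a → edgeIn (X b) i j ≡ false
      other b b≢a = not-true⇒false (λ eq → proj₁ (proj₂ strong) a b (λ a≡b → b≢a (sym a≡b)) i j i~j
        ( i∈a , j∈a , lookup⇒[]= i _ (∧-trueˡ (∧-trueʳ {adj H i j} eq))
        , lookup⇒[]= j _ (∧-trueʳ {X b i} (∧-trueʳ {adj H i j} eq))))

    κ : Ω → Fin N → Fin N → ℚ⁺
    κ h i j = k i j (lookup h i) (lookup h j)

    ∏-K : ∀ h → ∏ (λ a → ⟦ Q a ⟧ K (X a) h) ≡ ∏ (λ i → ∏ (λ j → ⟦ (i <ᶠ j) ∧ adj H i j ⟧ κ h i j))
    ∏-K h = begin
      ∏ (λ a → ⟦ Q a ⟧ K (X a) h)
        ≡⟨ Prod.⨁-cong (λ a → Prod.⟦⟧-cong (all∈Q a) refl) ⟩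
      ∏ (λ a → ∏ (λ i → ∏ (λ j → ⟦ (i <ᶠ j) ∧ edgeIn (X a) i j ⟧ κ h i j)))
        ≡⟨ Prod.⨁-comm _ ⟩
      ∏ (λ i → ∏ (λ a → ∏ (λ j → ⟦ (i <ᶠ j) ∧ edgeIn (X a) i j ⟧ κ h i j)))
        ≡⟨ Prod.⨁-cong (λ i → Prod.⨁-comm _) ⟩
      ∏ (λ i → ∏ (λ j → ∏ (λ a → ⟦ (i <ᶠ j) ∧ edgeIn (X a) i j ⟧ κ h i j)))
        ≡⟨ Prod.⨁-cong (λ i → Prod.⨁-cong (λ j → edge-in-one-bag i j _)) ⟩
      ∏ (λ i → ∏ (λ j → ⟦ (i <ᶠ j) ∧ adj H i j ⟧ κ h i j)) ∎

    C : Fin N → Ω → ℚ⁺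
    C v h = inv (μ v (lookup h v))

    -- It vanishes off the homomorphisms and is constant on them, so it determines the support of
    -- `p`.
    W : Ω → ℚ⁺
    W h = ∏ (λ i → ∏ (λ j → ⟦ (i <ᶠ j) ∧ adj H i j ⟧ w (lookup h i) (lookup h j)))

    -- Every edge divides by `μ` at both of its ends; collected by vertices, this is one division
    -- for each incident edge.
    ∏-κ : ∀ h → ∏ (λ i → ∏ (λ j → ⟦ (i <ᶠ j) ∧ adj H i j ⟧ κ h i j)) ≡ W h * ∏ (λ v → C v h ^ degree v)
    ∏-κ h = begin
      ∏ (λ i → ∏ (λ j → ⟦ (i <ᶠ j) ∧ adj H i j ⟧ κ h i j))
        ≡⟨ Prod.⨁-cong (λ i → trans (Prod.⨁-cong (λ j → Prod.⟦⟧-∙ ((i <ᶠ j) ∧ adj H i j) _ _)) (Prod.⨁-∙ _ _)) ⟩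
      ∏ (λ i → ∏ (λ j → ⟦ (i <ᶠ j) ∧ adj H i j ⟧ w (lookup h i) (lookup h j))
             * ∏ (λ j → ⟦ (i <ᶠ j) ∧ adj H i j ⟧ (C i h * C j h)))
        ≡⟨ Prod.⨁-∙ _ _ ⟩
      W h * ∏ (λ i → ∏ (λ j → ⟦ (i <ᶠ j) ∧ adj H i j ⟧ (C i h * C j h)))
        ≡⟨ cong (W h *_) (Prod.⨁-symmetrise (adj H) (adj-sym H) (adj-irrefl H) (λ i j → C i h)) ⟩
      W h * ∏ (λ i → ∏ (λ j → ⟦ adj H i j ⟧ C i h))
        ≡⟨ cong (W h *_) (Prod.⨁-cong (λ i → ∏-count (adj H i) (C i h))) ⟩
      W h * ∏ (λ v → C v h ^ degree v) ∎

    p-expanded : ∀ h → p h ≡ prodᴸ (evaluate factors h) * (∏ (λ v → μ v (lookup h v)) * (W h * ∏ (λ v → C v h ^ degree v)))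
    p-expanded h = trans (p-product h) (cong₂ (λ x y → prodᴸ (evaluate factors h) * (x * y))
      (Prod.⨁-cong (λ v → Prod.⟦⟧-cong (all∈U v) refl)) (trans (∏-K h) (∏-κ h)))

    isHom : ∀ h → p h ≢ 0# → IsHom H G h
    isHom h p≢0 = edge-weights-≢0⇒IsHom H G n≢0 h (λ i j → w (lookup h i) (lookup h j)) (λ i j → w≢0 _ _)
      (*-≢0ˡ (*-≢0ʳ (*-≢0ʳ (subst (_≢ 0#) (p-expanded h) p≢0))))
      where
      w≢0 : ∀ a b → w a b ≢ 0# → Adj G a b
      w≢0 a b ne with adj G a b
      ... | true  = refl
      ... | false = ⊥-elim (ne refl)

    W-isHom : ∀ h → IsHom H G h → W h ≡ β ^ E H
    W-isHom h hom = trans (Prod.⨁-cong (λ i → Prod.⨁-cong (λ j → Prod.⟦⟧-congʳ ((i <ᶠ j) ∧ adj H i j)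
      (λ eq → cong (if_then β else 0#) (hom i j (∧-trueʳ {i <ᶠ j} eq)))))) (edges-∏ H β)

    -- Of the deg v inverses at v one is consumed by the vertex factor of `p`. Truncated subtraction
    -- gives no copies at an isolated vertex, which agrees with the weight 1 there.
    Cs : List (Ω → ℚ⁺)
    Cs = concatMap (λ v → replicate (degree v ℕ.∸ 1) (C v)) (allFin N)

    prod-Cs : ∀ h → prodᴸ (evaluate Cs h) ≡ ∏ (λ v → C v h ^ (degree v ℕ.∸ 1))
    prod-Cs h = trans (Prod.⨁ᴸ-concatMap (λ F → F h) _ id) (Prod.⨁-cong (λ v → power (degree v ℕ.∸ 1) v))
      where
      power : ∀ m v → prodᴸ (evaluate (replicate m (C v)) h) ≡ C v h ^ m
      power zero    v = refl
      power (suc m) v = cong (C v h *_) (power m v)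

    cancel-μ : ∀ h → (∀ v → μ v (lookup h v) ≢ 0#) →
               ∏ (λ v → μ v (lookup h v)) * ∏ (λ v → C v h ^ degree v) ≡ prodᴸ (evaluate Cs h)
    cancel-μ h μ≢0 = trans (sym (Prod.⨁-∙ _ _)) (trans (Prod.⨁-cong (λ v → vertex (degree v) (μ≢0 v))) (sym (prod-Cs h)))
      where
      vertex : ∀ d {a} → weight d a ≢ 0# → weight d a * inv (weight d a) ^ d ≡ inv (weight d a) ^ (d ℕ.∸ 1)
      vertex zero    _  = *-identityˡ 1#
      vertex (suc d) {a} ne = trans (sym (*-assoc _ _ _)) (trans (cong (_* inv (weight (suc d) a) ^ d) (*-inv ne)) (*-identityˡ _))

    -- Any bag containing v shows that the marginal of `p` at v is `μ v`, which cancels the inverse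
    -- except at its zeros.
    C-≤1 : ∀ v h → 𝔼 (λ h → C v h * p h) h ≤ 1#
    C-≤1 v h with cover D v
    ... | a , v∈a = subst (_≤ 1#) (sym (trans (𝔼-marg-* {⁅ v ⁆} p C-dep h) (𝔼-cong (λ h → cong (C v h *_) (marg-v h)) h)))
      (≤-trans (𝔼-mono-≤ (λ h → ≤-trans (≤-reflexive (*-comm _ _)) (*-inv-≤1 (μ v (lookup h v)))) h) (≤-reflexive (𝔼-const 1# h)))
      where
      C-dep : Dep ⁅ v ⁆ (C v)
      C-dep h h′ agree = cong (λ a → inv (μ v a)) (agree v (⁅⁆-refl v))
      v⊆Xa : ⁅ v ⁆ ⊆ᵇ X a
      v⊆Xa u u∈ = subst (λ u → X a u ≡ true) (sym (⁅⁆-true u∈)) ([]=⇒lookup v∈a)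
      marg-v : ∀ h → marg ⁅ v ⁆ p h ≡ μ v (lookup h v)
      marg-v h = begin
        marg ⁅ v ⁆ p h               ≡⟨ marg-tower v⊆Xa p h ⟨
        marg ⁅ v ⁆ (marg (X a) p) h  ≡⟨ marg-cong ⁅ v ⁆ (p-marg a (all∈Q a)) h ⟩
        marg ⁅ v ⁆ (P (X a)) h       ≡⟨ marg-tree {s = v} (X-connected a) (X-acyclic a) (connected-⁅⁆ H v) v⊆Xa (⁅⁆-refl v) h ⟩
        P ⁅ v ⁆ h                    ≡⟨ P-⁅⁆ v h ⟩
        μ v (lookup h v)             ∎

    mass : ∀ h → 𝔼 p h ≡ 1#
    mass h = begin
      𝔼 p h               ≡⟨ 𝔼-marg (X a) p h ⟨
      𝔼 (marg (X a) p) h  ≡⟨ 𝔼-cong (p-marg a (all∈Q a)) h ⟩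
      𝔼 (P (X a)) h       ≡⟨ 𝔼-tree (X-connected a) (X-acyclic a) (proj₂ (X-nonempty a)) h ⟩
      1#                  ∎
      where
      a : Fin ∣ T D ∣ᵛ
      a = fromℕ< (proj₁ (T-tree D))

    g : Ω → ℚ⁺
    g h = β ^ E H * inv (p h)

    -- On the support of `p` the edge weights in the expansion of `p` multiply to `β ^ E H`, so the
    -- product is `p h` times its inverse.
    product-≡1 : ∀ h → p h ≢ 0# → prodᴸ (g h ∷ evaluate (factors ++ Cs) h) ≡ 1#
    product-≡1 h p≢0 = begin
      g h * prodᴸ (evaluate (factors ++ Cs) h)
        ≡⟨ cong (g h *_) (trans (cong prodᴸ (map-++ (λ F → F h) factors Cs)) (Prod.⨁ᴸ-++ (evaluate factors h) (evaluate Cs h))) ⟩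
      β ^ E H * inv (p h) * (Bs * prodᴸ (evaluate Cs h))
        ≡⟨ cong (λ x → β ^ E H * inv (p h) * (Bs * x)) (cancel-μ h μ≢0) ⟨
      β ^ E H * inv (p h) * (Bs * (Μ * Cd))
        ≡⟨ solve 5 (λ b i B m c → b :* i :* (B :* (m :* c)) := (B :* (m :* (b :* c))) :* i) refl (β ^ E H) (inv (p h)) Bs Μ Cd ⟩
      Bs * (Μ * (β ^ E H * Cd)) * inv (p h)
        ≡⟨ cong (λ x → Bs * (Μ * (x * Cd)) * inv (p h)) (W-isHom h (isHom h p≢0)) ⟨
      Bs * (Μ * (W h * Cd)) * inv (p h)
        ≡⟨ cong (_* inv (p h)) (p-expanded h) ⟨
      p h * inv (p h)
        ≡⟨ *-inv p≢0 ⟩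
      1# ∎
      where
      Bs Μ Cd : ℚ⁺
      Bs = prodᴸ (evaluate factors h)
      Μ = ∏ (λ v → μ v (lookup h v))
      Cd = ∏ (λ v → C v h ^ degree v)
      μ≢0 : ∀ v → μ v (lookup h v) ≢ 0#
      μ≢0 = ∏-≢0 (*-≢0ˡ (*-≢0ʳ (subst (_≢ 0#) (p-expanded h) p≢0)))

    -- The product of `p` with its inverse is the indicator of its support, which consists of
    -- homomorphisms.
    g*p≤ : ∀ h → g h * p h ≤ β ^ E H * indicator (isHom? H G) h
    g*p≤ h = subst (_≤ _) (sym (*-assoc (β ^ E H) (inv (p h)) (p h))) (*-monoʳ-≤ (β ^ E H) bound)
      where
      bound : inv (p h) * p h ≤ indicator (isHom? H G) h
      bound with p h ≟0
      ... | yes p≡0 = subst (_≤ _) (sym (trans (cong (inv (p h) *_) p≡0) (zeroʳ _))) (0≤x _)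
      ... | no  p≢0 = ≤-reflexive (trans (*-comm (inv (p h)) (p h)) (trans (*-inv p≢0)
                        (sym (indicator-true (isHom? H G) {h} (isHom h p≢0)))))

    density-bound : ∀ (h : Ω) → 1# ≤ β ^ E H * 𝔼 (indicator (isHom? H G)) h
    density-bound h = ≤-trans
      (Hölder.hölder n≢0 (factors ++ Cs) mass (λ h p≢0 → ≤-reflexive (sym (product-≡1 h p≢0)))
        (Allₚ.++⁺ (All.map proj₂ factors-≤1)
          (Allₚ.concat⁺ (Allₚ.map⁺ (Allₚ.tabulate⁺ (λ v → Allₚ.replicate⁺ (degree v ℕ.∸ 1) (C-≤1 v)))))) h)
      (≤-trans (𝔼-mono-≤ g*p≤ h) (≤-reflexive (𝔼-*ˡ (β ^ E H) _ h)))

  homomorphism-density : ∀ (h : Ω) → 1# ≤ β ^ E H * 𝔼 (indicator (isHom? H G)) h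
  homomorphism-density with all-bags
  ... | Q , state , all∈Q = density-bound state all∈Q

-- Edgeless graphs and clearing of denominators

edgeless-isHom : ∀ H G → E H ≡ 0 → ∀ h → IsHom H G h
edgeless-isHom H G e≡0 h u v u~v = ⊥-elim (absurd (<ᶠ-trichotomy u v))
  where
  -- Placing 0 on every edge gives 0 to the power `E H`, which is 1 here; so no factor 0 occurs and
  -- H has no adjacent pair.
  ne : ∏ (λ i → ∏ (λ j → ⟦ (i <ᶠ j) ∧ adj H i j ⟧ 0#)) ≢ 0#
  ne eq = 1≢0 (trans (cong (0# ^_) (sym e≡0)) (trans (sym (edges-∏ H 0#)) eq))
  no-edge : ∀ i j → (i <ᶠ j) ≡ true → Adj H i j → ⊥
  no-edge i j i<j i~j = ∏-≢0 (∏-≢0 ne i) j (Prod.⟦⟧-cong (∧-intro {i <ᶠ j} i<j i~j) refl)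
  absurd : _ → ⊥
  absurd (inj₁ refl)             = true≢false u~v (adj-irrefl H u)
  absurd (inj₂ (inj₁ (u<v , _))) = no-edge u v u<v u~v
  absurd (inj₂ (inj₂ (_ , v<u))) = no-edge v u v<u (adj-flip H u~v)

module _ (H G : Graph) (1≤n : 1 ℕ.≤ ∣ G ∣ᵛ) where

  private
    n≢0 : fromℕ ∣ G ∣ᵛ ≢ 0#
    n≢0 eq with fromℕ-cancel-≤ ∣ G ∣ᵛ 0 (≤-reflexive eq)
    ... | n≤0 = ℕₚ.<⇒≱ 1≤n n≤0

    n e hc : ℚ⁺
    n  = fromℕ ∣ G ∣ᵛ
    e  = fromℕ (2 ℕ.* E G)
    hc = fromℕ (homCount H G)

    open Averaging ∣ H ∣ᵛ ∣ G ∣ᵛ n≢0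

    h₀ : Ω
    h₀ = Vec.replicate ∣ H ∣ᵛ (fromℕ< 1≤n)

  edgeless-sidorenko : E H ≡ 0 → ∣ G ∣ᵛ ℕ.^ ∣ H ∣ᵛ ℕ.≤ homCount H G
  edgeless-sidorenko e≡0 = fromℕ-cancel-≤ _ _ (subst₂ _≤_ (trans (*-identityʳ _) (sym (fromℕ-^ ∣ G ∣ᵛ ∣ H ∣ᵛ)))
    (begin
      n ^ ∣ H ∣ᵛ * (ν ^ ∣ H ∣ᵛ * hc)  ≡⟨ *-assoc _ _ _ ⟨
      n ^ ∣ H ∣ᵛ * ν ^ ∣ H ∣ᵛ * hc    ≡⟨ cong (_* hc) (^-distrib-* n ν ∣ H ∣ᵛ) ⟨
      (n * ν) ^ ∣ H ∣ᵛ * hc           ≡⟨ cong (λ x → x ^ ∣ H ∣ᵛ * hc) n*ν≡1 ⟩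
      1# ^ ∣ H ∣ᵛ * hc                ≡⟨ cong (_* hc) (1^ ∣ H ∣ᵛ) ⟩
      1# * hc                         ≡⟨ *-identityˡ hc ⟩
      hc                              ∎)
    (*-monoʳ-≤ (n ^ ∣ H ∣ᵛ) (≤-reflexive (begin
      1#                             ≡⟨ 𝔼-const 1# h₀ ⟨
      𝔼 (λ _ → 1#) h₀                ≡⟨ 𝔼-cong (λ h → sym (indicator-true (isHom? H G) {h} (edgeless-isHom H G e≡0 h))) h₀ ⟩
      𝔼 (indicator (isHom? H G)) h₀  ≡⟨ 𝔼-isHom H G n≢0 h₀ ⟩
      ν ^ ∣ H ∣ᵛ * hc                ∎))))
    where open ≡-Reasoning

  module _ (e≢0 : fromℕ (2 ℕ.* E G) ≢ 0#) (D : TreeDecomposition H) (strong : IsStrong H D) where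

    open Scaling H G n≢0 e≢0

    e*β≡n*n : e * β ≡ n * n
    e*β≡n*n = begin
      e * β                        ≡⟨ *-identityʳ _ ⟨
      e * β * 1#                   ≡⟨ cong (e * β *_) (trans (cong₂ _*_ n*ν≡1 n*ν≡1) (*-identityˡ 1#)) ⟨
      e * β * ((n * ν) * (n * ν))  ≡⟨ solve 4 (λ e b n u → e :* b :* ((n :* u) :* (n :* u)) := n :* n :* ((e :* (u :* u)) :* b)) refl e β n ν ⟩
      n * n * (ρ * β)              ≡⟨ cong (n * n *_) ρ*β≡1 ⟩
      n * n * 1#                   ≡⟨ *-identityʳ _ ⟩
      n * n                        ∎
      where open ≡-Reasoning

    -- The density bound is multiplied by the left side: the powers of n and ν cancel, and each edge
    -- turns e * β into n².
    weighted-sidorenko : n ^ ∣ H ∣ᵛ * e ^ E H ≤ hc * n ^ (2 ℕ.* E H)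
    weighted-sidorenko = subst₂ _≤_ (*-identityʳ _) (begin
      n ^ ∣ H ∣ᵛ * e ^ E H * (β ^ E H * 𝔼 (indicator (isHom? H G)) h₀)
        ≡⟨ cong (λ x → n ^ ∣ H ∣ᵛ * e ^ E H * (β ^ E H * x)) (𝔼-isHom H G n≢0 h₀) ⟩
      n ^ ∣ H ∣ᵛ * e ^ E H * (β ^ E H * (ν ^ ∣ H ∣ᵛ * hc))
        ≡⟨ solve 5 (λ a b c d h → a :* b :* (c :* (d :* h)) := (a :* d) :* (h :* (b :* c))) refl
             (n ^ ∣ H ∣ᵛ) (e ^ E H) (β ^ E H) (ν ^ ∣ H ∣ᵛ) hc ⟩
      (n ^ ∣ H ∣ᵛ * ν ^ ∣ H ∣ᵛ) * (hc * (e ^ E H * β ^ E H))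
        ≡⟨ cong₂ (λ x y → x * (hc * y)) (^-distrib-* n ν ∣ H ∣ᵛ) (^-distrib-* e β (E H)) ⟨
      (n * ν) ^ ∣ H ∣ᵛ * (hc * (e * β) ^ E H)
        ≡⟨ cong₂ (λ x y → x ^ ∣ H ∣ᵛ * (hc * y ^ E H)) n*ν≡1 (trans e*β≡n*n (cong (n *_) (sym (*-identityʳ n)))) ⟩
      1# ^ ∣ H ∣ᵛ * (hc * (n ^ 2) ^ E H)
        ≡⟨ cong₂ (λ x y → x * (hc * y)) (1^ ∣ H ∣ᵛ) (^-assocʳ n 2 (E H)) ⟩
      1# * (hc * n ^ (2 ℕ.* E H))
        ≡⟨ *-identityˡ _ ⟩
      hc * n ^ (2 ℕ.* E H) ∎)
      (*-monoʳ-≤ (n ^ ∣ H ∣ᵛ * e ^ E H) (Main.homomorphism-density H G n≢0 β normalised D strong h₀))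
      where open ≡-Reasoning

    nondegenerate-sidorenko : ∣ G ∣ᵛ ℕ.^ ∣ H ∣ᵛ ℕ.* (2 ℕ.* E G) ℕ.^ E H ℕ.≤ homCount H G ℕ.* ∣ G ∣ᵛ ℕ.^ (2 ℕ.* E H)
    nondegenerate-sidorenko = fromℕ-cancel-≤ _ _ (subst₂ _≤_
      (sym (trans (fromℕ-* (∣ G ∣ᵛ ℕ.^ ∣ H ∣ᵛ) _) (cong₂ _*_ (fromℕ-^ ∣ G ∣ᵛ ∣ H ∣ᵛ) (fromℕ-^ (2 ℕ.* E G) (E H)))))
      (sym (trans (fromℕ-* (homCount H G) _) (cong (hc *_) (fromℕ-^ ∣ G ∣ᵛ (2 ℕ.* E H)))))
      weighted-sidorenko)

theorem1p2 : (H : Graph) → StronglyTreeDecomposable H → Sidorenko H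
theorem1p2 H (D , strong) G 1≤n with fromℕ (2 ℕ.* E G) ≟0
-- The kernel height inverts the edge density of G, so a graph G without edges is treated apart.
... | no e≢0  = nondegenerate-sidorenko H G 1≤n e≢0 D strong
... | yes e≡0 = no-edges (E H) refl
  where
  open ℕₚ.≤-Reasoning
  EG≡0 : 2 ℕ.* E G ≡ 0
  EG≡0 = ℕₚ.n≤0⇒n≡0 (fromℕ-cancel-≤ (2 ℕ.* E G) 0 (≤-reflexive e≡0))
  no-edges : ∀ d → E H ≡ d → ∣ G ∣ᵛ ℕ.^ ∣ H ∣ᵛ ℕ.* (2 ℕ.* E G) ℕ.^ d ℕ.≤ homCount H G ℕ.* ∣ G ∣ᵛ ℕ.^ (2 ℕ.* d)
  -- Here the edge term is 0 to the power 0, that is 1, and the bound demands that all maps are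
  -- homomorphisms; with an edge in H the left side is 0.
  no-edges zero    EH≡0 = begin
    ∣ G ∣ᵛ ℕ.^ ∣ H ∣ᵛ ℕ.* 1  ≡⟨ ℕₚ.*-identityʳ _ ⟩
    ∣ G ∣ᵛ ℕ.^ ∣ H ∣ᵛ        ≤⟨ edgeless-sidorenko H G 1≤n EH≡0 ⟩
    homCount H G             ≡⟨ ℕₚ.*-identityʳ _ ⟨
    homCount H G ℕ.* 1       ∎
  no-edges (suc d) _ = begin
    ∣ G ∣ᵛ ℕ.^ ∣ H ∣ᵛ ℕ.* (2 ℕ.* E G) ℕ.^ suc d  ≡⟨ cong (λ m → ∣ G ∣ᵛ ℕ.^ ∣ H ∣ᵛ ℕ.* (m ℕ.* (2 ℕ.* E G) ℕ.^ d)) EG≡0 ⟩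
    ∣ G ∣ᵛ ℕ.^ ∣ H ∣ᵛ ℕ.* 0                      ≡⟨ ℕₚ.*-zeroʳ (∣ G ∣ᵛ ℕ.^ ∣ H ∣ᵛ) ⟩
    0                                            ≤⟨ z≤n ⟩
    homCount H G ℕ.* ∣ G ∣ᵛ ℕ.^ (2 ℕ.* suc d)    ∎
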